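{- Let $f\colon\{0,1\}^n\to\{ -1,+1\}$ be a given function. Fix functions $g_i\colon X_i\times Y_i\to\{0,1\}$ for $i=1,2,\dots,n$, where $X_i,Y_i$ are finite sets. Assume that for each $i$, the matrix $[g_i(x^{(i)},y^{(i)})]_{x^{(i)}\in X_i,\,y^{(i)}\in Y_i}$ contains both of the following as submatrices, up to permutations of rows and columns: $$\begin{bmatrix}1&0\\0&0\end{bmatrix},\qquad\begin{bmatrix}0&1\\1&1\end{bmatrix}.$$ Assume that for some constant $c>0$, $$D(g_i)\le(\log_2\operatorname{rk}G_i)^c+c,\qquad i=1,2,\dots,n,$$ where $G_i=[(-1)^{g_i(x^{(i)},y^{(i)})}]_{x^{(i)}\in X_i,\,y^{(i)}\in Y_i}$. Then the matrix $F=[f(g_1(x^{(1)},y^{(1)}),\dots,g_n(x^{(n)},y^{(n)}))]$, with rows indexed by $(x^{(1)},\dots,x^{(n)})\in X_1\times\cdots\times X_n$ and columns indexed by $(y^{(1)},\dots,y^{(n)})\in Y_1\times\cdots\times Y_n$, obeys $$D(F)\le(\log_2\operatorname{rk}F)^C+C$$ for some constant $C=C(c)>0$ (depending only on $c$). In particular, $F$ satisfies the log-rank conjecture.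
   Context: The rank $\operatorname{rk}$ is over the reals. $D(h)$ is the deterministic two-party communication complexity of a two-valued function $h$ on $X\times Y$ (least worst-case number of bits exchanged by a deterministic protocol in which Alice holds the element of $X$ and Bob the element of $Y$); for a matrix it is the complexity of the associated function of (row index, column index), with Alice holding the row index and Bob the column index. The log-rank conjecture states that $D(F)\le(\log_2\operatorname{rk}F)^c+c$ for every Boolean ($\pm1$-valued) matrix $F$, for some absolute constant $c>0$. -}

module Defs where

open import Algebra.Bundles.Raw using (RawSemiring)
open import Data.Bool.Base using (Bool; true; false; if_then_else_)
open import Data.Fin.Base using (Fin; zero; suc)
open import Data.Integer.Base as ℤ using (+_)
import Data.Integer.Properties as ℤ
import Data.Integer.Solver as ℤ
open import Data.Nat.Base as ℕ using (ℕ; zero; suc; ⌊_/2⌋)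
import Data.Nat.Properties as ℕ
open import Data.Nat.Induction using (<-rec)
open import Data.Nat.Logarithm using (⌊log₂_⌋; ⌊log₂⌋-mono-≤; ⌊log₂[2^n]⌋≡n; ⌊log₂⌊n/2⌋⌋≡⌊log₂n⌋∸1)
open import Data.Product.Base using (Σ; ∃; _×_; _,_)
open import Data.Rational.Base as ℚ using (ℚ; 0ℚ; 1ℚ; ½; Positive; mkℚ; ∣_∣)
import Data.Rational.Properties as ℚ
import Data.Rational.Unnormalised.Base as ℚᵘ
import Data.Rational.Unnormalised.Properties as ℚᵘ
open import Data.Rational.Solver using (module +-*-Solver)
open import Data.Sign.Base as Sign using (Sign)
open import Data.Sum.Base using (inj₁; inj₂)
open import Data.Vec.Base using (Vec; tabulate)
open import Function.Base using (it)
open import Function.Definitions using (Injective)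
open import Level using (0ℓ)
open import Relation.Binary.PropositionalEquality
import Algebra.Definitions.RawSemiring as RawSemiringDefinitions

------------------------------------------------------------------------
-- Real numbers

IsCauchy : (ℕ → ℚ) → Set
IsCauchy s = ∀ ε .{{_ : Positive ε}} →
  ∃ λ N → ∀ {m n} → N ℕ.≤ m → N ℕ.≤ n → ∣ s m ℚ.- s n ∣ ℚ.≤ ε

-- A real is a Cauchy sequence of rationals; two sequences represent the same
-- real when they are related by _≈_ below.
record ℝ : Set where
  constructor mkℝ
  field
    seq    : ℕ → ℚ
    cauchy : IsCauchy seq

open ℝ public

infix 4 _≈_ _≤_ _<_

_≈_ : ℝ → ℝ → Set
x ≈ y = ∀ ε .{{_ : Positive ε}} →
  ∃ λ N → ∀ {n} → N ℕ.≤ n → ∣ seq x n ℚ.- seq y n ∣ ℚ.≤ ε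

_≤_ : ℝ → ℝ → Set
x ≤ y = ∀ ε .{{_ : Positive ε}} →
  ∃ λ N → ∀ {n} → N ℕ.≤ n → seq x n ℚ.≤ seq y n ℚ.+ ε

_<_ : ℝ → ℝ → Set
x < y = Σ ℚ λ ε → Positive ε ×
  (∃ λ N → ∀ {n} → N ℕ.≤ n → seq x n ℚ.+ ε ℚ.≤ seq y n)

fromℚ : ℚ → ℝ
fromℚ p = mkℝ (λ _ → p) λ ε → 0 , λ _ _ → begin
  ∣ p ℚ.- p ∣  ≡⟨ cong ∣_∣ (ℚ.+-inverseʳ p) ⟩
  0ℚ           ≤⟨ ℚ.<⇒≤ (ℚ.positive⁻¹ ε) ⟩
  ε            ∎
  where open ℚ.≤-Reasoning

fromℕ : ℕ → ℝ
fromℕ n = fromℚ (+ n ℚ./ 1)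

half+half : ∀ ε → ½ ℚ.* ε ℚ.+ ½ ℚ.* ε ≡ ε
half+half ε = trans (sym (ℚ.*-distribʳ-+ ε ½ ½)) (ℚ.*-identityˡ ε)

+-cauchy : ∀ {s t} → IsCauchy s → IsCauchy t → IsCauchy (λ n → s n ℚ.+ t n)
+-cauchy {s} {t} s-cauchy t-cauchy ε
  with M , bs ← s-cauchy (½ ℚ.* ε) {{ℚ.pos*pos⇒pos ½ ε}}
  with N , bt ← t-cauchy (½ ℚ.* ε) {{ℚ.pos*pos⇒pos ½ ε}}
  = M ℕ.⊔ N , λ {m} {n} m≥ n≥ → begin
    ∣ (s m ℚ.+ t m) ℚ.- (s n ℚ.+ t n) ∣      ≡⟨ cong ∣_∣ (rearrange (s m) (t m) (s n) (t n)) ⟩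
    ∣ (s m ℚ.- s n) ℚ.+ (t m ℚ.- t n) ∣      ≤⟨ ℚ.∣p+q∣≤∣p∣+∣q∣ (s m ℚ.- s n) (t m ℚ.- t n) ⟩
    ∣ s m ℚ.- s n ∣ ℚ.+ ∣ t m ℚ.- t n ∣      ≤⟨ ℚ.+-mono-≤
                                                  (bs (ℕ.m⊔n≤o⇒m≤o M N m≥) (ℕ.m⊔n≤o⇒m≤o M N n≥))
                                                  (bt (ℕ.m⊔n≤o⇒n≤o M N m≥) (ℕ.m⊔n≤o⇒n≤o M N n≥)) ⟩
    ½ ℚ.* ε ℚ.+ ½ ℚ.* ε                      ≡⟨ half+half ε ⟩
    ε                                        ∎
  where
  open ℚ.≤-Reasoning
  rearrange : ∀ a b c d → (a ℚ.+ b) ℚ.- (c ℚ.+ d) ≡ (a ℚ.- c) ℚ.+ (b ℚ.- d)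
  rearrange = solve 4 (λ a b c d → (a :+ b) :- (c :+ d) := (a :- c) :+ (b :- d)) refl
    where open +-*-Solver

eventually-bounded : ∀ {s} → IsCauchy s →
  Σ ℚ λ B → Positive B × ∃ λ N → ∀ {n} → N ℕ.≤ n → ∣ s n ∣ ℚ.≤ B
eventually-bounded {s} s-cauchy with N , b ← s-cauchy 1ℚ =
  ∣ s N ∣ ℚ.+ 1ℚ , ℚ.nonNeg+pos⇒pos ∣ s N ∣ {{ℚ.∣-∣-nonNeg (s N)}} 1ℚ , N , λ {n} n≥ → begin
    ∣ s n ∣                          ≡⟨ cong ∣_∣ (rearrange (s n) (s N)) ⟩
    ∣ s N ℚ.+ (s n ℚ.- s N) ∣        ≤⟨ ℚ.∣p+q∣≤∣p∣+∣q∣ (s N) (s n ℚ.- s N) ⟩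
    ∣ s N ∣ ℚ.+ ∣ s n ℚ.- s N ∣      ≤⟨ ℚ.+-monoʳ-≤ ∣ s N ∣ (b n≥ ℕ.≤-refl) ⟩
    ∣ s N ∣ ℚ.+ 1ℚ                   ∎
  where
  open ℚ.≤-Reasoning
  rearrange : ∀ a b → a ≡ b ℚ.+ (a ℚ.- b)
  rearrange = solve 2 (λ a b → a := b :+ (a :- b)) refl
    where open +-*-Solver

∣*∣-mono-≤ : ∀ p q {B C} → .{{_ : Positive B}} → ∣ p ∣ ℚ.≤ B → ∣ q ∣ ℚ.≤ C → ∣ p ℚ.* q ∣ ℚ.≤ B ℚ.* C
∣*∣-mono-≤ p q {B} {C} p≤ q≤ = begin
  ∣ p ℚ.* q ∣        ≡⟨ ℚ.∣p*q∣≡∣p∣*∣q∣ p q ⟩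
  ∣ p ∣ ℚ.* ∣ q ∣    ≤⟨ ℚ.*-monoʳ-≤-nonNeg ∣ q ∣ {{ℚ.∣-∣-nonNeg q}} p≤ ⟩
  B ℚ.* ∣ q ∣        ≤⟨ ℚ.*-monoˡ-≤-nonNeg B {{ℚ.pos⇒nonNeg B}} q≤ ⟩
  B ℚ.* C            ∎
  where open ℚ.≤-Reasoning

shrink : ∀ ε K .{{_ : Positive ε}} .{{_ : Positive K}} → Σ ℚ λ δ → Positive δ × K ℚ.* δ ≡ ε
shrink ε K = ε ℚ.* 1/K , ℚ.pos*pos⇒pos ε 1/K , (begin
  K ℚ.* (ε ℚ.* 1/K)    ≡⟨ ℚ.*-comm K (ε ℚ.* 1/K) ⟩
  (ε ℚ.* 1/K) ℚ.* K    ≡⟨ ℚ.*-assoc ε 1/K K ⟩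
  ε ℚ.* (1/K ℚ.* K)    ≡⟨ cong (ε ℚ.*_) (ℚ.*-inverseˡ K) ⟩
  ε ℚ.* 1ℚ             ≡⟨ ℚ.*-identityʳ ε ⟩
  ε                    ∎)
  where
  open ≡-Reasoning
  instance
    K-nonZero : ℚ.NonZero K
    K-nonZero = ℚ.pos⇒nonZero K
  1/K : ℚ
  1/K = ℚ.1/ K
  instance
    1/K-pos : Positive 1/K
    1/K-pos = ℚ.1/pos⇒pos K

product-difference : ∀ a b c d {B C δ} → .{{_ : Positive B}} → .{{_ : Positive C}} →
  ∣ a ∣ ℚ.≤ B → ∣ d ∣ ℚ.≤ C → ∣ a ℚ.- c ∣ ℚ.≤ δ → ∣ b ℚ.- d ∣ ℚ.≤ δ →
  ∣ a ℚ.* b ℚ.- c ℚ.* d ∣ ℚ.≤ (B ℚ.+ C) ℚ.* δ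
product-difference a b c d {B} {C} {δ} a≤B d≤C a-c≤δ b-d≤δ = begin
  ∣ a ℚ.* b ℚ.- c ℚ.* d ∣
    ≡⟨ cong ∣_∣ (rearrange a b c d) ⟩
  ∣ a ℚ.* (b ℚ.- d) ℚ.+ d ℚ.* (a ℚ.- c) ∣
    ≤⟨ ℚ.∣p+q∣≤∣p∣+∣q∣ (a ℚ.* (b ℚ.- d)) (d ℚ.* (a ℚ.- c)) ⟩
  ∣ a ℚ.* (b ℚ.- d) ∣ ℚ.+ ∣ d ℚ.* (a ℚ.- c) ∣
    ≤⟨ ℚ.+-mono-≤ (∣*∣-mono-≤ a (b ℚ.- d) a≤B b-d≤δ) (∣*∣-mono-≤ d (a ℚ.- c) d≤C a-c≤δ) ⟩
  B ℚ.* δ ℚ.+ C ℚ.* δ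
    ≡⟨ ℚ.*-distribʳ-+ δ B C ⟨
  (B ℚ.+ C) ℚ.* δ
    ∎
  where
  open ℚ.≤-Reasoning
  rearrange : ∀ a b c d → a ℚ.* b ℚ.- c ℚ.* d ≡ a ℚ.* (b ℚ.- d) ℚ.+ d ℚ.* (a ℚ.- c)
  rearrange = solve 4 (λ a b c d → a :* b :- c :* d := a :* (b :- d) :+ d :* (a :- c)) refl
    where open +-*-Solver

*-cauchy : ∀ {s t} → IsCauchy s → IsCauchy t → IsCauchy (λ n → s n ℚ.* t n)
*-cauchy {s} {t} s-cauchy t-cauchy ε =
  let
    B , B>0 , K , s≤B = eventually-bounded s-cauchy
    C , C>0 , L , t≤C = eventually-bounded t-cauchy
    B+C>0 = ℚ.pos+pos⇒pos B {{B>0}} C {{C>0}}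
    δ , δ>0 , [B+C]δ≡ε = shrink ε (B ℚ.+ C) {{it}} {{B+C>0}}
    M , s-close = s-cauchy δ {{δ>0}}
    N , t-close = t-cauchy δ {{δ>0}}
  in (K ℕ.⊔ L) ℕ.⊔ (M ℕ.⊔ N) , λ {m} {n} m≥ n≥ →
    let
      m≥KL = ℕ.m⊔n≤o⇒m≤o (K ℕ.⊔ L) (M ℕ.⊔ N) m≥
      m≥MN = ℕ.m⊔n≤o⇒n≤o (K ℕ.⊔ L) (M ℕ.⊔ N) m≥
      n≥KL = ℕ.m⊔n≤o⇒m≤o (K ℕ.⊔ L) (M ℕ.⊔ N) n≥
      n≥MN = ℕ.m⊔n≤o⇒n≤o (K ℕ.⊔ L) (M ℕ.⊔ N) n≥
    in subst (∣ s m ℚ.* t m ℚ.- s n ℚ.* t n ∣ ℚ.≤_) [B+C]δ≡ε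
      (product-difference (s m) (t m) (s n) (t n) {{B>0}} {{C>0}}
        (s≤B (ℕ.m⊔n≤o⇒m≤o K L m≥KL))
        (t≤C (ℕ.m⊔n≤o⇒n≤o K L n≥KL))
        (s-close (ℕ.m⊔n≤o⇒m≤o M N m≥MN) (ℕ.m⊔n≤o⇒m≤o M N n≥MN))
        (t-close (ℕ.m⊔n≤o⇒n≤o M N m≥MN) (ℕ.m⊔n≤o⇒n≤o M N n≥MN)))

ℝ-rawSemiring : RawSemiring 0ℓ 0ℓ
ℝ-rawSemiring = record
  { Carrier = ℝ
  ; _≈_     = _≈_
  ; _+_     = λ x y → mkℝ (λ n → seq x n ℚ.+ seq y n) (+-cauchy {seq x} {seq y} (cauchy x) (cauchy y))
  ; _*_     = λ x y → mkℝ (λ n → seq x n ℚ.* seq y n) (*-cauchy {seq x} {seq y} (cauchy x) (cauchy y))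
  ; 0#      = fromℚ 0ℚ
  ; 1#      = fromℚ 1ℚ
  }

open RawSemiring ℝ-rawSemiring public using (_+_; _*_; 0#; 1#)
open RawSemiringDefinitions ℝ-rawSemiring public using (sum; _^_)

------------------------------------------------------------------------
-- Logarithms and real powers

2*⌊n/2⌋≤n : ∀ n → 2 ℕ.* ⌊ n /2⌋ ℕ.≤ n
2*⌊n/2⌋≤n n = begin
  2 ℕ.* ⌊ n /2⌋               ≡⟨ cong (⌊ n /2⌋ ℕ.+_) (ℕ.+-identityʳ ⌊ n /2⌋) ⟩
  ⌊ n /2⌋ ℕ.+ ⌊ n /2⌋         ≤⟨ ℕ.+-monoʳ-≤ ⌊ n /2⌋ (ℕ.⌊n/2⌋≤⌈n/2⌉ n) ⟩
  ⌊ n /2⌋ ℕ.+ ℕ.⌈ n /2⌉       ≡⟨ ℕ.⌊n/2⌋+⌈n/2⌉≡n n ⟩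
  n                           ∎
  where open ℕ.≤-Reasoning

2^⌊log₂n⌋≤n : ∀ n .{{_ : ℕ.NonZero n}} → 2 ℕ.^ ⌊log₂ n ⌋ ℕ.≤ n
2^⌊log₂n⌋≤n n = <-rec P (λ n rec n≢0 → step n ⌊log₂ n ⌋ refl rec n≢0) n (ℕ.>-nonZero⁻¹ n)
  where
  P : ℕ → Set
  P n = 0 ℕ.< n → 2 ℕ.^ ⌊log₂ n ⌋ ℕ.≤ n

  double : ∀ n l → ⌊log₂ n ⌋ ≡ suc l → 2 ℕ.^ ⌊log₂ ⌊ n /2⌋ ⌋ ℕ.≤ ⌊ n /2⌋ → 2 ℕ.^ suc l ℕ.≤ n
  double n l eq half = begin
    2 ℕ.* 2 ℕ.^ l                    ≡⟨ cong (λ j → 2 ℕ.* 2 ℕ.^ j)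
                                          (trans (⌊log₂⌊n/2⌋⌋≡⌊log₂n⌋∸1 n) (cong ℕ.pred eq)) ⟨
    2 ℕ.* 2 ℕ.^ ⌊log₂ ⌊ n /2⌋ ⌋      ≤⟨ ℕ.*-monoʳ-≤ 2 half ⟩
    2 ℕ.* ⌊ n /2⌋                    ≤⟨ 2*⌊n/2⌋≤n n ⟩
    n                                ∎
    where open ℕ.≤-Reasoning

  step : ∀ n l → ⌊log₂ n ⌋ ≡ l → (∀ {m} → m ℕ.< n → P m) → 0 ℕ.< n → 2 ℕ.^ l ℕ.≤ n
  step n             zero    _  _   n>0 = n>0
  step (suc (suc k)) (suc l) eq rec _   =
    double (suc (suc k)) l eq (rec (ℕ.⌊n/2⌋<n (suc k)) (ℕ.s≤s ℕ.z≤n))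

n<2^[1+⌊log₂n⌋] : ∀ n → n ℕ.< 2 ℕ.^ suc ⌊log₂ n ⌋
n<2^[1+⌊log₂n⌋] n = ℕ.≰⇒> λ 2^≤n → ℕ.<-irrefl refl
  (subst (ℕ._≤ ⌊log₂ n ⌋) (⌊log₂[2^n]⌋≡n (suc ⌊log₂ n ⌋)) (⌊log₂⌋-mono-≤ 2^≤n))

module Log₂Approximation (r : ℕ) .{{_ : ℕ.NonZero r}} where

  ℓ : ℕ → ℕ
  ℓ k = ⌊log₂ r ℕ.^ suc k ⌋

  approximation : ℕ → ℚ
  approximation k = + ℓ k ℚ./ suc k

  cross : ∀ m n → ℓ m ℕ.* suc n ℕ.≤ suc (ℓ n) ℕ.* suc m
  cross m n = ℕ.≮⇒≥ λ lt → ℕ.<-irrefl refl (begin-strict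
    2 ℕ.^ (ℓ m ℕ.* suc n)            ≡⟨ ℕ.^-*-assoc 2 (ℓ m) (suc n) ⟨
    (2 ℕ.^ ℓ m) ℕ.^ suc n            ≤⟨ ℕ.^-monoˡ-≤ (suc n) (2^⌊log₂n⌋≤n (r ℕ.^ suc m) {{ℕ.m^n≢0 r (suc m)}}) ⟩
    (r ℕ.^ suc m) ℕ.^ suc n          ≡⟨ ℕ.^-*-assoc r (suc m) (suc n) ⟩
    r ℕ.^ (suc m ℕ.* suc n)          ≡⟨ cong (r ℕ.^_) (ℕ.*-comm (suc m) (suc n)) ⟩
    r ℕ.^ (suc n ℕ.* suc m)          ≡⟨ ℕ.^-*-assoc r (suc n) (suc m) ⟨
    (r ℕ.^ suc n) ℕ.^ suc m          ≤⟨ ℕ.^-monoˡ-≤ (suc m) (ℕ.<⇒≤ (n<2^[1+⌊log₂n⌋] (r ℕ.^ suc n))) ⟩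
    (2 ℕ.^ suc (ℓ n)) ℕ.^ suc m      ≡⟨ ℕ.^-*-assoc 2 (suc (ℓ n)) (suc m) ⟩
    2 ℕ.^ (suc (ℓ n) ℕ.* suc m)      <⟨ ℕ.^-monoʳ-< 2 ℕ.≤-refl lt ⟩
    2 ℕ.^ (ℓ m ℕ.* suc n)            ∎)
    where open ℕ.≤-Reasoning

  successor : ∀ n → + suc (ℓ n) ℚ./ suc n ≡ approximation n ℚ.+ + 1 ℚ./ suc n
  successor n = ℚ.toℚᵘ-injective (begin
    ℚ.toℚᵘ (ℚ.fromℚᵘ 1+p)                            ≈⟨ ℚ.toℚᵘ-fromℚᵘ 1+p ⟩
    1+p                                              ≈⟨ ℚᵘ.*≡* (solve 2 (λ a d → (con (+ 1) :+ a) :* (d :* d) := (a :* d :+ con (+ 1) :* d) :* d) refl (+ ℓ n) (+ suc n)) ⟩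
    p ℚᵘ.+ q                                         ≈⟨ ℚᵘ.+-cong (ℚ.toℚᵘ-fromℚᵘ p) (ℚ.toℚᵘ-fromℚᵘ q) ⟨
    ℚ.toℚᵘ (ℚ.fromℚᵘ p) ℚᵘ.+ ℚ.toℚᵘ (ℚ.fromℚᵘ q)     ≈⟨ ℚ.toℚᵘ-homo-+ (ℚ.fromℚᵘ p) (ℚ.fromℚᵘ q) ⟨
    ℚ.toℚᵘ (ℚ.fromℚᵘ p ℚ.+ ℚ.fromℚᵘ q)               ∎)
    where
    open import Relation.Binary.Reasoning.Setoid ℚᵘ.≃-setoid
    open ℤ.+-*-Solver
    1+p p q : ℚᵘ.ℚᵘ
    1+p = ℚᵘ.mkℚᵘ (+ suc (ℓ n)) n
    p = ℚᵘ.mkℚᵘ (+ ℓ n) n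
    q = ℚᵘ.mkℚᵘ (+ 1) n

  approximation-≤ : ∀ m n → approximation m ℚ.≤ approximation n ℚ.+ + 1 ℚ./ suc n
  approximation-≤ m n = subst (approximation m ℚ.≤_) (successor n) (ℚ.toℚᵘ-cancel-≤ (begin
    ℚ.toℚᵘ (ℚ.fromℚᵘ p)   ≃⟨ ℚ.toℚᵘ-fromℚᵘ p ⟩
    p                     ≤⟨ ℚᵘ.*≤* (subst₂ ℤ._≤_ (ℤ.pos-* (ℓ m) (suc n)) (ℤ.pos-* (suc (ℓ n)) (suc m))
                               (ℤ.+≤+ (cross m n))) ⟩
    q                     ≃⟨ ℚ.toℚᵘ-fromℚᵘ q ⟨
    ℚ.toℚᵘ (ℚ.fromℚᵘ q)   ∎))
    where
    open ℚᵘ.≤-Reasoning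
    p q : ℚᵘ.ℚᵘ
    p = ℚᵘ.mkℚᵘ (+ ℓ m) m
    q = ℚᵘ.mkℚᵘ (+ suc (ℓ n)) n

  1/n≤ε : ∀ ε .{{_ : Positive ε}} {n} → ℚ.↧ₙ ε ℕ.≤ n → + 1 ℚ./ suc n ℚ.≤ ε
  1/n≤ε ε@(mkℚ (+ suc p) d _) {n} d≤n = ℚ.toℚᵘ-cancel-≤ (begin
    ℚ.toℚᵘ (ℚ.fromℚᵘ q)      ≃⟨ ℚ.toℚᵘ-fromℚᵘ q ⟩
    q                        ≤⟨ ℚᵘ.*≤* (ℤ.+≤+ (ℕ.*-mono-≤ {1} {suc p} {suc d} {suc n} (ℕ.s≤s ℕ.z≤n) (ℕ.m≤n⇒m≤1+n d≤n))) ⟩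
    ℚ.toℚᵘ ε                 ∎)
    where
    open ℚᵘ.≤-Reasoning
    q : ℚᵘ.ℚᵘ
    q = ℚᵘ.mkℚᵘ (+ 1) n

  log₂-cauchy : IsCauchy approximation
  log₂-cauchy ε = ℚ.↧ₙ ε , λ {m} {n} m≥ n≥ → ∣p-q∣≤ε (approximation m) (approximation n)
    (ℚ.≤-trans (approximation-≤ m n) (ℚ.+-monoʳ-≤ (approximation n) (1/n≤ε ε n≥)))
    (ℚ.≤-trans (approximation-≤ n m) (ℚ.+-monoʳ-≤ (approximation m) (1/n≤ε ε m≥)))
    where
    ≤-shift : ∀ a b → a ℚ.≤ b ℚ.+ ε → a ℚ.- b ℚ.≤ ε
    ≤-shift a b a≤b+ε = begin
      a ℚ.- b              ≤⟨ ℚ.+-monoˡ-≤ (ℚ.- b) a≤b+ε ⟩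
      b ℚ.+ ε ℚ.- b        ≡⟨ solve 2 (λ b ε → b :+ ε :- b := ε) refl b ε ⟩
      ε                    ∎
      where
      open ℚ.≤-Reasoning
      open +-*-Solver

    ∣p-q∣≤ε : ∀ p q → p ℚ.≤ q ℚ.+ ε → q ℚ.≤ p ℚ.+ ε → ∣ p ℚ.- q ∣ ℚ.≤ ε
    ∣p-q∣≤ε p q p≤ q≤ with ℚ.∣p∣≡p∨∣p∣≡-p (p ℚ.- q)
    ... | inj₁ eq = subst (ℚ._≤ ε) (sym eq) (≤-shift p q p≤)
    ... | inj₂ eq = subst (ℚ._≤ ε) (sym (trans eq (solve 2 (λ p q → :- (p :- q) := q :- p) refl p q))) (≤-shift q p q≤)
      where open +-*-Solver

-- The k-th approximation is ⌊log₂ r^(k+1)⌋ / (k+1), which lies within 1/(k+1)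
-- of log₂ r. The value at 0 is junk.
log₂ : ℕ → ℝ
log₂ zero      = 0#
log₂ r@(suc _) = mkℝ (approximation r) (log₂-cauchy r)
  where open Log₂Approximation

-- The graph of real exponentiation: for x ≥ 0 and c > 0, IsPower x c y says that
-- y = x^c. Here y is pinned down by comparison with the rational powers x^(p/q):
-- for 1 ≤ x the exponential is increasing, so p/q ≤ c forces x^(p/q) ≤ y, that is
-- x^p ≤ y^q, and c ≤ p/q forces y^q ≤ x^p; for x ≤ 1 it is decreasing.
record IsPower (x c y : ℝ) : Set where
  field
    nonNegative : 0# ≤ y
    increasing  : 1# ≤ x → ∀ p q .{{_ : ℕ.NonZero q}} →
      (fromℕ p ≤ fromℕ q * c → x ^ p ≤ y ^ q) ×
      (fromℕ q * c ≤ fromℕ p → y ^ q ≤ x ^ p)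
    decreasing  : x ≤ 1# → ∀ p q .{{_ : ℕ.NonZero q}} →
      (fromℕ p ≤ fromℕ q * c → y ^ q ≤ x ^ p) ×
      (fromℕ q * c ≤ fromℕ p → x ^ p ≤ y ^ q)

------------------------------------------------------------------------
-- Matrices, submatrices and rank

Matrix : Set → Set → Set → Set
Matrix A I J = I → J → A

-- Distinct rows and distinct columns may be taken in any order, so the containment
-- is up to permutations of rows and columns.
ContainsSubmatrix : ∀ {A I J K L} → Matrix A K L → Matrix A I J → Set
ContainsSubmatrix S M = ∃ λ ρ → ∃ λ κ →
  Injective _≡_ _≡_ ρ × Injective _≡_ _≡_ κ × (∀ k l → M (ρ k) (κ l) ≡ S k l)

matrix₂₂ : ∀ {A} → A → A → A → A → Matrix A (Fin 2) (Fin 2)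
matrix₂₂ a b c d zero       zero       = a
matrix₂₂ a b c d zero       (suc zero) = b
matrix₂₂ a b c d (suc zero) zero       = c
matrix₂₂ a b c d (suc zero) (suc zero) = d

LinearlyIndependent : ∀ {I s} → (Fin s → I → ℝ) → Set
LinearlyIndependent {s = s} v = (a : Fin s → ℝ) →
  (∀ i → sum (λ k → a k * v k i) ≈ 0#) → ∀ k → a k ≈ 0#

-- The rank is the maximal number of linearly independent columns.
IsRank : ∀ {I J} → Matrix ℝ I J → ℕ → Set
IsRank {I} {J} M r =
  (∃ λ (κ : Fin r → J) → LinearlyIndependent (λ k i → M i (κ k))) ×
  (∀ {s} (κ : Fin s → J) → LinearlyIndependent (λ k i → M i (κ k)) → s ℕ.≤ r)

signToℝ : Sign → ℝ
signToℝ Sign.+ = fromℚ 1ℚ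
signToℝ Sign.- = fromℚ (ℚ.- 1ℚ)

-1^_ : Bool → Sign
-1^ true  = Sign.-
-1^ false = Sign.+

------------------------------------------------------------------------
-- Deterministic communication complexity

-- At an inner node the named party sends one bit, a function of that party's own
-- input and of the node (that is, of the bits exchanged so far).
data Protocol (X Y Z : Set) : Set where
  output : Z → Protocol X Y Z
  alice  : (X → Bool) → (if-true if-false : Protocol X Y Z) → Protocol X Y Z
  bob    : (Y → Bool) → (if-true if-false : Protocol X Y Z) → Protocol X Y Z

run : ∀ {X Y Z} → Protocol X Y Z → X → Y → Z
run (output z)    x y = z
run (alice b t f) x y = if b x then run t x y else run f x y
run (bob b t f)   x y = if b y then run t x y else run f x y

cost : ∀ {X Y Z} → Protocol X Y Z → ℕ
cost (output z)    = 0
cost (alice b t f) = suc (cost t ℕ.⊔ cost f)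
cost (bob b t f)   = suc (cost t ℕ.⊔ cost f)

Computes : ∀ {X Y Z} → Protocol X Y Z → (X → Y → Z) → Set
Computes π h = ∀ x y → run π x y ≡ h x y

IsCommunicationComplexity : ∀ {X Y Z} → (X → Y → Z) → ℕ → Set
IsCommunicationComplexity h d =
  (∃ λ π → Computes π h × cost π ≡ d) × (∀ π → Computes π h → d ℕ.≤ cost π)

------------------------------------------------------------------------
-- The log-rank bound and composed functions

-- D(h) ≤ (log₂ (rk M))^c + c.
LogRankBound : ∀ {X Y Z} → (X → Y → Z) → Matrix Sign X Y → ℝ → Set
LogRankBound h M c = ∃ λ d → ∃ λ r → ∃ λ y →
  IsCommunicationComplexity h d ×
  IsRank (λ i j → signToℝ (M i j)) r ×
  IsPower (log₂ r) c y ×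
  fromℕ d ≤ y + c

compose : ∀ {n} {X Y : Fin n → Set} {A B : Set} →
  (Vec A n → B) → (∀ i → X i → Y i → A) → (∀ i → X i) → (∀ i → Y i) → B
compose f g x y = f (tabulate λ i → g i (x i) (y i))

{-# OPTIONS --safe #-}

-- Write F = f(g₁,…,gₙ) and r = rk F. Choosing an AND or an OR submatrix in every gᵢ,
-- F contains f ∘ gates z for every z, and the rank of f ∘ gates z is the number of
-- monomials of f after negating the inputs of the OR gates. Passing from a derivative of
-- f to f multiplies that number by 3/2 for a suitable gate, so (3/2)^deg f ≤ r. A function
-- of degree d has a decision tree of depth polynomial in d: disjoint monomials of top
-- degree contain disjoint blocks that flip f at 0, Markov's inequality for t ↦ E f (with
-- each block switched on with probability t) bounds their number, and querying a maximal
-- family of them lowers the degree. A queried variable is one that f depends on, so that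
-- F contains ±Gᵢ, whence rk Gᵢ ≤ r and the query costs D(gᵢ) ≤ (log₂ r)^c + c.
module Submission where

open import Defs hiding (_≤_; _+_; _*_; _^_; sum)
open import Algebra.Bundles using (module CommutativeRing)
import Algebra.Properties.Semiring.Exp
import Algebra.Properties.Semiring.Sum
open import Data.Bool.Base using (Bool; true; false; if_then_else_; not; _∧_; _∨_)
import Data.Bool.Properties as Bool
open import Data.Fin.Base as Fin using (Fin; zero; suc; punchIn; splitAt; _↑ˡ_; _↑ʳ_)
import Data.Fin.Properties as Fin
import Data.Fin.Subset as Subset
open import Data.Fin.Subset.Properties using (anySubset?)
import Data.Integer.Base as ℤ
import Data.Integer.Properties as ℤ
open import Data.List.Base as List using (List; []; _∷_; _++_; length)
import Data.List.Properties as List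
import Data.List.Membership.DecPropositional
open import Data.List.Membership.Propositional using (_∈_; _∉_)
open import Data.List.Membership.Propositional.Properties using (∈-++⁺ˡ; ∈-++⁺ʳ; ∈-map⁺)
open import Data.List.Relation.Unary.Any using (here; there)
open import Data.Nat.Base as ℕ using (ℕ; zero; suc; z≤n; s≤s; _!)
open import Data.Nat.Combinatorics using (nCk≡n!/k![n-k]!; nCk+nC[k+1]≡[n+1]C[k+1]; k![n∸k]!∣n!) renaming (_C_ to _choose_)
open import Data.Nat.DivMod using (m/n*n≡m)
open import Data.Nat.Logarithm using (⌊log₂_⌋; ⌊log₂⌋-mono-≤; ⌊log₂[2^n]⌋≡n)
import Data.Nat.Properties as ℕ
import Data.Nat.Tactic.RingSolver as ℕ-Ring
open import Data.Product.Base using (Σ; ∃; _×_; _,_; proj₁; proj₂)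
open import Data.Rational.Base as ℚ using (ℚ; 0ℚ; 1ℚ; ½; _+_; _*_; _-_; -_; _≤_; ∣_∣; NonNegative; Positive)
import Data.Rational.Properties as ℚ
open import Data.Rational.Solver using (module +-*-Solver)
import Data.Rational.Unnormalised.Base as ℚᵘ
import Data.Rational.Unnormalised.Properties as ℚᵘ
open import Data.Sign.Base as Sign using (Sign)
import Data.Sign.Properties as Sign
open import Data.Sum.Base using (_⊎_; inj₁; inj₂; [_,_]′)
open import Data.Vec.Base using (Vec; []; _∷_; lookup; replicate; tabulate; tail; _[_]≔_)
open import Data.Vec.Functional using (insertAt)
import Data.Vec.Functional.Properties as Vector
import Data.Vec.Properties as Vec
open import Function.Base using (_∘_; it)
open import Relation.Binary.PropositionalEquality
open import Relation.Nullary using (Dec; ¬_; yes; no; contradiction)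
open import Relation.Nullary.Decidable using (_×-dec_; _→-dec_; _⊎-dec_; ¬?; decidable-stable) renaming (map′ to map-dec)

open +-*-Solver using (solve; _:+_; _:*_; _:-_; :-_; con; _:=_)
open Algebra.Properties.Semiring.Exp (CommutativeRing.semiring ℚ.+-*-commutativeRing) using (_^_; ^-assocʳ)
open Algebra.Properties.Semiring.Sum (CommutativeRing.semiring ℚ.+-*-commutativeRing)
  using (sum; sum-cong-≗; sum-remove; sum-replicate-zero; ∑-comm; *-distribˡ-sum; *-distribʳ-sum)
open module FinMembership {n} = Data.List.Membership.DecPropositional (Fin._≟_ {n}) using (_∈?_)

-- Naturals as rationals

-- No fixed choice of gates can serve: every choice admits a function of degree n with only two
-- monomials, such as 1 - 2 x_1 ... x_n when all gates are AND. The choice therefore follows a given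
-- monomial of f, coordinate by coordinate. Markov's inequality is needed only at 0 and up to a
-- polynomial factor. Nodes k²/m² crowd near 0 as Chebyshev nodes do, and squaring arranges them
-- symmetrically about the node 0, which thereby receives the central binomial coefficient, the
-- largest weight of its row. Equally spaced nodes ending at 0 would cost an exponential factor.
-- `LogRankBound` asserts that a communication complexity, a rank and a real power exist, and each
-- has to be constructed: the rank by elimination over the rationals, the complexity by exhaustive
-- search over rectangles, the power by taking C natural. Since reals are Cauchy sequences,
-- independence is carried through as a statement about null sequences of rationals, and the
-- comparison of log₂ r with 1, undecidable for general reals, is settled from r.

ι : ℕ → ℚ
ι n = ℤ.+ n ℚ./ 1

toℚᵘ-ι : ∀ n → ℚ.toℚᵘ (ι n) ℚᵘ.≃ ℚᵘ.mkℚᵘ (ℤ.+ n) 0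
toℚᵘ-ι n = ℚ.toℚᵘ-fromℚᵘ (ℚᵘ.mkℚᵘ (ℤ.+ n) 0)

ι-+ : ∀ m n → ι (m ℕ.+ n) ≡ ι m + ι n
ι-+ m n = ℚ.toℚᵘ-injective (begin
  ℚ.toℚᵘ (ι (m ℕ.+ n))                        ≈⟨ toℚᵘ-ι (m ℕ.+ n) ⟩
  ℚᵘ.mkℚᵘ (ℤ.+ (m ℕ.+ n)) 0                     ≈⟨ ℚᵘ.*≡* (cong (ℤ._* ℤ.+ 1) (cong₂ ℤ._+_ (sym (ℤ.*-identityʳ (ℤ.+ m))) (sym (ℤ.*-identityʳ (ℤ.+ n))))) ⟩
  ℚᵘ.mkℚᵘ (ℤ.+ m) 0 ℚᵘ.+ ℚᵘ.mkℚᵘ (ℤ.+ n) 0        ≈⟨ ℚᵘ.+-cong (toℚᵘ-ι m) (toℚᵘ-ι n) ⟨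
  ℚ.toℚᵘ (ι m) ℚᵘ.+ ℚ.toℚᵘ (ι n)              ≈⟨ ℚ.toℚᵘ-homo-+ (ι m) (ι n) ⟨
  ℚ.toℚᵘ (ι m + ι n)                          ∎)
  where open import Relation.Binary.Reasoning.Setoid ℚᵘ.≃-setoid

ι-* : ∀ m n → ι (m ℕ.* n) ≡ ι m * ι n
ι-* m n = ℚ.toℚᵘ-injective (begin
  ℚ.toℚᵘ (ι (m ℕ.* n))                        ≈⟨ toℚᵘ-ι (m ℕ.* n) ⟩
  ℚᵘ.mkℚᵘ (ℤ.+ (m ℕ.* n)) 0                     ≈⟨ ℚᵘ.*≡* (cong (ℤ._* ℤ.+ 1) (ℤ.pos-* m n)) ⟩
  ℚᵘ.mkℚᵘ (ℤ.+ m) 0 ℚᵘ.* ℚᵘ.mkℚᵘ (ℤ.+ n) 0        ≈⟨ ℚᵘ.*-cong (toℚᵘ-ι m) (toℚᵘ-ι n) ⟨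
  ℚ.toℚᵘ (ι m) ℚᵘ.* ℚ.toℚᵘ (ι n)              ≈⟨ ℚ.toℚᵘ-homo-* (ι m) (ι n) ⟨
  ℚ.toℚᵘ (ι m * ι n)                          ∎)
  where open import Relation.Binary.Reasoning.Setoid ℚᵘ.≃-setoid

ι-mono-≤ : ∀ {m n} → m ℕ.≤ n → ι m ≤ ι n
ι-mono-≤ {m} {n} m≤n = ℚ.toℚᵘ-cancel-≤ (begin
  ℚ.toℚᵘ (ι m)       ≃⟨ toℚᵘ-ι m ⟩
  ℚᵘ.mkℚᵘ (ℤ.+ m) 0    ≤⟨ ℚᵘ.*≤* (ℤ.*-monoʳ-≤-nonNeg (ℤ.+ 1) (ℤ.+≤+ m≤n)) ⟩
  ℚᵘ.mkℚᵘ (ℤ.+ n) 0    ≃⟨ toℚᵘ-ι n ⟨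
  ℚ.toℚᵘ (ι n)       ∎)
  where open ℚᵘ.≤-Reasoning

ι-cancel-≤ : ∀ {m n} → ι m ≤ ι n → m ℕ.≤ n
ι-cancel-≤ {m} {n} m≤n
  with ℚᵘ.*≤* p ← ℚᵘ.≤-respˡ-≃ (toℚᵘ-ι m) (ℚᵘ.≤-respʳ-≃ (toℚᵘ-ι n) (ℚ.toℚᵘ-mono-≤ m≤n))
  = ℤ.drop‿+≤+ (ℤ.*-cancelʳ-≤-pos (ℤ.+ m) (ℤ.+ n) (ℤ.+ 1) p)

ι-nonNeg : ∀ n → NonNegative (ι n)
ι-nonNeg n = ℚ.normalize-nonNeg n 1

ι-pos : ∀ n .{{_ : ℕ.NonZero n}} → Positive (ι n)
ι-pos n = ℚ.normalize-pos n 1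

ι-suc : ∀ n → ι (suc n) ≡ ι n + 1ℚ
ι-suc n = trans (ι-+ 1 n) (ℚ.+-comm 1ℚ (ι n))

-- Central binomial coefficients

central-factorial : ∀ m → ((m ℕ.* 2) choose m) ℕ.* (m ! ℕ.* m !) ≡ (m ℕ.* 2) !
central-factorial m = begin
  ((m ℕ.* 2) choose m) ℕ.* (m ! ℕ.* m !)                        ≡⟨ cong (λ k → ((m ℕ.* 2) choose m) ℕ.* (m ! ℕ.* k !)) 2m∸m≡m ⟨
  ((m ℕ.* 2) choose m) ℕ.* (m ! ℕ.* (m ℕ.* 2 ℕ.∸ m) !)          ≡⟨ cong (ℕ._* (m ! ℕ.* (m ℕ.* 2 ℕ.∸ m) !)) (nCk≡n!/k![n-k]! m≤2m) ⟩
  _                                                    ≡⟨ m/n*n≡m (k![n∸k]!∣n! m≤2m) ⟩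
  (m ℕ.* 2) !                                          ∎
  where
  open ≡-Reasoning
  instance _ = m ℕ.!* (m ℕ.* 2 ℕ.∸ m) !≢0
  m≤2m : m ℕ.≤ m ℕ.* 2
  m≤2m = ℕ.m≤m*n m 2
  2m∸m≡m : m ℕ.* 2 ℕ.∸ m ≡ m
  2m∸m≡m = trans (cong (ℕ._∸ m) (trans (ℕ.*-comm m 2) (cong (m ℕ.+_) (ℕ.+-identityʳ m)))) (ℕ.m+n∸m≡n m m)

central-step : ∀ m → suc m ℕ.* ((suc m ℕ.* 2) choose suc m) ≡ 2 ℕ.* suc (m ℕ.* 2) ℕ.* ((m ℕ.* 2) choose m)
central-step m = ℕ.*-cancelʳ-≡ _ _ (suc m ℕ.* (m ! ℕ.* m !)) (begin
  suc m ℕ.* c′ ℕ.* (suc m ℕ.* (m ! ℕ.* m !))            ≡⟨ shuffle₁ (suc m) c′ (m !) ⟩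
  c′ ℕ.* (suc m ! ℕ.* suc m !)                          ≡⟨ central-factorial (suc m) ⟩
  suc (suc (m ℕ.* 2)) ℕ.* (suc (m ℕ.* 2) ℕ.* (m ℕ.* 2) !)     ≡⟨ cong (λ a → suc (suc (m ℕ.* 2)) ℕ.* (suc (m ℕ.* 2) ℕ.* a)) (central-factorial m) ⟨
  suc (suc (m ℕ.* 2)) ℕ.* (suc (m ℕ.* 2) ℕ.* (c ℕ.* (m ! ℕ.* m !)))  ≡⟨ shuffle₂ m c (m ! ℕ.* m !) ⟩
  2 ℕ.* suc (m ℕ.* 2) ℕ.* c ℕ.* (suc m ℕ.* (m ! ℕ.* m !))     ∎)
  where
  open ≡-Reasoning
  c c′ : ℕ
  c = ((m ℕ.* 2) choose m)
  c′ = ((suc m ℕ.* 2) choose suc m)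
  instance
    _ = m ℕ.!* m !≢0
    _ = ℕ.m*n≢0 (suc m) (m ! ℕ.* m !)
  shuffle₁ : ∀ s c f → s ℕ.* c ℕ.* (s ℕ.* (f ℕ.* f)) ≡ c ℕ.* (s ℕ.* f ℕ.* (s ℕ.* f))
  shuffle₁ = ℕ-Ring.solve-∀
  shuffle₂ : ∀ m c f → suc (suc (m ℕ.* 2)) ℕ.* (suc (m ℕ.* 2) ℕ.* (c ℕ.* f)) ≡ 2 ℕ.* suc (m ℕ.* 2) ℕ.* c ℕ.* (suc m ℕ.* f)
  shuffle₂ = ℕ-Ring.solve-∀

-- The central coefficient is the largest of the 2m + 1 entries of a row with sum 4^m. The induction
-- gets this from the ratio of consecutive central coefficients, 2(2m + 1)/(m + 1), without
-- comparing entries.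
4^m≤[2m+1]*central : ∀ m → 2 ℕ.^ (m ℕ.* 2) ℕ.≤ suc (m ℕ.* 2) ℕ.* ((m ℕ.* 2) choose m)
4^m≤[2m+1]*central zero    = ℕ.≤-refl
4^m≤[2m+1]*central (suc m) = begin
  2 ℕ.* (2 ℕ.* 2 ℕ.^ (m ℕ.* 2))                        ≤⟨ ℕ.*-monoʳ-≤ 2 (ℕ.*-monoʳ-≤ 2 (4^m≤[2m+1]*central m)) ⟩
  2 ℕ.* (2 ℕ.* (suc (m ℕ.* 2) ℕ.* c))                  ≡⟨ cong (2 ℕ.*_) (ℕ.*-assoc 2 (suc (m ℕ.* 2)) c) ⟨
  2 ℕ.* (2 ℕ.* suc (m ℕ.* 2) ℕ.* c)                    ≡⟨ cong (2 ℕ.*_) (central-step m) ⟨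
  2 ℕ.* (suc m ℕ.* c′)                                 ≡⟨ trans (sym (ℕ.*-assoc 2 (suc m) c′)) (cong (ℕ._* c′) (ℕ.*-comm 2 (suc m))) ⟩
  suc m ℕ.* 2 ℕ.* c′                                   ≤⟨ ℕ.*-monoˡ-≤ c′ (ℕ.n≤1+n (suc m ℕ.* 2)) ⟩
  suc (suc m ℕ.* 2) ℕ.* c′                             ∎
  where
  open ℕ.≤-Reasoning
  c c′ : ℕ
  c = ((m ℕ.* 2) choose m)
  c′ = ((suc m ℕ.* 2) choose suc m)

-- Polynomials and alternating sequences

-- A polynomial is recorded by its construction, with pointwise equations only: `Deg⇒Poly` can then
-- follow the shape of a degree derivation, and no function extensionality is needed.
data Poly : ℕ → (ℚ → ℚ) → Set where
  const : ∀ {d p} c → (∀ t → p t ≡ c) → Poly d p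
  add   : ∀ {d p q r} → Poly d p → Poly d q → (∀ t → r t ≡ p t + q t) → Poly d r
  mul   : ∀ {d p r} → Poly d p → (∀ t → r t ≡ t * p t) → Poly (suc d) r

-- Alt d q says that q i = (-1)^i p(i) for a polynomial p of degree at most d.
data Alt : ℕ → (ℕ → ℚ) → Set where
  const : ∀ {d q} → (∀ i → q (suc i) ≡ - q i) → Alt d q
  add   : ∀ {d p q r} → Alt d p → Alt d q → (∀ i → r i ≡ p i + q i) → Alt d r
  mul   : ∀ {d q r} a c → Alt d q → (∀ i → r i ≡ (a * ι i + c) * q i) → Alt (suc d) r

-- On a sequence (-1)^i p(i) this is the forward difference of p up to sign; the alternating sign
-- turns the weights of its iterates into positive binomial coefficients.
S : (ℕ → ℚ) → ℕ → ℚ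
S q i = q (suc i) + q i

S^ : ℕ → (ℕ → ℚ) → ℕ → ℚ
S^ zero    q = q
S^ (suc n) q = S^ n (S q)

S^-suc : ∀ n q i → S^ (suc n) q i ≡ S^ n q (suc i) + S^ n q i
S^-suc zero    q i = refl
S^-suc (suc n) q i = S^-suc n (S q) i

Alt-shift : ∀ {d q} a → Alt d q → Alt d (λ i → a * q (suc i))
Alt-shift {q = q} a (const e) = const λ i → trans (cong (a *_) (e (suc i))) (sym (ℚ.neg-distribʳ-* a (q (suc i))))
Alt-shift a (add x y e) = add (Alt-shift a x) (Alt-shift a y) λ i → trans (cong (a *_) (e (suc i))) (ℚ.*-distribˡ-+ a _ _)
Alt-shift a (mul {q = q} b c x e) = mul b (b + c) (Alt-shift a x) λ i → begin
  a * _                                  ≡⟨ cong (a *_) (trans (e (suc i)) (cong (λ j → (b * j + c) * q (suc i)) (ι-suc i))) ⟩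
  a * ((b * (ι i + 1ℚ) + c) * q (suc i)) ≡⟨ solve 5 (λ a b c i x → a :* ((b :* (i :+ con 1ℚ) :+ c) :* x) := (b :* i :+ (b :+ c)) :* (a :* x)) refl a b c (ι i) (q (suc i)) ⟩
  (b * ι i + (b + c)) * (a * q (suc i))  ∎
  where open ≡-Reasoning

Alt-zero : ∀ {q} → Alt 0 q → ∀ i → S q i ≡ 0ℚ
Alt-zero {q} (const e) i = trans (cong (_+ q i) (e i)) (ℚ.+-inverseˡ (q i))
Alt-zero (add {p = p} {q} {r} x y e) i = begin
  r (suc i) + r i                            ≡⟨ cong₂ _+_ (e (suc i)) (e i) ⟩
  (p (suc i) + q (suc i)) + (p i + q i)      ≡⟨ solve 4 (λ a b c d → (a :+ b) :+ (c :+ d) := (a :+ c) :+ (b :+ d)) refl (p (suc i)) (q (suc i)) (p i) (q i) ⟩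
  S p i + S q i                              ≡⟨ cong₂ _+_ (Alt-zero x i) (Alt-zero y i) ⟩
  0ℚ                                         ∎
  where open ≡-Reasoning

-- The discrete product rule, in which the affine factor has constant difference a.
S-affine : ∀ {q r} a c → (∀ i → r i ≡ (a * ι i + c) * q i) → ∀ i → S r i ≡ (a * ι i + c) * S q i + a * q (suc i)
S-affine {q} {r} a c e i = begin
  r (suc i) + r i
    ≡⟨ cong₂ _+_ (trans (e (suc i)) (cong (λ j → (a * j + c) * q (suc i)) (ι-suc i))) (e i) ⟩
  (a * (ι i + 1ℚ) + c) * q (suc i) + (a * ι i + c) * q i
    ≡⟨ solve 5 (λ a c i x y → (a :* (i :+ con 1ℚ) :+ c) :* x :+ (a :* i :+ c) :* y := (a :* i :+ c) :* (x :+ y) :+ a :* x) refl a c (ι i) (q (suc i)) (q i) ⟩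
  (a * ι i + c) * S q i + a * q (suc i) ∎
  where open ≡-Reasoning

-- By the product rule `S-affine` a product contributes two terms of smaller degree: in the first
-- the induction lowers q, in the second the affine factor is gone. In the lowest degree the first
-- term is zero.
S-Alt : ∀ {d q} → Alt (suc d) q → Alt d (S q)
S-Alt {q = q} (const e) = const λ i → trans (cancels (suc i)) (cong -_ (sym (cancels i)))
  where
  cancels : ∀ i → q (suc i) + q i ≡ 0ℚ
  cancels i = trans (cong (_+ q i) (e i)) (ℚ.+-inverseˡ (q i))
S-Alt (add {p = p} {q} x y e) = add (S-Alt x) (S-Alt y) λ i → trans (cong₂ _+_ (e (suc i)) (e i))
  (solve 4 (λ a b c d → (a :+ b) :+ (c :+ d) := (a :+ c) :+ (b :+ d)) refl (p (suc i)) (q (suc i)) (p i) (q i))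
S-Alt {zero} (mul {q = q} a c x e) = add (const vanish) (Alt-shift a x) (S-affine a c e)
  where
  zero-at : ∀ i → (a * ι i + c) * S q i ≡ 0ℚ
  zero-at i = trans (cong ((a * ι i + c) *_) (Alt-zero x i)) (ℚ.*-zeroʳ (a * ι i + c))
  vanish : ∀ i → (a * ι (suc i) + c) * S q (suc i) ≡ - ((a * ι i + c) * S q i)
  vanish i = trans (zero-at (suc i)) (cong -_ (sym (zero-at i)))
S-Alt {suc d} (mul a c x e) = add (mul a c (S-Alt x) λ _ → refl) (Alt-shift a x) (S-affine a c e)

Alt-kill : ∀ d {q} → Alt d q → ∀ i → S^ (suc d) q i ≡ 0ℚ
Alt-kill zero    x i = Alt-zero x i
Alt-kill (suc d) x i = Alt-kill d (S-Alt x) i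

-- S^n q i is the sum of (n choose j) q(i+j), so a bound on q away from m bounds S^n q i
-- up to its q(m)-term.
module Binomial (q : ℕ → ℚ) (m : ℕ) (A : ℚ) (bound : ∀ i → i ℕ.≤ m ℕ.* 2 → i ≢ m → ∣ q i ∣ ≤ A) (A≥0 : 0ℚ ≤ A) where

  double-bound : ∀ n {x y} → ∣ x ∣ ≤ ι (2 ℕ.^ n) * A → ∣ y ∣ ≤ ι (2 ℕ.^ n) * A → ∣ x + y ∣ ≤ ι (2 ℕ.^ suc n) * A
  double-bound n {x} {y} p r = begin
    ∣ x + y ∣                                   ≤⟨ ℚ.∣p+q∣≤∣p∣+∣q∣ x y ⟩
    ∣ x ∣ + ∣ y ∣                               ≤⟨ ℚ.+-mono-≤ p r ⟩
    ι (2 ℕ.^ n) * A + ι (2 ℕ.^ n) * A           ≡⟨ ℚ.*-distribʳ-+ A (ι (2 ℕ.^ n)) (ι (2 ℕ.^ n)) ⟨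
    (ι (2 ℕ.^ n) + ι (2 ℕ.^ n)) * A             ≡⟨ cong (_* A) (ι-+ (2 ℕ.^ n) (2 ℕ.^ n)) ⟨
    ι (2 ℕ.^ n ℕ.+ 2 ℕ.^ n) * A                 ≡⟨ cong (λ k → ι (2 ℕ.^ n ℕ.+ k) * A) (ℕ.+-identityʳ (2 ℕ.^ n)) ⟨
    ι (2 ℕ.^ suc n) * A                         ∎
    where open ℚ.≤-Reasoning

  suc-shift : ∀ {i n} → i ℕ.+ suc n ℕ.≤ m ℕ.* 2 → suc i ℕ.+ n ℕ.≤ m ℕ.* 2
  suc-shift {i} {n} = subst (ℕ._≤ m ℕ.* 2) (ℕ.+-suc i n)

  weaken : ∀ {i n} → i ℕ.+ suc n ℕ.≤ m ℕ.* 2 → i ℕ.+ n ℕ.≤ m ℕ.* 2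
  weaken p = ℕ.≤-trans (ℕ.n≤1+n _) (suc-shift p)

  -- A sum that starts past m never meets q(m), so the 2^n total weight is multiplied by A
  -- throughout.
  off : ∀ n i → m ℕ.< i → i ℕ.+ n ℕ.≤ m ℕ.* 2 → ∣ S^ n q i ∣ ≤ ι (2 ℕ.^ n) * A
  off zero i m<i i≤ = ℚ.≤-trans
    (bound i (subst (ℕ._≤ m ℕ.* 2) (ℕ.+-identityʳ i) i≤) (λ i≡m → ℕ.<-irrefl (sym i≡m) m<i))
    (ℚ.≤-reflexive (sym (ℚ.*-identityˡ A)))
  off (suc n) i m<i i≤ = subst (λ x → ∣ x ∣ ≤ ι (2 ℕ.^ suc n) * A) (sym (S^-suc n q i))
    (double-bound n (off n (suc i) (ℕ.m≤n⇒m≤1+n m<i) (suc-shift i≤)) (off n i m<i (weaken i≤)))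

  -- With j = m - i, the weight of q(m) in `S^ n q i` is n choose j, and Pascal's rule propagates
  -- the corrected bound. For j = 0 the shifted summand already lies past m and is left to `off`.
  on : ∀ n i j → i ℕ.+ j ≡ m → i ℕ.+ n ℕ.≤ m ℕ.* 2 → ∣ S^ n q i - ι (n choose j) * q m ∣ ≤ ι (2 ℕ.^ n) * A
  on zero i zero i≡m i≤ = subst (_≤ ι 1 * A) (cong ∣_∣ (begin
      0ℚ                    ≡⟨ ℚ.+-inverseʳ (q m) ⟨
      q m - q m             ≡⟨ cong₂ _-_ (cong q (trans (sym i≡m) (ℕ.+-identityʳ i))) (sym (ℚ.*-identityˡ (q m))) ⟩
      q i - ι 1 * q m       ∎))
    (ℚ.≤-trans A≥0 (ℚ.≤-reflexive (sym (ℚ.*-identityˡ A))))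
    where open ≡-Reasoning
  on zero i (suc j) i+j≡m i≤ = subst₂ _≤_
    (cong ∣_∣ (trans (sym (ℚ.+-identityʳ (q i))) (cong (λ x → q i - x) (sym (ℚ.*-zeroˡ (q m))))))
    (sym (ℚ.*-identityˡ A))
    (bound i (subst (ℕ._≤ m ℕ.* 2) (ℕ.+-identityʳ i) i≤)
      (λ i≡m → ℕ.m+1+n≢m i (trans i+j≡m (sym i≡m))))
  on (suc n) i zero i≡m i≤ = subst (λ x → ∣ x ∣ ≤ ι (2 ℕ.^ suc n) * A)
    (trans (sym (ℚ.+-assoc (S^ n q (suc i)) (S^ n q i) (- (ι 1 * q m)))) (cong (_- ι 1 * q m) (sym (S^-suc n q i))))
    (double-bound n (off n (suc i) (s≤s (ℕ.≤-reflexive (sym (trans (sym (ℕ.+-identityʳ i)) i≡m)))) (suc-shift i≤))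
      (on n i zero i≡m (weaken i≤)))
  on (suc n) i (suc j) i+j≡m i≤ = subst (λ x → ∣ x ∣ ≤ ι (2 ℕ.^ suc n) * A) (begin
      (S^ n q (suc i) - ι (n choose j) * q m) + (S^ n q i - ι (n choose suc j) * q m)
        ≡⟨ solve 5 (λ a b c d x → (a :- c :* x) :+ (b :- d :* x) := (a :+ b) :- (c :+ d) :* x) refl (S^ n q (suc i)) (S^ n q i) (ι (n choose j)) (ι (n choose suc j)) (q m) ⟩
      (S^ n q (suc i) + S^ n q i) - (ι (n choose j) + ι (n choose suc j)) * q m
        ≡⟨ cong₂ (λ x c → x - c * q m) (sym (S^-suc n q i)) (trans (sym (ι-+ (n choose j) (n choose suc j))) (cong ι (nCk+nC[k+1]≡[n+1]C[k+1] n j))) ⟩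
      S^ (suc n) q i - ι (suc n choose suc j) * q m ∎)
    (double-bound n (on n (suc i) j (trans (sym (ℕ.+-suc i j)) i+j≡m) (suc-shift i≤)) (on n i (suc j) i+j≡m (weaken i≤)))
    where open ≡-Reasoning

  -- When the whole sum vanishes, its central term is balanced by the others, whose weights total at
  -- most 4^m; dividing by the central coefficient leaves the factor 2m + 1.
  centre-bound : S^ (m ℕ.* 2) q 0 ≡ 0ℚ → ∣ q m ∣ ≤ ι (suc (m ℕ.* 2)) * A
  centre-bound vanishes = ℚ.*-cancelˡ-≤-pos (ι c) (begin
    ι c * ∣ q m ∣                              ≡⟨ cong (_* ∣ q m ∣) (ℚ.0≤p⇒∣p∣≡p (ℚ.nonNegative⁻¹ (ι c) {{ι-nonNeg c}})) ⟨
    ∣ ι c ∣ * ∣ q m ∣                          ≡⟨ ℚ.∣p*q∣≡∣p∣*∣q∣ (ι c) (q m) ⟨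
    ∣ ι c * q m ∣                              ≡⟨ ℚ.∣-p∣≡∣p∣ (ι c * q m) ⟨
    ∣ - (ι c * q m) ∣                          ≡⟨ cong ∣_∣ (trans (sym (ℚ.+-identityˡ _)) (cong (_- ι c * q m) (sym vanishes))) ⟩
    ∣ S^ (m ℕ.* 2) q 0 - ι c * q m ∣           ≤⟨ on (m ℕ.* 2) 0 m refl ℕ.≤-refl ⟩
    ι (2 ℕ.^ (m ℕ.* 2)) * A                    ≤⟨ ℚ.*-monoʳ-≤-nonNeg A {{ℚ.nonNegative A≥0}} (ι-mono-≤ (4^m≤[2m+1]*central m)) ⟩
    ι (suc (m ℕ.* 2) ℕ.* c) * A                ≡⟨ cong (_* A) (ι-* (suc (m ℕ.* 2)) c) ⟩
    ι (suc (m ℕ.* 2)) * ι c * A                ≡⟨ solve 3 (λ a b c → a :* b :* c := b :* (a :* c)) refl (ι (suc (m ℕ.* 2))) (ι c) A ⟩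
    ι c * (ι (suc (m ℕ.* 2)) * A)              ∎)
    where
    open ℚ.≤-Reasoning
    c : ℕ
    c = ((m ℕ.* 2) choose m)
    c≢0 : ℕ.NonZero c
    c≢0 = ℕ.>-nonZero (ℕ.n≢0⇒n>0 λ c≡0 → ℕ.<⇒≢ (ℕ.m^n>0 2 (m ℕ.* 2)) (sym (ℕ.n≤0⇒n≡0
      (subst (2 ℕ.^ (m ℕ.* 2) ℕ.≤_) (trans (cong (suc (m ℕ.* 2) ℕ.*_) c≡0) (ℕ.*-zeroʳ (suc (m ℕ.* 2)))) (4^m≤[2m+1]*central m)))))
    instance _ = ι-pos c {{c≢0}}

-- Markov's inequality at 0 from quadratically spaced nodes

sgn : ℕ → ℚ
sgn zero    = 1ℚ
sgn (suc i) = - sgn i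

∣sgn∣≡1 : ∀ i → ∣ sgn i ∣ ≡ 1ℚ
∣sgn∣≡1 zero    = refl
∣sgn∣≡1 (suc i) = trans (ℚ.∣-p∣≡∣p∣ (sgn i)) (∣sgn∣≡1 i)

square-distance : ∀ i m → (ι i - ι m) * (ι i - ι m) ≡ ι (ℕ.∣ i - m ∣ ℕ.* ℕ.∣ i - m ∣)
square-distance i m with ℕ.≤-total i m
... | inj₁ i≤m = begin
  (ι i - ι m) * (ι i - ι m)
    ≡⟨ cong (λ x → (ι i - x) * (ι i - x)) (trans (cong ι (sym (ℕ.m+[n∸m]≡n i≤m))) (ι-+ i (m ℕ.∸ i))) ⟩
  (ι i - (ι i + ι (m ℕ.∸ i))) * (ι i - (ι i + ι (m ℕ.∸ i)))
    ≡⟨ solve 2 (λ a b → (a :- (a :+ b)) :* (a :- (a :+ b)) := b :* b) refl (ι i) (ι (m ℕ.∸ i)) ⟩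
  ι (m ℕ.∸ i) * ι (m ℕ.∸ i)
    ≡⟨ ι-* (m ℕ.∸ i) (m ℕ.∸ i) ⟨
  ι ((m ℕ.∸ i) ℕ.* (m ℕ.∸ i))
    ≡⟨ cong (λ k → ι (k ℕ.* k)) (ℕ.m≤n⇒∣m-n∣≡n∸m i≤m) ⟨
  _ ∎
  where open ≡-Reasoning
... | inj₂ m≤i = begin
  (ι i - ι m) * (ι i - ι m)
    ≡⟨ cong (λ x → (x - ι m) * (x - ι m)) (trans (cong ι (sym (ℕ.m+[n∸m]≡n m≤i))) (ι-+ m (i ℕ.∸ m))) ⟩
  ((ι m + ι (i ℕ.∸ m)) - ι m) * ((ι m + ι (i ℕ.∸ m)) - ι m)
    ≡⟨ solve 2 (λ a b → ((a :+ b) :- a) :* ((a :+ b) :- a) := b :* b) refl (ι m) (ι (i ℕ.∸ m)) ⟩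
  ι (i ℕ.∸ m) * ι (i ℕ.∸ m)
    ≡⟨ ι-* (i ℕ.∸ m) (i ℕ.∸ m) ⟨
  ι ((i ℕ.∸ m) ℕ.* (i ℕ.∸ m))
    ≡⟨ cong (λ k → ι (k ℕ.* k)) (ℕ.m≤n⇒∣n-m∣≡n∸m m≤i) ⟨
  _ ∎
  where open ≡-Reasoning

-- At a node each factor t becomes w(i - m)², which is two affine factors in i; hence the degree
-- doubles.
Poly⇒Alt : ∀ w m {d p} → Poly d p → Alt (d ℕ.* 2) (λ i → sgn i * p ((ι i - ι m) * (ι i - ι m) * w))
Poly⇒Alt w m (const {p = p} c e) = const λ i →
  trans (cong (- sgn i *_) (trans (e _) (sym (e _)))) (sym (ℚ.neg-distribˡ-* (sgn i) (p ((ι i - ι m) * (ι i - ι m) * w))))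
Poly⇒Alt w m (add x y e) = add (Poly⇒Alt w m x) (Poly⇒Alt w m y) λ i →
  trans (cong (sgn i *_) (e _)) (ℚ.*-distribˡ-+ (sgn i) _ _)
Poly⇒Alt w m (mul {p = p} x e) = mul w (- (w * ι m)) (mul 1ℚ (- ι m) (Poly⇒Alt w m x) λ _ → refl) λ i →
  trans (cong (sgn i *_) (e _))
    (solve 5 (λ s i m w p → s :* ((i :- m) :* (i :- m) :* w :* p) := (w :* i :+ :- (w :* m)) :* ((con 1ℚ :* i :+ :- m) :* (s :* p)))
      refl (sgn i) (ι i) (ι m) w (p ((ι i - ι m) * (ι i - ι m) * w)))

∣i-m∣≤m : ∀ i m → i ℕ.≤ m ℕ.* 2 → ℕ.∣ i - m ∣ ℕ.≤ m
∣i-m∣≤m i m i≤2m with ℕ.≤-total i m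
... | inj₁ i≤m = subst (ℕ._≤ m) (sym (ℕ.m≤n⇒∣m-n∣≡n∸m i≤m)) (ℕ.m∸n≤m m i)
... | inj₂ m≤i = subst (ℕ._≤ m) (sym (ℕ.m≤n⇒∣n-m∣≡n∸m m≤i)) (ℕ.m≤n+o⇒m∸n≤o i m
  (subst (i ℕ.≤_) (trans (ℕ.*-comm m 2) (cong (m ℕ.+_) (ℕ.+-identityʳ m))) i≤2m))

-- A weak form of Markov's inequality: interpolate at the nodes k²/m².
markov : ∀ d {u} → Poly d u → (∀ t → 0ℚ ≤ t → t ≤ 1ℚ → ∣ t * u t ∣ ≤ ι 2) →
  ∣ u 0ℚ ∣ ≤ ι (suc (suc d ℕ.* 2) ℕ.* (2 ℕ.* (suc d ℕ.* suc d)))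
markov d {u} u-poly bounded = begin
  ∣ u 0ℚ ∣                                ≡⟨ cong (λ t → ∣ u t ∣) (trans (cong (λ x → x * x * w) (ℚ.+-inverseʳ (ι m))) (ℚ.*-zeroˡ w)) ⟨
  ∣ u (node m) ∣                          ≡⟨ ∣q∣ m ⟨
  -- The degree 2d in i is raised by one, so that the vanishing difference has the even order 2m =
  -- 2d + 2 and a central coefficient exists.
  ∣ q m ∣                                 ≤⟨ Binomial.centre-bound q m A q-bound A≥0 (Alt-kill (suc (d ℕ.* 2)) (Alt-suc (Poly⇒Alt w m u-poly)) 0) ⟩
  ι (suc (m ℕ.* 2)) * A                   ≡⟨ ι-* (suc (m ℕ.* 2)) (2 ℕ.* N) ⟨
  ι (suc (m ℕ.* 2) ℕ.* (2 ℕ.* N))         ∎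
  where
  open ℚ.≤-Reasoning
  m N : ℕ
  m = suc d
  N = m ℕ.* m
  instance
    _ = ι-pos N
    _ = ι-nonNeg N
    ιN≢0 = ℚ.pos⇒nonZero (ι N)
  w A : ℚ
  w = ℚ.1/ ι N
  A = ι (2 ℕ.* N)
  instance
    w-pos : Positive w
    w-pos = ℚ.1/pos⇒pos (ι N)
    w-nonNeg : NonNegative w
    w-nonNeg = ℚ.pos⇒nonNeg w
  A≥0 : 0ℚ ≤ A
  A≥0 = ℚ.nonNegative⁻¹ A {{ι-nonNeg (2 ℕ.* N)}}
  node : ℕ → ℚ
  node i = (ι i - ι m) * (ι i - ι m) * w
  q : ℕ → ℚ
  q i = sgn i * u (node i)
  ∣q∣ : ∀ i → ∣ q i ∣ ≡ ∣ u (node i) ∣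
  ∣q∣ i = trans (ℚ.∣p*q∣≡∣p∣*∣q∣ (sgn i) (u (node i))) (trans (cong (_* ∣ u (node i) ∣) (∣sgn∣≡1 i)) (ℚ.*-identityˡ _))

  Alt-suc : ∀ {d q} → Alt d q → Alt (suc d) q
  Alt-suc (const e) = const e
  Alt-suc (add x y e) = add (Alt-suc x) (Alt-suc y) e
  Alt-suc (mul a c x e) = mul a c (Alt-suc x) e

  -- Off the centre t is at least w = 1/N, so the bound 2 on t u(t) gives at most 2N for u(t).
  -- Comparing after multiplication by w avoids dividing by t.
  q-bound : ∀ i → i ℕ.≤ m ℕ.* 2 → i ≢ m → ∣ q i ∣ ≤ A
  q-bound i i≤ i≢m = ℚ.*-cancelˡ-≤-pos w (begin
    w * ∣ q i ∣                        ≡⟨ cong (w *_) (∣q∣ i) ⟩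
    w * ∣ u t ∣                        ≤⟨ ℚ.*-monoʳ-≤-nonNeg ∣ u t ∣ {{ℚ.∣-∣-nonNeg (u t)}} w≤t ⟩
    t * ∣ u t ∣                        ≡⟨ cong (_* ∣ u t ∣) (ℚ.0≤p⇒∣p∣≡p t≥0) ⟨
    ∣ t ∣ * ∣ u t ∣                    ≡⟨ ℚ.∣p*q∣≡∣p∣*∣q∣ t (u t) ⟨
    ∣ t * u t ∣                        ≤⟨ bounded t t≥0 t≤1 ⟩
    ι 2                                ≡⟨ ℚ.*-identityʳ (ι 2) ⟨
    ι 2 * 1ℚ                           ≡⟨ cong (ι 2 *_) (ℚ.*-inverseˡ (ι N)) ⟨
    ι 2 * (w * ι N)                    ≡⟨ solve 3 (λ a b c → a :* (b :* c) := b :* (a :* c)) refl (ι 2) w (ι N) ⟩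
    w * (ι 2 * ι N)                    ≡⟨ cong (w *_) (ι-* 2 N) ⟨
    w * A                              ∎)
    where
    t : ℚ
    t = node i
    k : ℕ
    k = ℕ.∣ i - m ∣
    k≥1 : 1 ℕ.≤ k
    k≥1 = ℕ.n≢0⇒n>0 λ k≡0 → i≢m (ℕ.∣m-n∣≡0⇒m≡n k≡0)
    k≤m : k ℕ.≤ m
    k≤m = ∣i-m∣≤m i m i≤
    t≡ : t ≡ ι (k ℕ.* k) * w
    t≡ = cong (_* w) (square-distance i m)
    w≤t : w ≤ t
    w≤t = begin
      w                    ≡⟨ ℚ.*-identityˡ w ⟨
      ι 1 * w              ≤⟨ ℚ.*-monoʳ-≤-nonNeg w (ι-mono-≤ (ℕ.*-mono-≤ k≥1 k≥1)) ⟩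
      ι (k ℕ.* k) * w      ≡⟨ t≡ ⟨
      t                    ∎
    t≥0 : 0ℚ ≤ t
    t≥0 = ℚ.≤-trans (ℚ.nonNegative⁻¹ w) w≤t
    t≤1 : t ≤ 1ℚ
    t≤1 = begin
      t                    ≡⟨ t≡ ⟩
      ι (k ℕ.* k) * w      ≤⟨ ℚ.*-monoʳ-≤-nonNeg w (ι-mono-≤ (ℕ.*-mono-≤ k≤m k≤m)) ⟩
      ι N * w              ≡⟨ ℚ.*-inverseʳ (ι N) ⟩
      1ℚ                   ∎

-- Degree and expectation of functions on the cube

Cube : ℕ → Set
Cube n = Vec Bool n

zeros : ∀ {n} → Cube n
zeros = replicate _ false

unit : ∀ {n} → Fin n → Cube n
unit i = zeros [ i ]≔ true

⟦_⟧ : Bool → ℚ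
⟦ true ⟧  = 1ℚ
⟦ false ⟧ = 0ℚ

-- Repeated factors are allowed in a product, which makes Deg d closed under
-- identification of variables.
data Deg {n} : ℕ → (Cube n → ℚ) → Set where
  const : ∀ {d p} c → (∀ x → p x ≡ c) → Deg d p
  add   : ∀ {d p q r} → Deg d p → Deg d q → (∀ x → r x ≡ p x + q x) → Deg d r
  mul   : ∀ {d p r} j → Deg d p → (∀ x → r x ≡ ⟦ lookup x j ⟧ * p x) → Deg (suc d) r

Deg-cong : ∀ {n d} {p r : Cube n → ℚ} → (∀ x → r x ≡ p x) → Deg d p → Deg d r
Deg-cong e (const c f)  = const c λ x → trans (e x) (f x)
Deg-cong e (add p q f)  = add p q λ x → trans (e x) (f x)
Deg-cong e (mul j p f)  = mul j p λ x → trans (e x) (f x)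

Deg-suc : ∀ {n d} {p : Cube n → ℚ} → Deg d p → Deg (suc d) p
Deg-suc (const c f) = const c f
Deg-suc (add p q f) = add (Deg-suc p) (Deg-suc q) f
Deg-suc (mul j p f) = mul j (Deg-suc p) f

-- Several coordinates may read the same input bit: this is how a whole block of variables is
-- switched on by one bit without raising the degree.
Substitution : ∀ {m n} → (Cube m → Cube n) → Set
Substitution σ = ∀ j →
  (∃ λ b → ∀ y → lookup (σ y) j ≡ b) ⊎ (∃ λ i → ∀ y → lookup (σ y) j ≡ lookup y i)

Deg-subst : ∀ {m n d} {p : Cube n → ℚ} {σ : Cube m → Cube n} → Substitution σ → Deg d p → Deg d (p ∘ σ)
Deg-subst s (const c f) = const c λ y → f _
Deg-subst s (add p q f) = add (Deg-subst s p) (Deg-subst s q) λ y → f _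
Deg-subst {σ = σ} s (mul {p = p} j x f) with s j
... | inj₁ (false , e) = const 0ℚ λ y → trans (f (σ y)) (trans (cong (λ b → ⟦ b ⟧ * p (σ y)) (e y)) (ℚ.*-zeroˡ (p (σ y))))
... | inj₁ (true , e)  = Deg-cong (λ y → trans (f (σ y)) (trans (cong (λ b → ⟦ b ⟧ * p (σ y)) (e y)) (ℚ.*-identityˡ (p (σ y)))))
                           (Deg-suc (Deg-subst s x))
... | inj₂ (i , e)     = mul i (Deg-subst s x) λ y → trans (f (σ y)) (cong (λ b → ⟦ b ⟧ * p (σ y)) (e y))

update-substitution : ∀ {n} (i : Fin n) b → Substitution (_[ i ]≔ b)
update-substitution i b j with i Fin.≟ j
... | yes refl = inj₁ (b , λ y → Vec.lookup∘update i y b)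
... | no i≢j   = inj₂ (j , λ y → Vec.lookup∘update′ (i≢j ∘ sym) y b)

-- The expectation of h at a point with independent coordinates, each 1 with probability t.
E : ∀ {n} → ℚ → (Cube n → ℚ) → ℚ
E {zero}  t h = h []
E {suc n} t h = (1ℚ - t) * E t (h ∘ (false ∷_)) + t * E t (h ∘ (true ∷_))

E-cong : ∀ {n} t {h h′ : Cube n → ℚ} → (∀ x → h x ≡ h′ x) → E t h ≡ E t h′
E-cong {zero}  t e = e []
E-cong {suc n} t e = cong₂ (λ a b → (1ℚ - t) * a + t * b) (E-cong t (e ∘ (false ∷_))) (E-cong t (e ∘ (true ∷_)))

E-const : ∀ {n} t c → E {n} t (λ _ → c) ≡ c
E-const {zero}  t c = refl
E-const {suc n} t c = trans (cong₂ (λ a b → (1ℚ - t) * a + t * b) (E-const {n} t c) (E-const {n} t c))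
  (solve 2 (λ t c → (con 1ℚ :- t) :* c :+ t :* c := c) refl t c)

E-+ : ∀ {n} t (h h′ : Cube n → ℚ) → E t (λ x → h x + h′ x) ≡ E t h + E t h′
E-+ {zero}  t h h′ = refl
E-+ {suc n} t h h′ = trans (cong₂ (λ a b → (1ℚ - t) * a + t * b) (E-+ t (h ∘ (false ∷_)) (h′ ∘ (false ∷_))) (E-+ t (h ∘ (true ∷_)) (h′ ∘ (true ∷_))))
  (solve 5 (λ t a b c d → (con 1ℚ :- t) :* (a :+ b) :+ t :* (c :+ d) := ((con 1ℚ :- t) :* a :+ t :* c) :+ ((con 1ℚ :- t) :* b :+ t :* d))
    refl t (E t (h ∘ (false ∷_))) (E t (h′ ∘ (false ∷_))) (E t (h ∘ (true ∷_))) (E t (h′ ∘ (true ∷_))))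

-- Conditioning on the event x_j = 1 of probability t. Fixing x_j inside h, rather than deleting it,
-- stays correct when h contains x_j again.
E-var : ∀ {n} t j (h : Cube n → ℚ) → E t (λ x → ⟦ lookup x j ⟧ * h x) ≡ t * E t (λ x → h (x [ j ]≔ true))
E-var {suc n} t zero h = begin
  (1ℚ - t) * E t (λ x → 0ℚ * h (false ∷ x)) + t * E t (λ x → 1ℚ * h (true ∷ x))
    ≡⟨ cong₂ (λ a b → (1ℚ - t) * a + t * b) (trans (E-cong t λ x → ℚ.*-zeroˡ (h (false ∷ x))) (E-const {n} t 0ℚ)) (E-cong t λ x → ℚ.*-identityˡ (h (true ∷ x))) ⟩
  (1ℚ - t) * 0ℚ + t * e
    ≡⟨ solve 2 (λ t e → (con 1ℚ :- t) :* con 0ℚ :+ t :* e := t :* ((con 1ℚ :- t) :* e :+ t :* e)) refl t e ⟩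
  t * ((1ℚ - t) * e + t * e) ∎
  where
  open ≡-Reasoning
  e : ℚ
  e = E t (h ∘ (true ∷_))
E-var {suc n} t (suc j) h = trans
  (cong₂ (λ a b → (1ℚ - t) * a + t * b) (E-var t j (h ∘ (false ∷_))) (E-var t j (h ∘ (true ∷_))))
  (solve 3 (λ t a b → (con 1ℚ :- t) :* (t :* a) :+ t :* (t :* b) := t :* ((con 1ℚ :- t) :* a :+ t :* b)) refl t
    (E t (λ x → h (false ∷ (x [ j ]≔ true)))) (E t (λ x → h (true ∷ (x [ j ]≔ true)))))

E-zero : ∀ {n} (h : Cube n → ℚ) → E 0ℚ h ≡ h zeros
E-zero {zero}  h = refl
E-zero {suc n} h = trans
  (solve 2 (λ a b → (con 1ℚ :- con 0ℚ) :* a :+ con 0ℚ :* b := a) refl (E 0ℚ (h ∘ (false ∷_))) (E 0ℚ (h ∘ (true ∷_))))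
  (E-zero (h ∘ (false ∷_)))

E-bound : ∀ {n} t {h : Cube n → ℚ} → 0ℚ ≤ t → t ≤ 1ℚ → (∀ x → ∣ h x ∣ ≤ 1ℚ) → ∣ E t h ∣ ≤ 1ℚ
E-bound {zero}  t     t≥0 t≤1 b = b []
E-bound {suc n} t {h} t≥0 t≤1 b = begin
  ∣ (1ℚ - t) * e₀ + t * e₁ ∣               ≤⟨ ℚ.∣p+q∣≤∣p∣+∣q∣ ((1ℚ - t) * e₀) (t * e₁) ⟩
  ∣ (1ℚ - t) * e₀ ∣ + ∣ t * e₁ ∣           ≤⟨ ℚ.+-mono-≤ (scale 1-t≥0 (E-bound t t≥0 t≤1 (b ∘ (false ∷_)))) (scale t≥0 (E-bound t t≥0 t≤1 (b ∘ (true ∷_)))) ⟩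
  (1ℚ - t) + t                             ≡⟨ solve 1 (λ t → (con 1ℚ :- t) :+ t := con 1ℚ) refl t ⟩
  1ℚ                                       ∎
  where
  open ℚ.≤-Reasoning
  e₀ e₁ : ℚ
  e₀ = E t (h ∘ (false ∷_))
  e₁ = E t (h ∘ (true ∷_))
  1-t≥0 : 0ℚ ≤ 1ℚ - t
  1-t≥0 = subst (_≤ 1ℚ - t) (ℚ.+-inverseʳ t) (ℚ.+-monoˡ-≤ (- t) t≤1)
  scale : ∀ {a x} → 0ℚ ≤ a → ∣ x ∣ ≤ 1ℚ → ∣ a * x ∣ ≤ a
  scale {a} {x} a≥0 x≤1 = begin
    ∣ a * x ∣         ≡⟨ ℚ.∣p*q∣≡∣p∣*∣q∣ a x ⟩
    ∣ a ∣ * ∣ x ∣     ≡⟨ cong (_* ∣ x ∣) (ℚ.0≤p⇒∣p∣≡p a≥0) ⟩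
    a * ∣ x ∣         ≤⟨ ℚ.*-monoˡ-≤-nonNeg a {{ℚ.nonNegative a≥0}} x≤1 ⟩
    a * 1ℚ            ≡⟨ ℚ.*-identityʳ a ⟩
    a                 ∎

Deg⇒Poly : ∀ {n} d {h : Cube n → ℚ} → Deg d h → Poly d (λ t → E t h)
Deg⇒Poly {n} d (const c f) = const c λ t → trans (E-cong t f) (E-const {n} t c)
Deg⇒Poly d (add {p = p} {q} x y f) = add (Deg⇒Poly d x) (Deg⇒Poly d y) λ t → trans (E-cong t f) (E-+ t p q)
Deg⇒Poly (suc d) (mul {p = p} j x f) = mul (Deg⇒Poly d (Deg-subst (update-substitution j true) x))
  λ t → trans (E-cong t f) (E-var t j p)

-- The sum of h(e_i) - h(0) over all i, which is the derivative of E t h at t = 0.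
D : ∀ {n} → (Cube n → ℚ) → ℚ
D {zero}  h = 0ℚ
D {suc n} h = (h (true ∷ zeros) - h (false ∷ zeros)) + D (h ∘ (false ∷_))

D-cong : ∀ {n} {h h′ : Cube n → ℚ} → (∀ x → h x ≡ h′ x) → D h ≡ D h′
D-cong {zero}  e = refl
D-cong {suc n} e = cong₂ _+_ (cong₂ _-_ (e _) (e _)) (D-cong (e ∘ (false ∷_)))

D-const : ∀ {n} c → D {n} (λ _ → c) ≡ 0ℚ
D-const {zero}  c = refl
D-const {suc n} c = trans (cong₂ _+_ (ℚ.+-inverseʳ c) (D-const {n} c)) refl

D-+ : ∀ {n} (h h′ : Cube n → ℚ) → D (λ x → h x + h′ x) ≡ D h + D h′
D-+ {zero}  h h′ = refl
D-+ {suc n} h h′ = trans (cong (((h (true ∷ zeros) + h′ (true ∷ zeros)) - (h (false ∷ zeros) + h′ (false ∷ zeros))) +_) (D-+ (h ∘ (false ∷_)) (h′ ∘ (false ∷_))))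
  (solve 6 (λ a b c d e f → ((a :+ b) :- (c :+ d)) :+ (e :+ f) := ((a :- c) :+ e) :+ ((b :- d) :+ f)) refl
    (h (true ∷ zeros)) (h′ (true ∷ zeros)) (h (false ∷ zeros)) (h′ (false ∷ zeros)) (D (h ∘ (false ∷_))) (D (h′ ∘ (false ∷_))))

D-var : ∀ {n} j (h : Cube n → ℚ) → D (λ x → ⟦ lookup x j ⟧ * h x) ≡ h (unit j)
D-var {suc n} zero h = trans
  (cong (((1ℚ * h (true ∷ zeros)) - (0ℚ * h (false ∷ zeros))) +_) (trans (D-cong λ x → ℚ.*-zeroˡ (h (false ∷ x))) (D-const {n} 0ℚ)))
  (solve 2 (λ a b → ((con 1ℚ :* a) :- (con 0ℚ :* b)) :+ con 0ℚ := a) refl (h (true ∷ zeros)) (h (false ∷ zeros)))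
D-var {suc n} (suc j) h = trans
  (cong₂ _+_ (cong₂ (λ a b → ⟦ a ⟧ * h (true ∷ zeros) - ⟦ b ⟧ * h (false ∷ zeros)) (Vec.lookup-replicate j false) (Vec.lookup-replicate j false))
    (D-var j (h ∘ (false ∷_))))
  (solve 3 (λ a b c → (con 0ℚ :* a :- con 0ℚ :* b) :+ c := c) refl (h (true ∷ zeros)) (h (false ∷ zeros)) (h (unit (suc j))))

D-sensitive : ∀ {n} (h : Cube n → ℚ) → (∀ i → h (unit i) ≡ - h zeros) → D h ≡ ι n * (- (h zeros + h zeros))
D-sensitive {zero}  h s = sym (ℚ.*-zeroˡ (- (h [] + h [])))
D-sensitive {suc n} h s = begin
  (h (true ∷ zeros) - z) + D (h ∘ (false ∷_))     ≡⟨ cong₂ (λ a b → (a - z) + b) (s zero) (D-sensitive (h ∘ (false ∷_)) (s ∘ suc)) ⟩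
  (- z - z) + ι n * (- (z + z))                   ≡⟨ solve 2 (λ z n → (:- z :- z) :+ n :* (:- (z :+ z)) := (n :+ con 1ℚ) :* (:- (z :+ z))) refl z (ι n) ⟩
  (ι n + 1ℚ) * (- (z + z))                        ≡⟨ cong (_* (- (z + z))) (ι-suc n) ⟨
  ι (suc n) * (- (z + z))                         ∎
  where
  open ≡-Reasoning
  z : ℚ
  z = h zeros

-- The quotient u of E t h - h(0) by t is built along the degree derivation instead of by dividing,
-- so it is a polynomial defined at t = 0 as well, where its value is the derivative.
first-order : ∀ {n d} {h : Cube n → ℚ} → Deg (suc d) h →
  ∃ λ u → Poly d u × (∀ t → E t h ≡ h zeros + t * u t) × u 0ℚ ≡ D h
first-order {n} {h = h} (const c f) = (λ _ → 0ℚ) , const 0ℚ (λ _ → refl) ,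
  (λ t → trans (E-cong t f) (trans (E-const {n} t c) (trans (sym (f zeros)) (solve 2 (λ a t → a := a :+ t :* con 0ℚ) refl (h zeros) t)))) ,
  sym (trans (D-cong f) (D-const {n} c))
first-order {h = h} (add {p = p} {q} x y f)
  with u , u-poly , u-eq , u-D ← first-order x
  with v , v-poly , v-eq , v-D ← first-order y
  = (λ t → u t + v t) , add u-poly v-poly (λ _ → refl) ,
    (λ t → begin
      E t h                                             ≡⟨ trans (E-cong t f) (E-+ t p q) ⟩
      E t p + E t q                                     ≡⟨ cong₂ _+_ (u-eq t) (v-eq t) ⟩
      (p zeros + t * u t) + (q zeros + t * v t)         ≡⟨ solve 5 (λ a b t u v → (a :+ t :* u) :+ (b :+ t :* v) := (a :+ b) :+ t :* (u :+ v)) refl (p zeros) (q zeros) t (u t) (v t) ⟩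
      (p zeros + q zeros) + t * (u t + v t)             ≡⟨ cong (_+ t * (u t + v t)) (f zeros) ⟨
      h zeros + t * (u t + v t)                         ∎) ,
    trans (cong₂ _+_ u-D v-D) (sym (trans (D-cong f) (D-+ p q)))
  where open ≡-Reasoning
first-order {h = h} (mul {d} {p} j x f) = (λ t → E t p₁) , Deg⇒Poly d (Deg-subst (update-substitution j true) x) ,
  (λ t → begin
    E t h                      ≡⟨ trans (E-cong t f) (E-var t j p) ⟩
    t * E t p₁                 ≡⟨ ℚ.+-identityˡ (t * E t p₁) ⟨
    0ℚ + t * E t p₁            ≡⟨ cong (_+ t * E t p₁) h0≡0 ⟨
    h zeros + t * E t p₁       ∎) ,
  trans (E-zero p₁) (sym (trans (D-cong f) (D-var j p)))
  where
  open ≡-Reasoning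
  p₁ : Cube _ → ℚ
  p₁ x = p (x [ j ]≔ true)
  h0≡0 : h zeros ≡ 0ℚ
  h0≡0 = trans (f zeros) (trans (cong (λ b → ⟦ b ⟧ * p zeros) (Vec.lookup-replicate j false)) (ℚ.*-zeroˡ (p zeros)))

-- Sensitivity at 0 bounded by the degree

K : ℕ → ℕ
K m = suc (m ℕ.* 2) ℕ.* (m ℕ.* m)

-- Every unit vector contributes -2h(0) to `D h`, so the derivative has absolute value 2s, while an
-- expectation of values ±1 stays within 2 of h(0). Hence 2s is at most Markov's bound, whose half
-- is `K`.
sensitivity-bound : ∀ {s d} {h : Cube s → ℚ} → Deg (suc d) h → (∀ x → ∣ h x ∣ ≡ 1ℚ) →
  (∀ i → h (unit i) ≡ - h zeros) → s ℕ.≤ K (suc d)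
sensitivity-bound {s} {d} {h} deg norm sens
  with u , u-poly , u-eq , u-D ← first-order deg
  = ℕ.*-cancelˡ-≤ 2 (ι-cancel-≤ (begin
    ι (2 ℕ.* s)                              ≡⟨ trans (ι-* 2 s) (ℚ.*-comm (ι 2) (ι s)) ⟩
    ι s * (1ℚ + 1ℚ)                          ≡⟨ cong (ι s *_) (cong₂ _+_ (norm zeros) (norm zeros)) ⟨
    ι s * (∣ z ∣ + ∣ z ∣)                    ≡⟨ cong (ι s *_) (double z) ⟨
    ι s * ∣ z + z ∣                          ≡⟨ cong₂ _*_ (ℚ.0≤p⇒∣p∣≡p (ℚ.nonNegative⁻¹ (ι s) {{ι-nonNeg s}})) (ℚ.∣-p∣≡∣p∣ (z + z)) ⟨
    ∣ ι s ∣ * ∣ - (z + z) ∣                  ≡⟨ ℚ.∣p*q∣≡∣p∣*∣q∣ (ι s) (- (z + z)) ⟨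
    ∣ ι s * (- (z + z)) ∣                    ≡⟨ cong ∣_∣ (trans u-D (D-sensitive h sens)) ⟨
    ∣ u 0ℚ ∣                                 ≤⟨ markov d u-poly bounded ⟩
    ι (suc (m ℕ.* 2) ℕ.* (2 ℕ.* (m ℕ.* m)))  ≡⟨ cong ι (shuffle (suc (m ℕ.* 2)) (m ℕ.* m)) ⟩
    ι (2 ℕ.* K m)                            ∎))
  where
  open ℚ.≤-Reasoning
  m : ℕ
  m = suc d
  z : ℚ
  z = h zeros
  shuffle : ∀ a b → a ℕ.* (2 ℕ.* b) ≡ 2 ℕ.* (a ℕ.* b)
  shuffle = ℕ-Ring.solve-∀
  double : ∀ z → ∣ z + z ∣ ≡ ∣ z ∣ + ∣ z ∣
  double z = trans (cong ∣_∣ (solve 1 (λ z → z :+ z := con (ι 2) :* z) refl z))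
    (trans (ℚ.∣p*q∣≡∣p∣*∣q∣ (ι 2) z) (solve 1 (λ z → con (ι 2) :* z := z :+ z) refl ∣ z ∣))
  bounded : ∀ t → 0ℚ ≤ t → t ≤ 1ℚ → ∣ t * u t ∣ ≤ ι 2
  bounded t t≥0 t≤1 = begin
    ∣ t * u t ∣                ≡⟨ cong ∣_∣ (trans (solve 2 (λ a b → b := (a :+ b) :- a) refl z (t * u t)) (cong (_- z) (sym (u-eq t)))) ⟩
    ∣ E t h - z ∣              ≤⟨ ℚ.∣p-q∣≤∣p∣+∣q∣ (E t h) z ⟩
    ∣ E t h ∣ + ∣ z ∣          ≤⟨ ℚ.+-mono-≤ (E-bound t t≥0 t≤1 (ℚ.≤-reflexive ∘ norm)) (ℚ.≤-reflexive (norm zeros)) ⟩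
    1ℚ + 1ℚ                    ∎

-- Monomial coefficients

-- Möbius inversion, the sum of (-1)^|S - T| f(T) over subsets T of S, unfolded one coordinate at a
-- time.
coef : ∀ {n} → (Cube n → ℚ) → Cube n → ℚ
coef f []          = f []
coef f (false ∷ S) = coef (f ∘ (false ∷_)) S
coef f (true ∷ S)  = coef (λ x → f (true ∷ x) - f (false ∷ x)) S

coef-cong : ∀ {n} {f g : Cube n → ℚ} → (∀ x → f x ≡ g x) → ∀ S → coef f S ≡ coef g S
coef-cong e []          = e []
coef-cong e (false ∷ S) = coef-cong (e ∘ (false ∷_)) S
coef-cong e (true ∷ S)  = coef-cong (λ x → cong₂ _-_ (e (true ∷ x)) (e (false ∷ x))) S

coef-zero : ∀ {n} {f : Cube n → ℚ} → (∀ x → f x ≡ 0ℚ) → ∀ S → coef f S ≡ 0ℚ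
coef-zero e []          = e []
coef-zero e (false ∷ S) = coef-zero (e ∘ (false ∷_)) S
coef-zero e (true ∷ S)  = coef-zero (λ x → cong₂ _-_ (e (true ∷ x)) (e (false ∷ x))) S

coef-sub : ∀ {n} (f g : Cube n → ℚ) S → coef (λ x → f x - g x) S ≡ coef f S - coef g S
coef-sub f g []          = refl
coef-sub f g (false ∷ S) = coef-sub (f ∘ (false ∷_)) (g ∘ (false ∷_)) S
coef-sub f g (true ∷ S)  = trans
  (coef-cong (λ x → solve 4 (λ a b c d → (a :- b) :- (c :- d) := (a :- c) :- (b :- d)) refl
    (f (true ∷ x)) (g (true ∷ x)) (f (false ∷ x)) (g (false ∷ x))) S)
  (coef-sub (λ x → f (true ∷ x) - f (false ∷ x)) (λ x → g (true ∷ x) - g (false ∷ x)) S)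

coefs-zero⇒zero : ∀ {n} {f : Cube n → ℚ} → (∀ S → coef f S ≡ 0ℚ) → ∀ x → f x ≡ 0ℚ
coefs-zero⇒zero z []          = z []
coefs-zero⇒zero z (false ∷ x) = coefs-zero⇒zero (z ∘ (false ∷_)) x
coefs-zero⇒zero {f = f} z (true ∷ x) = begin
  f (true ∷ x)                                     ≡⟨ solve 2 (λ a b → a := (a :- b) :+ b) refl (f (true ∷ x)) (f (false ∷ x)) ⟩
  (f (true ∷ x) - f (false ∷ x)) + f (false ∷ x)   ≡⟨ cong₂ _+_ (coefs-zero⇒zero (z ∘ (true ∷_)) x) (coefs-zero⇒zero (z ∘ (false ∷_)) x) ⟩
  0ℚ                                               ∎
  where open ≡-Reasoning

coef-update-∈ : ∀ {n} (f : Cube n → ℚ) j b S → lookup S j ≡ true → coef (λ x → f (x [ j ]≔ b)) S ≡ 0ℚ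
coef-update-∈ f zero    b (true ∷ S)  _   = coef-zero (λ x → ℚ.+-inverseʳ (f (b ∷ x))) S
coef-update-∈ f (suc j) b (false ∷ S) j∈S = coef-update-∈ (f ∘ (false ∷_)) j b S j∈S
coef-update-∈ f (suc j) b (true ∷ S)  j∈S = coef-update-∈ (λ x → f (true ∷ x) - f (false ∷ x)) j b S j∈S

-- Setting x_j to b merges the monomials S and S ∪ {j}.
coef-update-∉ : ∀ {n} (f : Cube n → ℚ) j b S → lookup S j ≡ false →
  coef (λ x → f (x [ j ]≔ b)) S ≡ coef f S + ⟦ b ⟧ * coef f (S [ j ]≔ true)
coef-update-∉ f zero false (false ∷ S) _ =
  solve 2 (λ a b → a := a :+ con 0ℚ :* b) refl (coef (f ∘ (false ∷_)) S) (coef f (true ∷ S))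
coef-update-∉ f zero true (false ∷ S) _ = trans
  (solve 2 (λ a b → a := b :+ con 1ℚ :* (a :- b)) refl (coef (f ∘ (true ∷_)) S) (coef (f ∘ (false ∷_)) S))
  (cong (λ c → coef (f ∘ (false ∷_)) S + 1ℚ * c) (sym (coef-sub (f ∘ (true ∷_)) (f ∘ (false ∷_)) S)))
coef-update-∉ f (suc j) b (false ∷ S) j∉S = coef-update-∉ (f ∘ (false ∷_)) j b S j∉S
coef-update-∉ f (suc j) b (true ∷ S)  j∉S = coef-update-∉ (λ x → f (true ∷ x) - f (false ∷ x)) j b S j∉S

size : ∀ {n} → Cube n → ℕ
size = Subset.∣_∣

size-insert : ∀ {n} (S : Cube n) j → lookup S j ≡ false → size (S [ j ]≔ true) ≡ suc (size S)
size-insert (false ∷ S) zero    _   = refl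
size-insert (false ∷ S) (suc j) j∉S = size-insert S j j∉S
size-insert (true ∷ S)  (suc j) j∉S = cong suc (size-insert S j j∉S)

-- Degree read off the coefficients, which exposes the top monomials and behaves well under
-- restriction. `Deg` is the syntactic counterpart used for substitution and expectation;
-- `DegLe⇒Deg` passes to it.
DegLe : ∀ {n} → ℕ → (Cube n → ℚ) → Set
DegLe d f = ∀ S → d ℕ.< size S → coef f S ≡ 0ℚ

DegLe-update : ∀ {n d} {f : Cube n → ℚ} j b → DegLe d f → DegLe d (λ x → f (x [ j ]≔ b))
DegLe-update {f = f} j b deg S d<S with lookup S j in eq
... | true  = coef-update-∈ f j b S eq
... | false = begin
  coef (λ x → f (x [ j ]≔ b)) S               ≡⟨ coef-update-∉ f j b S eq ⟩
  coef f S + ⟦ b ⟧ * coef f (S [ j ]≔ true)   ≡⟨ cong₂ (λ x y → x + ⟦ b ⟧ * y) (deg S d<S) (deg (S [ j ]≔ true) (subst (_ ℕ.<_) (sym (size-insert S j eq)) (ℕ.m≤n⇒m≤1+n d<S))) ⟩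
  0ℚ + ⟦ b ⟧ * 0ℚ                             ≡⟨ cong (0ℚ +_) (ℚ.*-zeroʳ ⟦ b ⟧) ⟩
  0ℚ                                          ∎
  where open ≡-Reasoning

-- Of the two monomials that merge into S, the one with j added exceeds the degree, so only S itself
-- can supply the coefficient; and no monomial of the restriction contains j.
coef-update-top : ∀ {n d} {f : Cube n → ℚ} j b → DegLe d f → ∀ S → size S ≡ d →
  coef (λ x → f (x [ j ]≔ b)) S ≢ 0ℚ → coef f S ≢ 0ℚ × lookup S j ≡ false
coef-update-top {f = f} j b deg S S≡d c≢0 with lookup S j in eq
... | true  = contradiction (coef-update-∈ f j b S eq) c≢0
... | false = (λ c≡0 → c≢0 (begin
  coef (λ x → f (x [ j ]≔ b)) S               ≡⟨ coef-update-∉ f j b S eq ⟩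
  coef f S + ⟦ b ⟧ * coef f (S [ j ]≔ true)   ≡⟨ cong₂ (λ x y → x + ⟦ b ⟧ * y) c≡0 (deg (S [ j ]≔ true) (ℕ.≤-reflexive (trans (cong suc (sym S≡d)) (sym (size-insert S j eq))))) ⟩
  0ℚ + ⟦ b ⟧ * 0ℚ                             ≡⟨ cong (0ℚ +_) (ℚ.*-zeroʳ ⟦ b ⟧) ⟩
  0ℚ                                          ∎)) , refl
  where open ≡-Reasoning

tail-substitution : ∀ {n} → Substitution {suc n} tail
tail-substitution j = inj₂ (suc j , λ { (_ ∷ _) → refl })

DegLe⇒Deg : ∀ {n} d {f : Cube n → ℚ} → DegLe d f → Deg d f
DegLe⇒Deg {zero}  d {f} deg = const (f []) λ { [] → refl }
DegLe⇒Deg {suc n} d {f} deg = add {p = f ∘ (false ∷_) ∘ tail} {q = λ x → ⟦ lookup x zero ⟧ * f₁-f₀ (tail x)}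
    (Deg-subst tail-substitution (DegLe⇒Deg d (deg ∘ (false ∷_)))) (difference d deg) expand
  where
  f₁-f₀ : Cube n → ℚ
  f₁-f₀ x = f (true ∷ x) - f (false ∷ x)

  expand : ∀ x → f x ≡ f (false ∷ tail x) + ⟦ lookup x zero ⟧ * f₁-f₀ (tail x)
  expand (false ∷ x) = solve 2 (λ a b → b := b :+ con 0ℚ :* (a :- b)) refl (f (true ∷ x)) (f (false ∷ x))
  expand (true ∷ x)  = solve 2 (λ a b → a := b :+ con 1ℚ :* (a :- b)) refl (f (true ∷ x)) (f (false ∷ x))

  difference : ∀ d → DegLe d f → Deg d (λ x → ⟦ lookup x zero ⟧ * f₁-f₀ (tail x))
  difference zero    deg = const 0ℚ λ x → trans
    (cong (⟦ lookup x zero ⟧ *_) (coefs-zero⇒zero {f = f₁-f₀} (λ S → deg (true ∷ S) (s≤s z≤n)) (tail x)))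
    (ℚ.*-zeroʳ ⟦ lookup x zero ⟧)
  difference (suc d) deg = mul zero (Deg-subst tail-substitution (DegLe⇒Deg d λ S → deg (true ∷ S) ∘ s≤s)) λ _ → refl

Deg0⇒constant : ∀ {n} {f : Cube n → ℚ} → Deg 0 f → ∃ λ c → ∀ x → f x ≡ c
Deg0⇒constant (const c e) = c , e
Deg0⇒constant (add x y e)
  with a , p ← Deg0⇒constant x
  with b , q ← Deg0⇒constant y
  = a + b , λ z → trans (e z) (cong₂ _+_ (p z) (q z))

_⊆ᵇ_ : ∀ {n} → Cube n → Cube n → Set
B ⊆ᵇ S = ∀ j → lookup B j ≡ true → lookup S j ≡ true

coef-below : ∀ {n} {f : Cube n → ℚ} S → (∀ B → B ⊆ᵇ S → f B ≡ 0ℚ) → coef f S ≡ 0ℚ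
coef-below []          z = z [] λ ()
coef-below (false ∷ S) z = coef-below S λ B B⊆S → z (false ∷ B) λ { (suc j) → B⊆S j }
coef-below (true ∷ S)  z = coef-below S λ B B⊆S → cong₂ _-_
  (z (true ∷ B) λ { zero _ → refl ; (suc j) → B⊆S j })
  (z (false ∷ B) λ { (suc j) → B⊆S j })

-- The coefficient sees f only on subsets of S, and one difference, available since S is nonempty,
-- annihilates a constant.
coef-constant-below : ∀ {n} {f : Cube n → ℚ} {c d} S → size S ≡ suc d → (∀ B → B ⊆ᵇ S → f B ≡ c) → coef f S ≡ 0ℚ
coef-constant-below (false ∷ S) eq z = coef-constant-below S eq λ B B⊆S → z (false ∷ B) λ { (suc j) → B⊆S j }
coef-constant-below {c = c} (true ∷ S) eq z = coef-below S λ B B⊆S → trans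
  (cong₂ _-_ (z (true ∷ B) λ { zero _ → refl ; (suc j) → B⊆S j }) (z (false ∷ B) λ { (suc j) → B⊆S j }))
  (ℚ.+-inverseʳ c)

elements : ∀ {n} → Cube n → List (Fin n)
elements []          = []
elements (false ∷ S) = List.map suc (elements S)
elements (true ∷ S)  = zero ∷ List.map suc (elements S)

length-elements : ∀ {n} (S : Cube n) → length (elements S) ≡ size S
length-elements []          = refl
length-elements (false ∷ S) = trans (List.length-map suc (elements S)) (length-elements S)
length-elements (true ∷ S)  = cong suc (trans (List.length-map suc (elements S)) (length-elements S))

∈-elements : ∀ {n} (S : Cube n) j → lookup S j ≡ true → j ∈ elements S
∈-elements (true ∷ S)  zero    _   = here refl
∈-elements (false ∷ S) (suc j) j∈S = ∈-map⁺ suc (∈-elements S j j∈S)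
∈-elements (true ∷ S)  (suc j) j∈S = there (∈-map⁺ suc (∈-elements S j j∈S))

-- Decision trees

sign : Sign → ℚ
sign Sign.+ = 1ℚ
sign Sign.- = - 1ℚ

∣sign∣≡1 : ∀ s → ∣ sign s ∣ ≡ 1ℚ
∣sign∣≡1 Sign.+ = refl
∣sign∣≡1 Sign.- = refl

sign-≢ : ∀ s t → s ≢ t → sign s ≡ - sign t
sign-≢ Sign.+ Sign.+ s≢t = contradiction refl s≢t
sign-≢ Sign.+ Sign.- s≢t = refl
sign-≢ Sign.- Sign.+ s≢t = refl
sign-≢ Sign.- Sign.- s≢t = contradiction refl s≢t

sign-injective : ∀ s t → sign s ≡ sign t → s ≡ t
sign-injective Sign.+ Sign.+ _ = refl
sign-injective Sign.- Sign.- _ = refl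

-- Restrictions remain functions on the same cube, so variable indices never shift along a branch; k
-- only bounds the depth from above.
data DecisionTree {n} : (Cube n → Sign) → ℕ → Set where
  leaf  : ∀ {f k} c → (∀ x → f x ≡ c) → DecisionTree f k
  query : ∀ {f k} j → DecisionTree (λ x → f (x [ j ]≔ true)) k → DecisionTree (λ x → f (x [ j ]≔ false)) k →
          DecisionTree f (suc k)

weaken-depth : ∀ {n k l} {f : Cube n → Sign} → k ℕ.≤ l → DecisionTree f k → DecisionTree f l
weaken-depth _         (leaf c e)    = leaf c e
weaken-depth (s≤s k≤l) (query j t u) = query j (weaken-depth k≤l t) (weaken-depth k≤l u)

lookup-ext : ∀ {n} {x y : Cube n} → (∀ j → lookup x j ≡ lookup y j) → x ≡ y
lookup-ext {x = x} {y} e = trans (sym (Vec.tabulate∘lookup x)) (trans (Vec.tabulate-cong e) (Vec.tabulate∘lookup y))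

-- Disjoint sensitive blocks and hitting sets for the top monomials

module Packings {n} (f : Cube n → Sign) (d : ℕ) where

  F : Cube n → ℚ
  F = sign ∘ f

  -- Disjoint blocks of variables, each of which flips the value at 0; σ y is the union
  -- of the blocks selected by y, and all blocks lie within U.
  record Packing (s : ℕ) : Set where
    field
      U         : List (Fin n)
      U-length  : length U ℕ.≤ s ℕ.* suc d
      σ         : Cube s → Cube n
      variables : ∀ j → (∀ y → lookup (σ y) j ≡ false) ⊎ (∃ λ i → ∀ y → lookup (σ y) j ≡ lookup y i)
      within    : ∀ j → j ∉ U → ∀ y → lookup (σ y) j ≡ false
      sensitive : ∀ i → f (σ (unit i)) ≢ f zeros

    σ-substitution : Substitution σ
    σ-substitution j with variables j
    ... | inj₁ e = inj₁ (false , e)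
    ... | inj₂ v = inj₂ v

    σ-zeros : σ zeros ≡ zeros
    σ-zeros = lookup-ext at
      where
      at : ∀ j → lookup (σ zeros) j ≡ lookup zeros j
      at j with variables j
      ... | inj₁ e       = trans (e zeros) (sym (Vec.lookup-replicate j false))
      ... | inj₂ (i , e) = trans (e zeros) (trans (Vec.lookup-replicate i false) (sym (Vec.lookup-replicate j false)))

  -- Tying each block to one bit turns f into a function of s bits of no larger degree that every
  -- single bit flips at 0.
  packing-bound : ∀ {s} → DegLe (suc d) F → Packing s → s ℕ.≤ K (suc d)
  packing-bound deg P = sensitivity-bound (Deg-subst σ-substitution (DegLe⇒Deg (suc d) deg))
    (λ x → ∣sign∣≡1 (f (σ x)))
    (λ i → sign-≢ _ _ (subst (λ z → f (σ (unit i)) ≢ f z) (sym σ-zeros) (sensitive i)))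
    where open Packing P

  empty : Packing 0
  empty = record
    { U = [] ; U-length = z≤n ; σ = λ _ → zeros
    ; variables = λ j → inj₁ λ _ → Vec.lookup-replicate j false
    ; within = λ j _ _ → Vec.lookup-replicate j false
    ; sensitive = λ ()
    }

  -- Otherwise f equals f(0) on all subsets of S and the coefficient vanishes.
  sensitive-block : ∀ S → size S ≡ suc d → coef F S ≢ 0ℚ → ∃ λ B → B ⊆ᵇ S × f B ≢ f zeros
  sensitive-block S S≡d c≢0
    with anySubset? (λ B → Fin.all? (λ j → (lookup B j Bool.≟ true) →-dec (lookup S j Bool.≟ true)) ×-dec ¬? (f B Sign.≟ f zeros))
  ... | yes p = p
  ... | no ¬p = contradiction
    (coef-constant-below S S≡d λ B B⊆S → cong sign (decidable-stable (f B Sign.≟ f zeros) λ B≢ → ¬p (B , B⊆S , B≢))) c≢0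

  extend : ∀ {s} (P : Packing s) S → size S ≡ suc d → coef F S ≢ 0ℚ →
    (∀ j → lookup S j ≡ true → j ∉ Packing.U P) → Packing (suc s)
  extend {s} P S S≡d c≢0 disjoint with B , B⊆S , B≢ ← sensitive-block S S≡d c≢0 = record
    { U = elements S ++ U
    ; U-length = subst₂ ℕ._≤_ (sym (List.length-++ (elements S)))
        (cong (ℕ._+ s ℕ.* suc d) (trans (length-elements S) S≡d)) (ℕ.+-monoʳ-≤ (length (elements S)) U-length)
    ; σ = σ′
    ; variables = variables′
    ; within = λ j j∉ y → trans (lookup-σ′ y j) (outside j j∉ y)
    ; sensitive = λ
        { zero → subst (λ z → f z ≢ f zeros) (sym first) B≢
        ; (suc i) → subst (λ z → f z ≢ f zeros) (sym (others (unit i))) (sensitive i) }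
    }
    where
    open Packing P
    bit : Cube (suc s) → Fin n → Bool
    bit y j = if lookup B j then lookup y zero else lookup (σ (tail y)) j
    σ′ : Cube (suc s) → Cube n
    σ′ y = tabulate (bit y)
    lookup-σ′ : ∀ y j → lookup (σ′ y) j ≡ bit y j
    lookup-σ′ y = Vec.lookup∘tabulate (bit y)
    outside : ∀ j → j ∉ elements S ++ U → ∀ y → bit y j ≡ false
    outside j j∉ y with lookup B j in eq
    ... | true  = contradiction (∈-++⁺ˡ (∈-elements S j (B⊆S j eq))) j∉
    ... | false = within j (j∉ ∘ ∈-++⁺ʳ (elements S)) (tail y)
    variables′ : ∀ j → (∀ y → lookup (σ′ y) j ≡ false) ⊎ (∃ λ i → ∀ y → lookup (σ′ y) j ≡ lookup y i)
    variables′ j with lookup B j in eq | variables j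
    ... | true  | _            = inj₂ (zero , λ y → trans (lookup-σ′ y j) (cong (if_then lookup y zero else lookup (σ (tail y)) j) eq))
    ... | false | inj₁ e       = inj₁ λ y → trans (lookup-σ′ y j) (trans (cong (if_then lookup y zero else lookup (σ (tail y)) j) eq) (e (tail y)))
    ... | false | inj₂ (i , e) = inj₂ (suc i , λ { y@(_ ∷ z) → trans (lookup-σ′ y j) (trans (cong (if_then lookup y zero else lookup (σ z) j) eq) (e z)) })
    first : σ′ (true ∷ zeros) ≡ B
    first = lookup-ext λ j → trans (lookup-σ′ (true ∷ zeros) j) (at j)
      where
      at : ∀ j → bit (true ∷ zeros) j ≡ lookup B j
      at j with lookup B j
      ... | true  = refl
      ... | false = trans (cong (λ z → lookup z j) σ-zeros) (Vec.lookup-replicate j false)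
    others : ∀ z → σ′ (false ∷ z) ≡ σ z
    others z = lookup-ext λ j → trans (lookup-σ′ (false ∷ z) j) (at j)
      where
      at : ∀ j → bit (false ∷ z) j ≡ lookup (σ z) j
      at j with lookup B j in eq
      ... | true  = sym (within j (disjoint j (B⊆S j eq)) z)
      ... | false = refl

  Hits : List (Fin n) → Set
  Hits U = ∀ S → size S ≡ suc d → coef F S ≢ 0ℚ → ∃ λ j → lookup S j ≡ true × j ∈ U

  -- The fuel runs out only at a family of K + 1 blocks, which `packing-bound` excludes. Before
  -- that, a finite search either finds a top monomial disjoint from U or certifies that U meets
  -- them all.
  grow : DegLe (suc d) F → ∀ fuel {s} → s ℕ.+ fuel ≡ suc (K (suc d)) → Packing s →
    ∃ λ U → length U ℕ.≤ K (suc d) ℕ.* suc d × Hits U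
  grow deg zero {s} eq P =
    contradiction (packing-bound deg P) (ℕ.<⇒≱ (ℕ.≤-reflexive (sym (trans (sym (ℕ.+-identityʳ s)) eq))))
  grow deg (suc fuel) {s} eq P
    with anySubset? (λ S → (size S ℕ.≟ suc d) ×-dec ¬? (coef F S ℚ.≟ 0ℚ) ×-dec ¬? (Fin.any? λ j → (lookup S j Bool.≟ true) ×-dec (j ∈? Packing.U P)))
  ... | yes (S , S≡d , c≢0 , disjoint) =
    grow deg fuel (trans (sym (ℕ.+-suc s fuel)) eq) (extend P S S≡d c≢0 λ j j∈S j∈U → disjoint (j , j∈S , j∈U))
  ... | no ¬p = Packing.U P , ℕ.≤-trans (Packing.U-length P) (ℕ.*-monoˡ-≤ (suc d) (packing-bound deg P)) ,
    λ S S≡d c≢0 → decidable-stable (Fin.any? λ j → (lookup S j Bool.≟ true) ×-dec (j ∈? Packing.U P))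
      λ disjoint → ¬p (S , S≡d , c≢0 , disjoint)

  hitting-set : DegLe (suc d) F → ∃ λ U → length U ℕ.≤ K (suc d) ℕ.* suc d × Hits U
  hitting-set deg = grow deg (suc (K (suc d))) refl empty

open Packings using (Hits; hitting-set)

-- Top monomials that survive a query of j do not contain j, so the rest of the list still meets
-- them all; once the list is empty none can be left, and the degree has dropped.
query-all : ∀ {n d k} U (f : Cube n → Sign) → DegLe (suc d) (sign ∘ f) → Hits f d U →
  (∀ (g : Cube n → Sign) → DegLe d (sign ∘ g) → DecisionTree g k) → DecisionTree f (length U ℕ.+ k)
query-all {d = d} [] f deg hits rec = rec f lower
  where
  lower : DegLe d (sign ∘ f)
  lower S d<S with size S ℕ.≟ suc d
  ... | no S≢ = deg S (ℕ.≤∧≢⇒< d<S (S≢ ∘ sym))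
  ... | yes S≡ = decidable-stable (coef (sign ∘ f) S ℚ.≟ 0ℚ) λ c≢0 → contradiction (proj₂ (proj₂ (hits S S≡ c≢0))) λ ()
query-all {d = d} (j ∷ U) f deg hits rec = query j (branch true) (branch false)
  where
  branch : ∀ b → DecisionTree (λ x → f (x [ j ]≔ b)) _
  branch b = query-all U _ (DegLe-update j b deg) hits′ rec
    where
    hits′ : Hits (λ x → f (x [ j ]≔ b)) d U
    hits′ S S≡ c≢0 with coef-update-top j b deg S S≡ c≢0
    ... | c≢0′ , j∉S with hits S S≡ c≢0′
    ...   | i , i∈S , there i∈U = i , i∈S , i∈U
    ...   | .j , j∈S , here refl = contradiction (trans (sym j∈S) j∉S) λ ()

depth : ℕ → ℕ
depth zero    = 0
depth (suc d) = K (suc d) ℕ.* suc d ℕ.+ depth d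

decision-tree : ∀ {n} d (f : Cube n → Sign) → DegLe d (sign ∘ f) → DecisionTree f (depth d)
decision-tree zero f deg with c , e ← Deg0⇒constant (DegLe⇒Deg 0 deg) =
  leaf (f zeros) λ x → sign-injective _ _ (trans (e x) (sym (e zeros)))
decision-tree (suc d) f deg with U , U≤ , hits ← hitting-set f d deg =
  weaken-depth (ℕ.+-monoˡ-≤ (depth d) U≤) (query-all U f deg hits (decision-tree d))

-- Linear independence tested on null sequences of coefficients

Null : (ℕ → ℚ) → Set
Null s = ∀ ε .{{_ : Positive ε}} → ∃ λ N → ∀ {n} → N ℕ.≤ n → ∣ s n ∣ ≤ ε

Null-cong : ∀ {s t} → (∀ n → s n ≡ t n) → Null s → Null t
Null-cong e s-null ε with N , b ← s-null ε = N , λ {n} n≥ → subst (λ x → ∣ x ∣ ≤ ε) (e n) (b n≥)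

Null-0 : Null (λ _ → 0ℚ)
Null-0 ε = 0 , λ _ → ℚ.<⇒≤ (ℚ.positive⁻¹ ε)

Null-+ : ∀ {s t} → Null s → Null t → Null (λ n → s n + t n)
Null-+ {s} {t} s-null t-null ε
  with M , bs ← s-null (½ * ε) {{ℚ.pos*pos⇒pos ½ ε}}
  with N , bt ← t-null (½ * ε) {{ℚ.pos*pos⇒pos ½ ε}}
  = M ℕ.⊔ N , λ {n} n≥ → begin
    ∣ s n + t n ∣            ≤⟨ ℚ.∣p+q∣≤∣p∣+∣q∣ (s n) (t n) ⟩
    ∣ s n ∣ + ∣ t n ∣        ≤⟨ ℚ.+-mono-≤ (bs (ℕ.m⊔n≤o⇒m≤o M N n≥)) (bt (ℕ.m⊔n≤o⇒n≤o M N n≥)) ⟩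
    ½ * ε + ½ * ε            ≡⟨ half+half ε ⟩
    ε                        ∎
  where open ℚ.≤-Reasoning

Null-* : ∀ c {s} → Null s → Null (λ n → c * s n)
Null-* c {s} s-null ε
  with δ , δ>0 , Bδ≡ε ← shrink ε (∣ c ∣ + 1ℚ) {{it}} {{ℚ.nonNeg+pos⇒pos ∣ c ∣ {{ℚ.∣-∣-nonNeg c}} 1ℚ}}
  with N , b ← s-null δ {{δ>0}}
  = N , λ {n} n≥ → subst (∣ c * s n ∣ ≤_) Bδ≡ε
      (∣*∣-mono-≤ c (s n) {{ℚ.nonNeg+pos⇒pos ∣ c ∣ {{ℚ.∣-∣-nonNeg c}} 1ℚ}}
        (ℚ.≤-trans (ℚ.≤-reflexive (sym (ℚ.+-identityʳ ∣ c ∣))) (ℚ.+-monoʳ-≤ ∣ c ∣ (ι-mono-≤ {0} {1} z≤n))) (b n≥))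

Null-cancel : ∀ {c s} → c ≢ 0ℚ → Null (λ n → c * s n) → Null s
Null-cancel {c} {s} c≢0 cs-null = Null-cong undo (Null-* (ℚ.1/ c) cs-null)
  where
  instance _ = ℚ.≢-nonZero c≢0
  undo : ∀ n → ℚ.1/ c * (c * s n) ≡ s n
  undo n = trans (sym (ℚ.*-assoc (ℚ.1/ c) c (s n))) (trans (cong (_* s n) (ℚ.*-inverseˡ c)) (ℚ.*-identityˡ (s n)))

Null-sub : ∀ {s t} → Null s → Null t → Null (λ n → s n - t n)
Null-sub {s} {t} s-null t-null = Null-cong (λ n → cong (s n +_) (trans (sym (ℚ.neg-distribˡ-* 1ℚ (t n))) (cong -_ (ℚ.*-identityˡ (t n)))))
  (Null-+ s-null (Null-* (- 1ℚ) t-null))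

Null-constant : ∀ {q} → Null (λ _ → q) → q ≡ 0ℚ
Null-constant {q} q-null with q ℚ.≟ 0ℚ
... | yes q≡0 = q≡0
... | no q≢0  = contradiction (begin-strict
    ∣ q ∣                            ≤⟨ proj₂ (q-null (½ * ∣ q ∣)) ℕ.≤-refl ⟩
    ½ * ∣ q ∣                        ≡⟨ ℚ.+-identityʳ (½ * ∣ q ∣) ⟨
    ½ * ∣ q ∣ + 0ℚ                   <⟨ ℚ.+-monoʳ-< (½ * ∣ q ∣) (ℚ.positive⁻¹ (½ * ∣ q ∣)) ⟩
    ½ * ∣ q ∣ + ½ * ∣ q ∣            ≡⟨ half+half ∣ q ∣ ⟩
    ∣ q ∣                            ∎) (ℚ.<-irrefl refl)
  where
  open ℚ.≤-Reasoning
  instance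
    ∣q∣>0 : Positive ∣ q ∣
    ∣q∣>0 = ℚ.nonNeg∧nonZero⇒pos ∣ q ∣ {{ℚ.∣-∣-nonNeg q}} {{ℚ.≢-nonZero (q≢0 ∘ ℚ.∣p∣≡0⇒p≡0 q)}}
    half>0 : Positive (½ * ∣ q ∣)
    half>0 = ℚ.pos*pos⇒pos ½ ∣ q ∣

Null-sum : ∀ {s} (a : Fin s → ℕ → ℚ) (c : Fin s → ℚ) → (∀ k → Null (a k)) → Null (λ n → sum λ k → a k n * c k)
Null-sum {zero}  a c a-null = Null-0
Null-sum {suc s} a c a-null = Null-+
  (Null-cong (λ n → ℚ.*-comm (c zero) (a zero n)) (Null-* (c zero) (a-null zero)))
  (Null-sum (a ∘ suc) (c ∘ suc) (a-null ∘ suc))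

-- A real is 0 exactly when its sequence is null, so letting rational sequences be the coefficients
-- covers all real combinations of rational vectors, and elimination can work term by term.
Independent : ∀ {s} {I : Set} → (Fin s → I → ℚ) → Set
Independent {s} v = ∀ (a : Fin s → ℕ → ℚ) →
  (∀ i → Null (λ n → sum λ k → a k n * v k i)) → ∀ k → Null (a k)

sum-split : ∀ p {q} (f : Fin (p ℕ.+ q) → ℚ) → sum f ≡ sum (f ∘ (_↑ˡ q)) + sum (f ∘ (p ↑ʳ_))
sum-split zero    f = sym (ℚ.+-identityˡ (sum f))
sum-split (suc p) {q} f = trans (cong (f zero +_) (sum-split p (f ∘ suc))) (sym (ℚ.+-assoc (f zero) _ _))

-- Composition with AND and OR gates

gate : Bool → Bool → Bool → Bool
gate false = _∧_
gate true  = _∨_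

gates : ∀ {n} → Cube n → Cube n → Cube n → Cube n
gates []      []      []      = []
gates (g ∷ z) (x ∷ X) (y ∷ Y) = gate g x y ∷ gates z X Y

gate-absorb : ∀ g y → gate g g y ≡ g
gate-absorb false y = refl
gate-absorb true  y = refl

gate-neutral : ∀ g y → gate g (not g) y ≡ y
gate-neutral false y = refl
gate-neutral true  y = refl

δ : ∀ {n} → (Cube (suc n) → ℚ) → Cube n → ℚ
δ h x = h (true ∷ x) - h (false ∷ x)

-- The number of monomials of h in the variables of the AND gates of z and the negated
-- variables of its OR gates; it is the rank of h ∘ gates z.
monomials : ∀ {n} → (Cube n → ℚ) → Cube n → ℕ
monomials h []      with h [] ℚ.≟ 0ℚ
... | yes _ = 0
... | no _  = 1
monomials h (g ∷ z) = monomials (δ h) z ℕ.+ monomials (h ∘ (g ∷_)) z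

-- The column bit `not g` is neutral for gate g and lets the row bit through, while the bit g
-- absorbs it. The former columns serve the derivative, the latter the restriction to g.
columns : ∀ {n} (h : Cube n → ℚ) z → Fin (monomials h z) → Cube n
columns h []      _ = []
columns h (g ∷ z) k =
  [ (λ i → not g ∷ columns (δ h) z i) , (λ j → g ∷ columns (h ∘ (g ∷_)) z j) ]′ (splitAt (monomials (δ h) z) k)

-- After a row operation the matrix is block triangular, with the matrices of `δ h` and `h ∘ (g ∷_)`
-- on the diagonal: the coefficients β are eliminated first, and α after them.
columns-independent : ∀ {n} (h : Cube n → ℚ) z → Independent (λ k X → h (gates z X (columns h z k)))
columns-independent h [] a a-null k with h [] ℚ.≟ 0ℚ
columns-independent h [] a a-null zero | no h≢0 = Null-cancel {c = h []} h≢0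
  (Null-cong (λ n → trans (ℚ.+-identityʳ (a zero n * h [])) (ℚ.*-comm (a zero n) (h []))) (a-null []))
columns-independent {suc n} h (g ∷ z) a a-null k = subst (Null ∘ a) (Fin.join-splitAt p q k) (both (splitAt p k))
  where
  p q : ℕ
  p = monomials (δ h) z
  q = monomials (h ∘ (g ∷_)) z
  β : Fin p → ℕ → ℚ
  β i = a (i ↑ˡ q)
  α : Fin q → ℕ → ℚ
  α j = a (p ↑ʳ j)
  κ : Fin p → Cube n
  κ = columns (δ h) z
  κ′ : Fin q → Cube n
  κ′ = columns (h ∘ (g ∷_)) z

  row : ∀ x X m → (sum λ k → a k m * h (gates (g ∷ z) (x ∷ X) (columns h (g ∷ z) k))) ≡
    (sum λ i → β i m * h (gate g x (not g) ∷ gates z X (κ i))) + (sum λ j → α j m * h (gate g x g ∷ gates z X (κ′ j)))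
  row x X m = trans (sum-split p _) (cong₂ _+_
    (sum-cong-≗ λ i → cong (λ s → β i m * h (gates (g ∷ z) (x ∷ X) ([ (λ i → not g ∷ κ i) , (λ j → g ∷ κ′ j) ]′ s))) (Fin.splitAt-↑ˡ p i q))
    (sum-cong-≗ λ j → cong (λ s → α j m * h (gates (g ∷ z) (x ∷ X) ([ (λ i → not g ∷ κ i) , (λ j → g ∷ κ′ j) ]′ s))) (Fin.splitAt-↑ʳ p q j)))

  -- In the row with bit g all entries come from h ∘ (g ∷_); subtracting it from the row
  -- with bit not g leaves ± δ h in the first block of columns and 0 in the second.
  absorbed : ∀ X m → (sum λ k → a k m * h (gates (g ∷ z) (g ∷ X) (columns h (g ∷ z) k))) ≡
    (sum λ i → β i m * h (g ∷ gates z X (κ i))) + (sum λ j → α j m * h (g ∷ gates z X (κ′ j)))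
  absorbed X m = trans (row g X m) (cong₂ _+_
    (sum-cong-≗ λ i → cong (λ b → β i m * h (b ∷ gates z X (κ i))) (gate-absorb g (not g)))
    (sum-cong-≗ λ j → cong (λ b → α j m * h (b ∷ gates z X (κ′ j))) (gate-absorb g g)))

  passed : ∀ X m → (sum λ k → a k m * h (gates (g ∷ z) (not g ∷ X) (columns h (g ∷ z) k))) ≡
    (sum λ i → β i m * h (not g ∷ gates z X (κ i))) + (sum λ j → α j m * h (g ∷ gates z X (κ′ j)))
  passed X m = trans (row (not g) X m) (cong₂ _+_
    (sum-cong-≗ λ i → cong (λ b → β i m * h (b ∷ gates z X (κ i))) (gate-neutral g (not g)))
    (sum-cong-≗ λ j → cong (λ b → α j m * h (b ∷ gates z X (κ′ j))) (gate-neutral g g)))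

  ∑-sub : ∀ {s} (b : Fin s → ℚ) (u v : Fin s → ℚ) → (sum λ i → b i * u i) - (sum λ i → b i * v i) ≡ sum λ i → b i * (u i - v i)
  ∑-sub {zero}  b u v = refl
  ∑-sub {suc s} b u v = trans
    (solve 5 (λ b u v x y → (b :* u :+ x) :- (b :* v :+ y) := b :* (u :- v) :+ (x :- y)) refl (b zero) (u zero) (v zero)
      (sum λ i → b (suc i) * u (suc i)) (sum λ i → b (suc i) * v (suc i)))
    (cong (b zero * (u zero - v zero) +_) (∑-sub (b ∘ suc) (u ∘ suc) (v ∘ suc)))

  cancel : ∀ x y z → (x + z) - (y + z) ≡ x - y
  cancel = solve 3 (λ x y z → (x :+ z) :- (y :+ z) := x :- y) refl

  difference : ∀ X → Null (λ m → (sum λ i → β i m * h (not g ∷ gates z X (κ i))) - (sum λ i → β i m * h (g ∷ gates z X (κ i))))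
  difference X = Null-cong (λ m → trans (cong₂ _-_ (passed X m) (absorbed X m)) (cancel (sum λ i → β i m * h (not g ∷ gates z X (κ i))) (sum λ i → β i m * h (g ∷ gates z X (κ i))) (sum λ j → α j m * h (g ∷ gates z X (κ′ j)))))
    (Null-sub (a-null (not g ∷ X)) (a-null (g ∷ X)))

  orient : ∀ g → (∀ X → Null (λ m → (sum λ i → β i m * h (not g ∷ gates z X (κ i))) - (sum λ i → β i m * h (g ∷ gates z X (κ i))))) →
    ∀ X → Null (λ m → sum λ i → β i m * δ h (gates z X (κ i)))
  orient false d X = Null-cong (λ m → ∑-sub (λ i → β i m) _ _) (d X)
  orient true  d X = Null-cong (λ m → trans (solve 2 (λ x y → con (- 1ℚ) :* (x :- y) := y :- x) refl
      (sum λ i → β i m * h (false ∷ gates z X (κ i))) (sum λ i → β i m * h (true ∷ gates z X (κ i))))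
    (∑-sub (λ i → β i m) _ _)) (Null-* (- 1ℚ) (d X))

  β-null : ∀ i → Null (β i)
  β-null = columns-independent (δ h) z β (orient g difference)

  α-null : ∀ j → Null (α j)
  α-null = columns-independent (h ∘ (g ∷_)) z α λ X → Null-cong
    (λ m → trans (cong (_- (sum λ i → β i m * h (g ∷ gates z X (κ i)))) (absorbed X m))
      (solve 2 (λ x y → (x :+ y) :- x := y) refl (sum λ i → β i m * h (g ∷ gates z X (κ i))) (sum λ j → α j m * h (g ∷ gates z X (κ′ j)))))
    (Null-sub (a-null (g ∷ X)) (Null-sum β (λ i → h (g ∷ gates z X (κ i))) β-null))

  both : ∀ s → Null (a (Fin.join p q s))
  both (inj₁ i) = β-null i
  both (inj₂ j) = α-null j

monomials-cong : ∀ {n} {h h′ : Cube n → ℚ} → (∀ x → h x ≡ h′ x) → ∀ z → monomials h z ≡ monomials h′ z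
monomials-cong {h = h} {h′} e [] with h [] ℚ.≟ 0ℚ | h′ [] ℚ.≟ 0ℚ
... | yes _ | yes _ = refl
... | no _  | no _  = refl
... | yes p | no q  = contradiction (trans (sym (e [])) p) q
... | no p  | yes q = contradiction (trans (e []) q) p
monomials-cong e (g ∷ z) = cong₂ ℕ._+_
  (monomials-cong (λ x → cong₂ _-_ (e (true ∷ x)) (e (false ∷ x))) z) (monomials-cong (e ∘ (g ∷_)) z)

-- The count is the size of the support of an expansion linear in h, hence subadditive.
monomials-sub : ∀ {n} (h h′ : Cube n → ℚ) z → monomials (λ x → h x - h′ x) z ℕ.≤ monomials h z ℕ.+ monomials h′ z
monomials-sub h h′ [] with h [] ℚ.≟ 0ℚ | h′ [] ℚ.≟ 0ℚ | h [] - h′ [] ℚ.≟ 0ℚ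
... | yes p | yes q | no r  = contradiction (cong₂ _-_ p q) r
... | _     | _     | yes _ = z≤n
... | yes _ | no _  | no _  = ℕ.≤-refl
... | no _  | yes _ | no _  = ℕ.≤-refl
... | no _  | no _  | no _  = s≤s z≤n
monomials-sub h h′ (g ∷ z) = begin
  monomials (δ (λ x → h x - h′ x)) z ℕ.+ monomials (λ x → h (g ∷ x) - h′ (g ∷ x)) z
    ≡⟨ cong (ℕ._+ monomials (λ x → h (g ∷ x) - h′ (g ∷ x)) z) (monomials-cong (λ x →
         solve 4 (λ a b c d → (a :- b) :- (c :- d) := (a :- c) :- (b :- d)) refl (h (true ∷ x)) (h′ (true ∷ x)) (h (false ∷ x)) (h′ (false ∷ x))) z) ⟩
  monomials (λ x → δ h x - δ h′ x) z ℕ.+ monomials (λ x → h (g ∷ x) - h′ (g ∷ x)) z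
    ≤⟨ ℕ.+-mono-≤ (monomials-sub (δ h) (δ h′) z) (monomials-sub (h ∘ (g ∷_)) (h′ ∘ (g ∷_)) z) ⟩
  (monomials (δ h) z ℕ.+ monomials (δ h′) z) ℕ.+ (monomials (h ∘ (g ∷_)) z ℕ.+ monomials (h′ ∘ (g ∷_)) z)
    ≡⟨ swap (monomials (δ h) z) (monomials (δ h′) z) (monomials (h ∘ (g ∷_)) z) (monomials (h′ ∘ (g ∷_)) z) ⟩
  monomials h (g ∷ z) ℕ.+ monomials h′ (g ∷ z) ∎
  where
  open ℕ.≤-Reasoning
  swap : ∀ a b c d → (a ℕ.+ b) ℕ.+ (c ℕ.+ d) ≡ (a ℕ.+ c) ℕ.+ (b ℕ.+ d)
  swap = ℕ-Ring.solve-∀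

-- Passing from δ h to h multiplies the number of monomials by 3/2 for the better of
-- the two gates, since δ h is the difference of the two restrictions of h.
many-monomials : ∀ {n} (h : Cube n → ℚ) S → coef h S ≢ 0ℚ →
  ∃ λ z → 3 ℕ.^ size S ℕ.≤ 2 ℕ.^ size S ℕ.* monomials h z
many-monomials h [] c≢0 = [] , bound
  where
  bound : 1 ℕ.≤ 1 ℕ.* monomials h []
  bound with h [] ℚ.≟ 0ℚ
  ... | yes h≡0 = contradiction h≡0 c≢0
  ... | no _    = ℕ.≤-refl
many-monomials h (false ∷ S) c≢0 with z , b ← many-monomials (h ∘ (false ∷_)) S c≢0 =
  -- The coefficient belongs to the restriction to `false`, which the AND gate retains; the
  -- monomials of `δ h` are merely dropped from the count.
  false ∷ z , ℕ.≤-trans b (ℕ.*-monoʳ-≤ (2 ℕ.^ size S) (ℕ.m≤n+m (monomials (h ∘ (false ∷_)) z) (monomials (δ h) z)))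
many-monomials h (true ∷ S) c≢0 with z , b ← many-monomials (δ h) S c≢0 =
  better (monomials-sub (h ∘ (true ∷_)) (h ∘ (false ∷_)) z)
  where
  open ℕ.≤-Reasoning
  2^ w : ℕ
  2^ = 2 ℕ.^ size S
  w = monomials (δ h) z
  finish : ∀ g → w ℕ.≤ monomials (h ∘ (g ∷_)) z ℕ.+ monomials (h ∘ (g ∷_)) z →
    ∃ λ z′ → 3 ℕ.* 3 ℕ.^ size S ℕ.≤ 2 ℕ.* 2^ ℕ.* monomials h z′
  finish g w≤2u = g ∷ z , (begin
    3 ℕ.* 3 ℕ.^ size S                         ≤⟨ ℕ.*-monoʳ-≤ 3 b ⟩
    3 ℕ.* (2^ ℕ.* w)                           ≡⟨ split 2^ w ⟩
    2^ ℕ.* (2 ℕ.* w ℕ.+ w)                     ≤⟨ ℕ.*-monoʳ-≤ 2^ (ℕ.+-monoʳ-≤ (2 ℕ.* w) w≤2u) ⟩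
    2^ ℕ.* (2 ℕ.* w ℕ.+ (u ℕ.+ u))             ≡⟨ regroup 2^ w u ⟩
    2 ℕ.* 2^ ℕ.* (w ℕ.+ u)                     ∎)
    where
    u : ℕ
    u = monomials (h ∘ (g ∷_)) z
    split : ∀ p w → 3 ℕ.* (p ℕ.* w) ≡ p ℕ.* (2 ℕ.* w ℕ.+ w)
    split = ℕ-Ring.solve-∀
    regroup : ∀ p w u → p ℕ.* (2 ℕ.* w ℕ.+ (u ℕ.+ u)) ≡ 2 ℕ.* p ℕ.* (w ℕ.+ u)
    regroup = ℕ-Ring.solve-∀
  better : w ℕ.≤ monomials (h ∘ (true ∷_)) z ℕ.+ monomials (h ∘ (false ∷_)) z → _
  better w≤ with ℕ.≤-total (monomials (h ∘ (true ∷_)) z) (monomials (h ∘ (false ∷_)) z)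
  ... | inj₁ t≤f = finish false (ℕ.≤-trans w≤ (ℕ.+-monoˡ-≤ (monomials (h ∘ (false ∷_)) z) t≤f))
  ... | inj₂ f≤t = finish true (ℕ.≤-trans w≤ (ℕ.+-monoʳ-≤ (monomials (h ∘ (true ∷_)) z) f≤t))

-- Rank

sum-zero : ∀ {s} {t : Fin s → ℚ} → (∀ k → t k ≡ 0ℚ) → sum t ≡ 0ℚ
sum-zero {s} z = trans (sum-cong-≗ z) (sum-replicate-zero s)

sum-eliminate : ∀ {s} (a x c : Fin s → ℚ) y →
  sum (λ k → a k * (x k - c k * y)) ≡ sum (λ k → a k * x k) - sum (λ k → a k * c k) * y
sum-eliminate {zero}  a x c y = solve 1 (λ y → con 0ℚ := con 0ℚ :- con 0ℚ :* y) refl y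
sum-eliminate {suc s} a x c y = trans
  (cong (a zero * (x zero - c zero * y) +_) (sum-eliminate (a ∘ suc) (x ∘ suc) (c ∘ suc) y))
  (solve 6 (λ a x c y p q → a :* (x :- c :* y) :+ (p :- q :* y) := (a :* x :+ p) :- (a :* c :+ q) :* y) refl
    (a zero) (x zero) (c zero) y (sum λ k → a (suc k) * x (suc k)) (sum λ k → a (suc k) * c (suc k)))

quotient : ∀ x {y} → y ≢ 0ℚ → ∃ λ c → x - c * y ≡ 0ℚ
quotient x {y} y≢0 = x * ℚ.1/ y , (begin
  x - x * ℚ.1/ y * y       ≡⟨ cong (λ z → x - z) (ℚ.*-assoc x (ℚ.1/ y) y) ⟩
  x - x * (ℚ.1/ y * y)     ≡⟨ cong (λ z → x - x * z) (ℚ.*-inverseˡ y) ⟩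
  x - x * 1ℚ               ≡⟨ solve 1 (λ x → x :- x :* con 1ℚ := con 0ℚ) refl x ⟩
  0ℚ                       ∎)
  where
  open ≡-Reasoning
  instance _ = ℚ.≢-nonZero y≢0

-- Gaussian elimination: a vector p with nonzero first entry clears that entry from the others, and
-- a relation among the results determines the coefficient e of p.
dependency : ∀ r {s} → r ℕ.< s → (b : Fin s → Fin r → ℚ) →
  ∃ λ (α : Fin s → ℚ) → (∃ λ k → α k ≢ 0ℚ) × ∀ i → sum (λ k → α k * b k i) ≡ 0ℚ
dependency zero    {suc s} _   b = (λ _ → 1ℚ) , (zero , λ ()) , λ ()
dependency (suc r) {suc s} r<s b with Fin.any? (λ k → ¬? (b k zero ℚ.≟ 0ℚ))
... | no ¬p with α , nontrivial , z ← dependency r (ℕ.<-trans (ℕ.n<1+n r) r<s) (λ k i → b k (suc i)) =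
  α , nontrivial , λ
    { zero    → sum-zero λ k → trans (cong (α k *_) (decidable-stable (b k zero ℚ.≟ 0ℚ) λ b≢0 → ¬p (k , b≢0))) (ℚ.*-zeroʳ (α k))
    ; (suc i) → z i }
... | yes (p , bp≢0) = extended (dependency r (ℕ.s<s⁻¹ r<s) (λ k i → w k (suc i)))
  where
  c : Fin s → ℚ
  c k = proj₁ (quotient (b (punchIn p k) zero) bp≢0)
  w : Fin s → Fin (suc r) → ℚ
  w k i = b (punchIn p k) i - c k * b p i
  extended : (∃ λ (α : Fin s → ℚ) → (∃ λ k → α k ≢ 0ℚ) × ∀ i → sum (λ k → α k * w k (suc i)) ≡ 0ℚ) →
    ∃ λ (α : Fin (suc s) → ℚ) → (∃ λ k → α k ≢ 0ℚ) × ∀ i → sum (λ k → α k * b k i) ≡ 0ℚ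
  extended (α , (k , αk≢0) , z) = α⁺ , (punchIn p k , αk≢0 ∘ trans (sym (Vector.insertAt-punchIn α p e k))) , total
    where
    e : ℚ
    e = - sum (λ k → α k * c k)
    α⁺ : Fin (suc s) → ℚ
    α⁺ = insertAt α p e
    vanish : ∀ i → sum (λ k → α k * w k i) ≡ 0ℚ
    vanish zero    = sum-zero λ k → trans (cong (α k *_) (proj₂ (quotient (b (punchIn p k) zero) bp≢0))) (ℚ.*-zeroʳ (α k))
    vanish (suc i) = z i
    total : ∀ i → sum (λ k → α⁺ k * b k i) ≡ 0ℚ
    total i = begin
      sum (λ k → α⁺ k * b k i)
        ≡⟨ sum-remove {i = p} (λ k → α⁺ k * b k i) ⟩
      α⁺ p * b p i + sum (λ k → α⁺ (punchIn p k) * b (punchIn p k) i)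
        ≡⟨ cong₂ _+_ (cong (_* b p i) (Vector.insertAt-lookup α p e))
             (sum-cong-≗ λ k → cong (_* b (punchIn p k) i) (Vector.insertAt-punchIn α p e k)) ⟩
      e * b p i + sum (λ k → α k * b (punchIn p k) i)
        ≡⟨ solve 3 (λ q y x → (:- q) :* y :+ x := x :- q :* y) refl (sum λ k → α k * c k) (b p i) (sum λ k → α k * b (punchIn p k) i) ⟩
      sum (λ k → α k * b (punchIn p k) i) - sum (λ k → α k * c k) * b p i
        ≡⟨ sum-eliminate α (λ k → b (punchIn p k) i) c (b p i) ⟨
      sum (λ k → α k * w k i)
        ≡⟨ vanish i ⟩
      0ℚ ∎
      where open ≡-Reasoning

Spans : ∀ {r N} {I : Set} → (Fin r → Fin N) → (Fin N → I → ℚ) → Set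
Spans {r} κ v = ∀ j → ∃ λ (b : Fin r → ℚ) → ∀ i → v j i ≡ sum (λ k → b k * v (κ k) i)

-- Two outputs serve the two halves of `IsRank`: independence against null sequences shows that the
-- chosen columns are independent over the reals, and rational spanning coefficients give the upper
-- bound through `dependency`.
basis : ∀ m {N} (v : Fin N → Fin m → ℚ) →
  ∃ λ r → ∃ λ (κ : Fin r → Fin N) → Independent (v ∘ κ) × Spans κ v
basis zero    v = 0 , (λ ()) , (λ _ _ ()) , λ j → (λ ()) , λ ()
basis (suc m) {N} v with Fin.any? (λ j → ¬? (v j zero ℚ.≟ 0ℚ))
... | no ¬p with r , κ , indep , spans ← basis m (λ j → v j ∘ suc) =
  r , κ , (λ a null → indep a (null ∘ suc)) , λ j → proj₁ (spans j) , λ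
    { zero    → trans (vanish j) (sym (sum-zero λ k → trans (cong (proj₁ (spans j) k *_) (vanish (κ k))) (ℚ.*-zeroʳ (proj₁ (spans j) k))))
    ; (suc i) → proj₂ (spans j) i }
  where
  vanish : ∀ j → v j zero ≡ 0ℚ
  vanish j = decidable-stable (v j zero ℚ.≟ 0ℚ) λ v≢0 → ¬p (j , v≢0)
... | yes (p , vp≢0) = extended (basis m (λ j → u j ∘ suc))
  where
  c : Fin N → ℚ
  c j = proj₁ (quotient (v j zero) vp≢0)
  u : Fin N → Fin (suc m) → ℚ
  u j i = v j i - c j * v p i
  u-zero : ∀ j → u j zero ≡ 0ℚ
  u-zero j = proj₂ (quotient (v j zero) vp≢0)
  extended : (∃ λ r → ∃ λ (κ : Fin r → Fin N) → Independent (λ k → u (κ k) ∘ suc) × Spans κ (λ j → u j ∘ suc)) →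
    ∃ λ r → ∃ λ (κ : Fin r → Fin N) → Independent (v ∘ κ) × Spans κ v
  extended (r , κ , indep , spans) = suc r , κ⁺ , indep⁺ , spans⁺
    where
    κ⁺ : Fin (suc r) → Fin N
    κ⁺ zero    = p
    κ⁺ (suc k) = κ k

    indep⁺ : Independent (v ∘ κ⁺)
    indep⁺ a null = result
      where
      γ : ℕ → ℚ
      γ n = a zero n + sum (λ k → a (suc k) n * c (κ k))
      split : ∀ i n → sum (λ k → a k n * v (κ⁺ k) i) ≡ γ n * v p i + sum (λ k → a (suc k) n * u (κ k) i)
      split i n = sym (trans
        (cong (γ n * v p i +_) (sum-eliminate (λ k → a (suc k) n) (λ k → v (κ k) i) (c ∘ κ) (v p i)))
        (solve 4 (λ a q y x → (a :+ q) :* y :+ (x :- q :* y) := a :* y :+ x) refl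
          (a zero n) (sum λ k → a (suc k) n * c (κ k)) (v p i) (sum λ k → a (suc k) n * v (κ k) i)))
      γ-null : Null γ
      γ-null = Null-cancel vp≢0 (Null-cong (λ n → trans (split zero n) (trans
        (cong (γ n * v p zero +_) (sum-zero λ k → trans (cong (a (suc k) n *_) (u-zero (κ k))) (ℚ.*-zeroʳ (a (suc k) n))))
        (trans (ℚ.+-identityʳ (γ n * v p zero)) (ℚ.*-comm (γ n) (v p zero))))) (null zero))
      tail-null : ∀ k → Null (a (suc k))
      tail-null = indep (a ∘ suc) λ i → Null-cong
        (λ n → trans (cong₂ _-_ (split (suc i) n) (ℚ.*-comm (v p (suc i)) (γ n)))
          (solve 2 (λ x y → (x :+ y) :- x := y) refl (γ n * v p (suc i)) (sum λ k → a (suc k) n * u (κ k) (suc i))))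
        (Null-sub (null (suc i)) (Null-* (v p (suc i)) γ-null))
      result : ∀ k → Null (a k)
      result zero    = Null-cong (λ n → solve 2 (λ x y → (x :+ y) :- y := x) refl (a zero n) (sum λ k → a (suc k) n * c (κ k)))
        (Null-sub γ-null (Null-sum (a ∘ suc) (c ∘ κ) tail-null))
      result (suc k) = tail-null k

    spans⁺ : Spans κ⁺ v
    spans⁺ j = b⁺ , λ i → begin
      v j i
        ≡⟨ solve 3 (λ x c y → x := c :* y :+ (x :- c :* y)) refl (v j i) (c j) (v p i) ⟩
      c j * v p i + u j i
        ≡⟨ cong (c j * v p i +_) (combination i) ⟩
      c j * v p i + sum (λ k → b k * u (κ k) i)
        ≡⟨ cong (c j * v p i +_) (sum-eliminate b (λ k → v (κ k) i) (c ∘ κ) (v p i)) ⟩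
      c j * v p i + (sum (λ k → b k * v (κ k) i) - sum (λ k → b k * c (κ k)) * v p i)
        ≡⟨ solve 4 (λ c q y x → c :* y :+ (x :- q :* y) := (c :- q) :* y :+ x) refl (c j) (sum λ k → b k * c (κ k)) (v p i) (sum λ k → b k * v (κ k) i) ⟩
      b⁺ zero * v p i + sum (λ k → b k * v (κ k) i) ∎
      where
      open ≡-Reasoning
      b : Fin r → ℚ
      b = proj₁ (spans j)
      b⁺ : Fin (suc r) → ℚ
      b⁺ zero    = c j - sum (λ k → b k * c (κ k))
      b⁺ (suc k) = b k
      combination : ∀ i → u j i ≡ sum (λ k → b k * u (κ k) i)
      combination zero    = trans (u-zero j) (sym (sum-zero λ k → trans (cong (b k *_) (u-zero (κ k))) (ℚ.*-zeroʳ (b k))))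
      combination (suc i) = proj₂ (spans j) i

seq-sign : ∀ s n → seq (signToℝ s) n ≡ sign s
seq-sign Sign.+ n = refl
seq-sign Sign.- n = refl

seq-combination : ∀ {s} (a : Fin s → ℝ) (t : Fin s → Sign) n →
  seq (Defs.sum λ k → a k Defs.* signToℝ (t k)) n ≡ sum (λ k → seq (a k) n * sign (t k))
seq-combination {zero}  a t n = refl
seq-combination {suc s} a t n =
  cong₂ _+_ (cong (seq (a zero) n *_) (seq-sign (t zero) n)) (seq-combination (a ∘ suc) (t ∘ suc) n)

≈0⇒Null : ∀ {x} → x ≈ 0# → Null (seq x)
≈0⇒Null {x} x≈0 ε with N , b ← x≈0 ε = N , λ {n} n≥ → subst (λ z → ∣ z ∣ ≤ ε) (ℚ.+-identityʳ (seq x n)) (b n≥)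

Null⇒≈0 : ∀ {x} → Null (seq x) → x ≈ 0#
Null⇒≈0 {x} x-null ε with N , b ← x-null ε = N , λ {n} n≥ → subst (λ z → ∣ z ∣ ≤ ε) (sym (ℚ.+-identityʳ (seq x n))) (b n≥)

Independent⇒LinearlyIndependent : ∀ {s I} (t : Fin s → I → Sign) →
  Independent (λ k i → sign (t k i)) → LinearlyIndependent (λ k i → signToℝ (t k i))
Independent⇒LinearlyIndependent t indep a a-null k = Null⇒≈0 {a k} (indep (λ k → seq (a k))
  (λ i → Null-cong (seq-combination a (λ k → t k i)) (≈0⇒Null {Defs.sum λ k → a k Defs.* signToℝ (t k i)} (a-null i))) k)

-- X is finite up to _~_, which is needed because functions x with x i ∈ Fin (k i) can only
-- be enumerated up to pointwise equality.
record Represents {X : Set} (_~_ : X → X → Set) (K : ℕ) : Set where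
  field
    ~-refl : ∀ x → x ~ x
    pick   : Fin K → X
    index  : X → Fin K
    sound  : ∀ x → pick (index x) ~ x

-- More than r columns have dependent coefficient vectors over a basis. The resulting relation has
-- constant rational coefficients, and a nonzero constant is not null, so the columns are dependent
-- over the reals too.
rank-exists : ∀ {X Y : Set} {_~_ _≋_ K L} (M : Matrix Sign X Y) → Represents {X} _~_ K → Represents {Y} _≋_ L →
  (∀ {x x′ y y′} → x ~ x′ → y ≋ y′ → M x y ≡ M x′ y′) → ∃ λ r → IsRank (λ x y → signToℝ (M x y)) r
rank-exists {X} {Y} {_} {_} {K} {L} M RX RY respects = rank (basis K v)
  where
  module X = Represents RX
  module Y = Represents RY
  v : Fin L → Fin K → ℚ
  v j i = sign (M (X.pick i) (Y.pick j))
  v-index : ∀ x y → sign (M x y) ≡ v (Y.index y) (X.index x)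
  v-index x y = cong sign (sym (respects (X.sound x) (Y.sound y)))

  rank : (∃ λ r → ∃ λ (κ : Fin r → Fin L) → Independent (v ∘ κ) × Spans κ v) → ∃ λ r → IsRank (λ x y → signToℝ (M x y)) r
  rank (r , κ , indep , spans) = r , (Y.pick ∘ κ , Independent⇒LinearlyIndependent (λ k x → M x (Y.pick (κ k)))
      (λ a null → indep a (null ∘ X.pick))) , λ κ′ li → ℕ.≮⇒≥ (maximal κ′ li)
    where
    maximal : ∀ {s} (κ′ : Fin s → Y) → LinearlyIndependent (λ k x → signToℝ (M x (κ′ k))) → ¬ r ℕ.< s
    maximal {s} κ′ li r<s = refute (dependency r r<s b)
      where
      b : Fin s → Fin r → ℚ
      b k = proj₁ (spans (Y.index (κ′ k)))
      refute : ¬ (∃ λ (α : Fin s → ℚ) → (∃ λ k → α k ≢ 0ℚ) × ∀ i → sum (λ k → α k * b k i) ≡ 0ℚ)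
      refute (α , (k , αk≢0) , z) = αk≢0 (Null-constant (≈0⇒Null {fromℚ (α k)} (li (fromℚ ∘ α) (λ x →
        Null⇒≈0 {Defs.sum λ k → fromℚ (α k) Defs.* signToℝ (M x (κ′ k))}
          (Null-cong (λ n → sym (trans (seq-combination (fromℚ ∘ α) (λ k → M x (κ′ k)) n) (vanish x))) Null-0)) k)))
        where
        open ≡-Reasoning
        vanish : ∀ x → sum (λ k → α k * sign (M x (κ′ k))) ≡ 0ℚ
        vanish x = begin
          sum (λ k → α k * sign (M x (κ′ k)))
            ≡⟨ sum-cong-≗ (λ k → cong (α k *_) (trans (v-index x (κ′ k)) (proj₂ (spans (Y.index (κ′ k))) (X.index x)))) ⟩
          sum (λ k → α k * sum (λ i → b k i * w i))
            ≡⟨ sum-cong-≗ (λ k → trans (*-distribˡ-sum (α k) (λ i → b k i * w i)) (sum-cong-≗ λ i → sym (ℚ.*-assoc (α k) (b k i) (w i)))) ⟩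
          sum (λ k → sum (λ i → α k * b k i * w i))
            ≡⟨ ∑-comm (λ k i → α k * b k i * w i) ⟩
          sum (λ i → sum (λ k → α k * b k i * w i))
            ≡⟨ sum-zero (λ i → trans (sym (*-distribʳ-sum (w i) (λ k → α k * b k i))) (trans (cong (_* w i) (z i)) (ℚ.*-zeroˡ (w i)))) ⟩
          0ℚ ∎
          where
          w : Fin r → ℚ
          w i = v (κ i) (X.index x)

-- Protocols

bind : ∀ {X Y A Z : Set} → Protocol X Y A → (A → Protocol X Y Z) → Protocol X Y Z
bind (output a)    c = c a
bind (alice b t f) c = alice b (bind t c) (bind f c)
bind (bob b t f)   c = bob b (bind t c) (bind f c)

run-bind : ∀ {X Y A Z : Set} (π : Protocol X Y A) (c : A → Protocol X Y Z) x y →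
  run (bind π c) x y ≡ run (c (run π x y)) x y
run-bind (output a)    c x y = refl
run-bind (alice b t f) c x y with b x
... | true  = run-bind t c x y
... | false = run-bind f c x y
run-bind (bob b t f)   c x y with b y
... | true  = run-bind t c x y
... | false = run-bind f c x y

cost-bind : ∀ {X Y A Z : Set} (π : Protocol X Y A) (c : A → Protocol X Y Z) {m} → (∀ a → cost (c a) ℕ.≤ m) →
  cost (bind π c) ℕ.≤ cost π ℕ.+ m
cost-bind (output a)    c c≤ = c≤ a
cost-bind (alice b t f) c {m} c≤ = s≤s (ℕ.⊔-lub
  (ℕ.≤-trans (cost-bind t c c≤) (ℕ.+-monoˡ-≤ m (ℕ.m≤m⊔n (cost t) (cost f))))
  (ℕ.≤-trans (cost-bind f c c≤) (ℕ.+-monoˡ-≤ m (ℕ.m≤n⊔m (cost t) (cost f)))))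
cost-bind (bob b t f)   c {m} c≤ = s≤s (ℕ.⊔-lub
  (ℕ.≤-trans (cost-bind t c c≤) (ℕ.+-monoˡ-≤ m (ℕ.m≤m⊔n (cost t) (cost f))))
  (ℕ.≤-trans (cost-bind f c c≤) (ℕ.+-monoˡ-≤ m (ℕ.m≤n⊔m (cost t) (cost f)))))

pullback : ∀ {X Y X′ Y′ Z : Set} → (X′ → X) → (Y′ → Y) → Protocol X Y Z → Protocol X′ Y′ Z
pullback p q (output z)    = output z
pullback p q (alice b t f) = alice (b ∘ p) (pullback p q t) (pullback p q f)
pullback p q (bob b t f)   = bob (b ∘ q) (pullback p q t) (pullback p q f)

run-pullback : ∀ {X Y X′ Y′ Z : Set} (p : X′ → X) (q : Y′ → Y) (π : Protocol X Y Z) x y →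
  run (pullback p q π) x y ≡ run π (p x) (q y)
run-pullback p q (output z)    x y = refl
run-pullback p q (alice b t f) x y = cong₂ (if b (p x) then_else_) (run-pullback p q t x y) (run-pullback p q f x y)
run-pullback p q (bob b t f)   x y = cong₂ (if b (q y) then_else_) (run-pullback p q t x y) (run-pullback p q f x y)

cost-pullback : ∀ {X Y X′ Y′ Z : Set} (p : X′ → X) (q : Y′ → Y) (π : Protocol X Y Z) → cost (pullback p q π) ≡ cost π
cost-pullback p q (output z)    = refl
cost-pullback p q (alice b t f) = cong suc (cong₂ ℕ._⊔_ (cost-pullback p q t) (cost-pullback p q f))
cost-pullback p q (bob b t f)   = cong suc (cong₂ ℕ._⊔_ (cost-pullback p q t) (cost-pullback p q f))

-- Relevant variables and protocols from decision trees

Relevant : ∀ {n} → (Cube n → Sign) → Fin n → Set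
Relevant f j = ∃ λ x → f (x [ j ]≔ true) ≢ f (x [ j ]≔ false)

relevant? : ∀ {n} (f : Cube n → Sign) j → Dec (Relevant f j)
relevant? f j = anySubset? λ x → ¬? (f (x [ j ]≔ true) Sign.≟ f (x [ j ]≔ false))

relevant-restriction : ∀ {n} (f : Cube n → Sign) i b j → Relevant (λ x → f (x [ i ]≔ b)) j → Relevant f j
relevant-restriction f i b j (x , f≢) with i Fin.≟ j
... | yes refl = contradiction (cong f (trans (Vec.[]≔-idempotent x i) (sym (Vec.[]≔-idempotent x i)))) f≢
... | no i≢j   = x [ i ]≔ b , λ f≡ → f≢ (trans (cong f (Vec.[]≔-commutes x j i (i≢j ∘ sym)))
                   (trans f≡ (cong f (Vec.[]≔-commutes x i j i≢j))))

irrelevant : ∀ {n} (f : Cube n → Sign) j → ¬ Relevant f j → ∀ x → f (x [ j ]≔ false) ≡ f x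
irrelevant f j ¬rel x with lookup x j in eq
... | false = cong f (trans (cong (x [ j ]≔_) (sym eq)) (Vec.[]≔-lookup x j))
... | true  = trans (sym (decidable-stable (_ Sign.≟ _) λ f≢ → ¬rel (x , f≢)))
                (cong f (trans (cong (x [ j ]≔_) (sym eq)) (Vec.[]≔-lookup x j)))

-- Bit protocols of cost m are supplied only for variables on which the current function depends. A
-- query of any other variable is answered `false` without communication, which leaves the value
-- unchanged.
tree-protocol : ∀ {n k m} {X Y : Set} (v : X → Y → Cube n) {f : Cube n → Sign} → DecisionTree f k →
  (∀ j → Relevant f j → ∃ λ π → Computes π (λ x y → lookup (v x y) j) × cost π ℕ.≤ m) →
  ∃ λ π → Computes π (λ x y → f (v x y)) × cost π ℕ.≤ k ℕ.* m
tree-protocol v (leaf c e) bits = output c , (λ x y → sym (e (v x y))) , z≤n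
tree-protocol {suc n} {suc k} {m} v {f} (query j t u) bits
  with τ , τ-computes , τ≤ ← tree-protocol v t (λ i → bits i ∘ relevant-restriction f j true i)
  with υ , υ-computes , υ≤ ← tree-protocol v u (λ i → bits i ∘ relevant-restriction f j false i)
  with relevant? f j
... | no ¬rel = υ , (λ x y → trans (υ-computes x y) (irrelevant f j ¬rel (v x y))) , ℕ.≤-trans υ≤ (ℕ.m≤n+m (k ℕ.* m) m)
... | yes rel with π , π-computes , π≤ ← bits j rel = bind π next , correct ,
    ℕ.≤-trans (cost-bind π next next≤) (ℕ.+-monoˡ-≤ (k ℕ.* m) π≤)
  where
  next : Bool → Protocol _ _ Sign
  next true  = τ
  next false = υ
  next≤ : ∀ b → cost (next b) ℕ.≤ k ℕ.* m
  next≤ true  = τ≤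
  next≤ false = υ≤
  next-computes : ∀ b x y → run (next b) x y ≡ f (v x y [ j ]≔ b)
  next-computes true  = τ-computes
  next-computes false = υ-computes
  correct : Computes (bind π next) (λ x y → f (v x y))
  correct x y = begin
    run (bind π next) x y                 ≡⟨ run-bind π next x y ⟩
    run (next (run π x y)) x y            ≡⟨ cong (λ b → run (next b) x y) (π-computes x y) ⟩
    run (next (lookup (v x y) j)) x y     ≡⟨ next-computes (lookup (v x y) j) x y ⟩
    f (v x y [ j ]≔ lookup (v x y) j)     ≡⟨ cong f (Vec.[]≔-lookup (v x y) j) ⟩
    f (v x y)                             ∎
    where open ≡-Reasoning

-- Existence of the communication complexity

least : ∀ {P : ℕ → Set} → (∀ n → Dec (P n)) → ∀ n → P n → ∃ λ m → P m × (∀ k → P k → m ℕ.≤ k)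
least P? n p with P? 0
least P? n       p | yes p₀ = 0 , p₀ , λ _ _ → z≤n
least P? zero    p | no ¬p₀ = contradiction p ¬p₀
least P? (suc n) p | no ¬p₀ with m , pₘ , m-least ← least (P? ∘ suc) n p =
  suc m , pₘ , λ { zero p₀ → contradiction p₀ ¬p₀ ; (suc k) pₖ → s≤s (m-least k pₖ) }

module Search {K L} (h : Fin K → Fin L → Sign) where

  -- Correctness is asked only on the rectangle of inputs consistent with the bits sent so far. The
  -- first bit then splits A or B into two parts, of which there are finitely many choices, so
  -- solvability at cost d is decidable by recursion on d.
  Solves : Protocol (Fin K) (Fin L) Sign → (Fin K → Bool) → (Fin L → Bool) → Set
  Solves π A B = ∀ x y → A x ≡ true → B y ≡ true → run π x y ≡ h x y

  Solvable : ℕ → (Fin K → Bool) → (Fin L → Bool) → Set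
  Solvable d A B = ∃ λ π → cost π ℕ.≤ d × Solves π A B

  both : ∀ b c → b ∧ c ≡ true → b ≡ true × c ≡ true
  both true true _ = refl , refl

  split : ∀ b c {P : Set} → b ≡ true → (c ≡ true → b ∧ c ≡ true → P) → (c ≡ false → b ∧ not c ≡ true → P) → P
  split true true  _ t f = t refl refl
  split true false _ t f = f refl refl

  Constant : (Fin K → Bool) → (Fin L → Bool) → Sign → Set
  Constant A B z = ∀ x y → A x ≡ true → B y ≡ true → z ≡ h x y

  constant? : ∀ A B z → Dec (Constant A B z)
  constant? A B z = Fin.all? λ x → Fin.all? λ y → (A x Bool.≟ true) →-dec (B y Bool.≟ true) →-dec (z Sign.≟ h x y)

  AliceSplit BobSplit : ℕ → (Fin K → Bool) → (Fin L → Bool) → Set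
  AliceSplit d A B = ∃ λ S → Solvable d (λ x → A x ∧ lookup S x) B × Solvable d (λ x → A x ∧ not (lookup S x)) B
  BobSplit   d A B = ∃ λ S → Solvable d A (λ y → B y ∧ lookup S y) × Solvable d A (λ y → B y ∧ not (lookup S y))

  build₀ : ∀ {A B} → Constant A B Sign.+ ⊎ Constant A B Sign.- → Solvable 0 A B
  build₀ (inj₁ c) = output Sign.+ , z≤n , c
  build₀ (inj₂ c) = output Sign.- , z≤n , c

  analyse₀ : ∀ {A B} → Solvable 0 A B → Constant A B Sign.+ ⊎ Constant A B Sign.-
  analyse₀ (output Sign.+ , _ , s) = inj₁ s
  analyse₀ (output Sign.- , _ , s) = inj₂ s

  build : ∀ {d A B} → Solvable d A B ⊎ AliceSplit d A B ⊎ BobSplit d A B → Solvable (suc d) A B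
  build (inj₁ (π , π≤ , s)) = π , ℕ.m≤n⇒m≤1+n π≤ , s
  build {A = A} {B} (inj₂ (inj₁ (S , (t , t≤ , st) , (f , f≤ , sf)))) = alice (lookup S) t f , s≤s (ℕ.⊔-lub t≤ f≤) ,
    λ x y x∈A y∈B → split (A x) (lookup S x) x∈A
      (λ eq x∈ → trans (cong (if_then run t x y else run f x y) eq) (st x y x∈ y∈B))
      (λ eq x∈ → trans (cong (if_then run t x y else run f x y) eq) (sf x y x∈ y∈B))
  build {A = A} {B} (inj₂ (inj₂ (S , (t , t≤ , st) , (f , f≤ , sf)))) = bob (lookup S) t f , s≤s (ℕ.⊔-lub t≤ f≤) ,
    λ x y x∈A y∈B → split (B y) (lookup S y) y∈B
      (λ eq y∈ → trans (cong (if_then run t x y else run f x y) eq) (st x y x∈A y∈))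
      (λ eq y∈ → trans (cong (if_then run t x y else run f x y) eq) (sf x y x∈A y∈))

  unnot : ∀ {b c} → not b ≡ true → b ≡ c → c ≡ false
  unnot {false} _ refl = refl

  analyse : ∀ {d A B} → Solvable (suc d) A B → Solvable d A B ⊎ AliceSplit d A B ⊎ BobSplit d A B
  analyse (output z , _ , s) = inj₁ (output z , z≤n , s)
  analyse {d} {A} {B} (alice b t f , s≤s π≤ , s) = inj₂ (inj₁ (tabulate b ,
    (t , ℕ.m⊔n≤o⇒m≤o (cost t) (cost f) π≤ , λ x y x∈ y∈ → let x∈A , x∈S = both (A x) _ x∈ in
      trans (cong (if_then run t x y else run f x y) (sym (trans (sym (Vec.lookup∘tabulate b x)) x∈S))) (s x y x∈A y∈)) ,
    (f , ℕ.m⊔n≤o⇒n≤o (cost t) (cost f) π≤ , λ x y x∈ y∈ → let x∈A , x∉S = both (A x) _ x∈ in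
      trans (cong (if_then run t x y else run f x y) (sym (unnot x∉S (Vec.lookup∘tabulate b x)))) (s x y x∈A y∈))))
  analyse {d} {A} {B} (bob b t f , s≤s π≤ , s) = inj₂ (inj₂ (tabulate b ,
    (t , ℕ.m⊔n≤o⇒m≤o (cost t) (cost f) π≤ , λ x y x∈ y∈ → let y∈B , y∈S = both (B y) _ y∈ in
      trans (cong (if_then run t x y else run f x y) (sym (trans (sym (Vec.lookup∘tabulate b y)) y∈S))) (s x y x∈ y∈B)) ,
    (f , ℕ.m⊔n≤o⇒n≤o (cost t) (cost f) π≤ , λ x y x∈ y∈ → let y∈B , y∉S = both (B y) _ y∈ in
      trans (cong (if_then run t x y else run f x y) (sym (unnot y∉S (Vec.lookup∘tabulate b y)))) (s x y x∈ y∈B))))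

  solvable? : ∀ d A B → Dec (Solvable d A B)
  solvable? zero    A B = map-dec build₀ analyse₀ (constant? A B Sign.+ ⊎-dec constant? A B Sign.-)
  solvable? (suc d) A B = map-dec build analyse (solvable? d A B ⊎-dec
    anySubset? (λ S → solvable? d (λ x → A x ∧ lookup S x) B ×-dec solvable? d (λ x → A x ∧ not (lookup S x)) B) ⊎-dec
    anySubset? (λ S → solvable? d A (λ y → B y ∧ lookup S y) ×-dec solvable? d A (λ y → B y ∧ not (lookup S y))))

-- Pullback along `pick` and along `index` carries protocols in both directions at equal cost, so
-- the minimum may be searched for on finite index sets, starting from the cost of π.
complexity-exists : ∀ {X Y : Set} {_~_ _≋_ K L} (M : X → Y → Sign) → Represents {X} _~_ K → Represents {Y} _≋_ L →
  (∀ {x x′ y y′} → x ~ x′ → y ≋ y′ → M x y ≡ M x′ y′) →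
  ∀ π → Computes π M → ∃ λ d → IsCommunicationComplexity M d × d ℕ.≤ cost π
complexity-exists {X} {Y} M RX RY respects π π-computes =
  result (least (λ d → solvable? d (λ _ → true) (λ _ → true)) (cost π) (down π π-computes))
  where
  module X = Represents RX
  module Y = Represents RY
  open Search (λ i j → M (X.pick i) (Y.pick j))

  down : ∀ ρ → Computes ρ M → Solvable (cost ρ) (λ _ → true) (λ _ → true)
  down ρ ρ-computes = pullback X.pick Y.pick ρ , ℕ.≤-reflexive (cost-pullback X.pick Y.pick ρ) ,
    λ i j _ _ → trans (run-pullback X.pick Y.pick ρ i j) (ρ-computes (X.pick i) (Y.pick j))

  result : (∃ λ d → Solvable d (λ _ → true) (λ _ → true) × (∀ k → Solvable k (λ _ → true) (λ _ → true) → d ℕ.≤ k)) →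
    ∃ λ d → IsCommunicationComplexity M d × d ℕ.≤ cost π
  result (d , (ρ , ρ≤d , ρ-solves) , d-least) =
    d , ((up , up-computes , ℕ.≤-antisym (ℕ.≤-trans (ℕ.≤-reflexive (cost-pullback X.index Y.index ρ)) ρ≤d) (d-least (cost up) (down up up-computes))) ,
      λ τ τ-computes → d-least (cost τ) (down τ τ-computes)) , d-least (cost π) (down π π-computes)
    where
    up : Protocol X Y Sign
    up = pullback X.index Y.index ρ
    up-computes : Computes up M
    up-computes x y = trans (run-pullback X.index Y.index ρ x y)
      (trans (ρ-solves (X.index x) (Y.index y) refl refl) (respects (X.sound x) (Y.sound y)))

-- Powers of rationals and reals

0≤1 : 0ℚ ≤ 1ℚ
0≤1 = ι-mono-≤ {0} {1} z≤n

*-mono-≤-nonNeg : ∀ {p q r s} → 0ℚ ≤ r → 0ℚ ≤ q → p ≤ q → r ≤ s → p * r ≤ q * s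
*-mono-≤-nonNeg {p} {q} {r} {s} r≥0 q≥0 p≤q r≤s = ℚ.≤-trans
  (ℚ.*-monoʳ-≤-nonNeg r {{ℚ.nonNegative r≥0}} p≤q) (ℚ.*-monoˡ-≤-nonNeg q {{ℚ.nonNegative q≥0}} r≤s)

^-nonNeg : ∀ {p} k → 0ℚ ≤ p → 0ℚ ≤ p ^ k
^-nonNeg zero    p≥0 = 0≤1
^-nonNeg {p} (suc k) p≥0 = subst (_≤ p * p ^ k) (ℚ.*-zeroʳ 0ℚ) (*-mono-≤-nonNeg ℚ.≤-refl p≥0 p≥0 (^-nonNeg k p≥0))

^-monoˡ-≤ : ∀ {p q} k → 0ℚ ≤ p → p ≤ q → p ^ k ≤ q ^ k
^-monoˡ-≤ zero    p≥0 p≤q = ℚ.≤-refl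
^-monoˡ-≤ (suc k) p≥0 p≤q = *-mono-≤-nonNeg (^-nonNeg k p≥0) (ℚ.≤-trans p≥0 p≤q) p≤q (^-monoˡ-≤ k p≥0 p≤q)

1^k≡1 : ∀ k → 1ℚ ^ k ≡ 1ℚ
1^k≡1 zero    = refl
1^k≡1 (suc k) = trans (ℚ.*-identityˡ (1ℚ ^ k)) (1^k≡1 k)

^-monoʳ-≤ : ∀ {p j k} → 1ℚ ≤ p → j ℕ.≤ k → p ^ j ≤ p ^ k
^-monoʳ-≤ {p} {k = k} p≥1 z≤n = subst (_≤ p ^ k) (1^k≡1 k) (^-monoˡ-≤ k 0≤1 p≥1)
^-monoʳ-≤ {p} {suc j} p≥1 (s≤s j≤k) = *-mono-≤-nonNeg (^-nonNeg j (ℚ.≤-trans 0≤1 p≥1)) (ℚ.≤-trans 0≤1 p≥1) ℚ.≤-refl (^-monoʳ-≤ p≥1 j≤k)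

0^k≡0 : ∀ k .{{_ : ℕ.NonZero k}} → 0ℚ ^ k ≡ 0ℚ
0^k≡0 (suc k) = ℚ.*-zeroˡ (0ℚ ^ k)

ι-^ : ∀ m k → ι (m ℕ.^ k) ≡ ι m ^ k
ι-^ m zero    = refl
ι-^ m (suc k) = trans (ι-* m (m ℕ.^ k)) (cong (ι m *_) (ι-^ m k))

seq-^ : ∀ x k n → seq (x Defs.^ k) n ≡ seq x n ^ k
seq-^ x zero    n = refl
seq-^ x (suc k) n = cong (seq x n *_) (seq-^ x k n)

≤+ε : ∀ {p q} ε .{{_ : Positive ε}} → p ≤ q → p ≤ q + ε
≤+ε {p} {q} ε p≤q = ℚ.≤-trans p≤q (ℚ.≤-trans (ℚ.≤-reflexive (sym (ℚ.+-identityʳ q))) (ℚ.+-monoʳ-≤ q (ℚ.<⇒≤ (ℚ.positive⁻¹ ε))))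

pointwise-≤ : ∀ {x y} → (∀ n → seq x n ≤ seq y n) → x Defs.≤ y
pointwise-≤ {y = y} x≤y ε = 0 , λ {n} _ → ≤+ε ε (x≤y n)

fromℕ-cancel-≤ : ∀ {m n} → ι m ≤ ι n + ½ → m ℕ.≤ n
fromℕ-cancel-≤ {m} {n} m≤n+½ = ℕ.≮⇒≥ λ n<m → ℚ.<-irrefl refl (begin-strict
  ι n + ½          <⟨ ℚ.+-monoʳ-< (ι n) ½<1 ⟩
  ι n + 1ℚ         ≡⟨ ι-suc n ⟨
  ι (suc n)        ≤⟨ ι-mono-≤ n<m ⟩
  ι m              ≤⟨ m≤n+½ ⟩
  ι n + ½          ∎)
  where
  open ℚ.≤-Reasoning
  ½<1 : ½ ℚ.< 1ℚ
  ½<1 = ℚ.*<* (ℤ.+<+ (s≤s (s≤s z≤n)))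


/-mono-≤ : ∀ a m b n → a ℕ.* suc n ℕ.≤ b ℕ.* suc m → ℤ.+ a ℚ./ suc m ≤ ℤ.+ b ℚ./ suc n
/-mono-≤ a m b n le = ℚ.toℚᵘ-cancel-≤ (begin
  ℚ.toℚᵘ (ℚ.fromℚᵘ p)   ≃⟨ ℚ.toℚᵘ-fromℚᵘ p ⟩
  p                     ≤⟨ ℚᵘ.*≤* (subst₂ ℤ._≤_ (ℤ.pos-* a (suc n)) (ℤ.pos-* b (suc m)) (ℤ.+≤+ le)) ⟩
  q                     ≃⟨ ℚ.toℚᵘ-fromℚᵘ q ⟨
  ℚ.toℚᵘ (ℚ.fromℚᵘ q)   ∎)
  where
  open ℚᵘ.≤-Reasoning
  p q : ℚᵘ.ℚᵘ
  p = ℚᵘ.mkℚᵘ (ℤ.+ a) m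
  q = ℚᵘ.mkℚᵘ (ℤ.+ b) n

-- ⌊log₂ r^(n+1)⌋ lies between (n+1)⌊log₂ r⌋ and (n+1)(⌊log₂ r⌋ + 1).
log₂-lower : ∀ r n → ι ⌊log₂ r ⌋ ≤ seq (log₂ r) n
log₂-lower zero        n = ℚ.≤-refl
log₂-lower r@(suc _)   n = /-mono-≤ l 0 (ℓ n) n (subst (l ℕ.* suc n ℕ.≤_) (sym (ℕ.*-identityʳ (ℓ n)))
  (subst (ℕ._≤ ℓ n) (⌊log₂[2^n]⌋≡n (l ℕ.* suc n)) (⌊log₂⌋-mono-≤ (begin
    2 ℕ.^ (l ℕ.* suc n)       ≡⟨ ℕ.^-*-assoc 2 l (suc n) ⟨
    (2 ℕ.^ l) ℕ.^ suc n       ≤⟨ ℕ.^-monoˡ-≤ (suc n) (2^⌊log₂n⌋≤n r) ⟩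
    r ℕ.^ suc n               ∎))))
  where
  open Log₂Approximation r
  open ℕ.≤-Reasoning
  l : ℕ
  l = ⌊log₂ r ⌋

log₂-upper : ∀ r n → seq (log₂ r) n ≤ ι (suc ⌊log₂ r ⌋)
log₂-upper zero      n = 0≤1
log₂-upper r@(suc _) n = begin
  approximation n                ≤⟨ approximation-≤ n 0 ⟩
  approximation 0 + 1ℚ           ≡⟨ cong (λ k → ι ⌊log₂ k ⌋ + 1ℚ) (ℕ.*-identityʳ r) ⟩
  ι ⌊log₂ r ⌋ + 1ℚ               ≡⟨ ι-suc ⌊log₂ r ⌋ ⟨
  ι (suc ⌊log₂ r ⌋)              ∎
  where
  open Log₂Approximation r
  open ℚ.≤-Reasoning

log₂-nonNeg : ∀ r n → 0ℚ ≤ seq (log₂ r) n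
log₂-nonNeg r n = ℚ.≤-trans (ι-mono-≤ {0} {⌊log₂ r ⌋} z≤n) (log₂-lower r n)

log₂1≡0 : ∀ n → seq (log₂ 1) n ≡ 0ℚ
log₂1≡0 n = trans (cong (λ k → ℤ.+ ⌊log₂ k ⌋ ℚ./ suc n) (ℕ.^-zeroˡ (suc n))) (ℚ.0/n≡0 (suc n))

log₂2≡1 : ∀ n → seq (log₂ 2) n ≡ 1ℚ
log₂2≡1 n = ℚ.≤-antisym
  (subst (λ k → ℤ.+ k ℚ./ suc n ≤ 1ℚ) (sym (⌊log₂[2^n]⌋≡n (suc n)))
    (/-mono-≤ (suc n) n 1 0 (ℕ.≤-reflexive (ℕ.*-comm (suc n) 1))))
  (log₂-lower 2 n)

-- Since 8 ≤ 9, log₂ 3 ≥ 3/2.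
log₂≥3/2 : ∀ r → 3 ℕ.≤ r → ∀ n → ℤ.+ 3 ℚ./ 2 ≤ seq (log₂ r) (suc (n ℕ.* 2))
log₂≥3/2 r@(suc _) r≥3 n = /-mono-≤ 3 1 (ℓ (suc (n ℕ.* 2))) (suc (n ℕ.* 2)) (begin
  3 ℕ.* (suc n ℕ.* 2)                       ≡⟨ ℕ.*-assoc 3 (suc n) 2 ⟨
  3 ℕ.* suc n ℕ.* 2                         ≤⟨ ℕ.*-monoˡ-≤ 2 (subst (ℕ._≤ ℓ (suc (n ℕ.* 2))) (⌊log₂[2^n]⌋≡n (3 ℕ.* suc n)) (⌊log₂⌋-mono-≤ (begin
    2 ℕ.^ (3 ℕ.* suc n)                         ≡⟨ ℕ.^-*-assoc 2 3 (suc n) ⟨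
    8 ℕ.^ suc n                                 ≤⟨ ℕ.^-monoˡ-≤ (suc n) (ℕ.n≤1+n 8) ⟩
    9 ℕ.^ suc n                                 ≡⟨ ℕ.^-*-assoc 3 2 (suc n) ⟩
    3 ℕ.^ (2 ℕ.* suc n)                         ≡⟨ cong (3 ℕ.^_) (ℕ.*-comm 2 (suc n)) ⟩
    3 ℕ.^ (suc n ℕ.* 2)                         ≤⟨ ℕ.^-monoˡ-≤ (suc n ℕ.* 2) r≥3 ⟩
    r ℕ.^ (suc n ℕ.* 2)                         ∎))) ⟩
  ℓ (suc (n ℕ.* 2)) ℕ.* 2                   ∎)
  where
  open Log₂Approximation r
  open ℕ.≤-Reasoning

log₂≰1 : ∀ r → 3 ℕ.≤ r → ¬ log₂ r Defs.≤ 1#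
log₂≰1 r r≥3 x≤1 with N , b ← x≤1 (ℤ.+ 1 ℚ./ 4) = ℚ.<-irrefl refl (begin-strict
  1ℚ + ℤ.+ 1 ℚ./ 4                     <⟨ ℚ.*<* (ℤ.+<+ (ℕ.≤ᵇ⇒≤ 11 12 _)) ⟩
  ℤ.+ 3 ℚ./ 2                          ≤⟨ log₂≥3/2 r r≥3 N ⟩
  seq (log₂ r) (suc (N ℕ.* 2))       ≤⟨ b (ℕ.≤-trans (ℕ.m≤m*n N 2) (ℕ.n≤1+n (N ℕ.* 2))) ⟩
  1ℚ + ℤ.+ 1 ℚ./ 4                     ∎)
  where open ℚ.≤-Reasoning

1≰0 : ∀ {x} → (∀ n → seq x n ≡ 0ℚ) → ¬ 1# Defs.≤ x
1≰0 {x} x≡0 1≤x with N , b ← 1≤x ½ = contradiction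
  (fromℕ-cancel-≤ {1} {0} (subst (λ q → 1ℚ ≤ q + ½) (x≡0 N) (b ℕ.≤-refl))) λ ()

-- `IsPower` has separate clauses for bases above and below 1. The logarithm of a natural number is
-- 0, 1 or greater than 1, and the last case also refutes the hypothesis of the decreasing clause.
data LogCase (r : ℕ) : Set where
  zero  : (∀ n → seq (log₂ r) n ≡ 0ℚ) → LogCase r
  one   : (∀ n → seq (log₂ r) n ≡ 1ℚ) → LogCase r
  large : (∀ n → 1ℚ ≤ seq (log₂ r) n) → ¬ log₂ r Defs.≤ 1# → LogCase r

logCase : ∀ r → LogCase r
logCase 0 = zero λ _ → refl
logCase 1 = zero log₂1≡0
logCase 2 = one log₂2≡1
logCase r@(suc (suc (suc k))) = large
  (λ n → ℚ.≤-trans (ι-mono-≤ {1} {⌊log₂ r ⌋} (⌊log₂⌋-mono-≤ {2} {r} (s≤s (s≤s z≤n)))) (log₂-lower r n))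
  (log₂≰1 r (s≤s (s≤s (s≤s z≤n))))

-- For natural C the terms of y^q are those of x^(qC), so every clause compares two natural powers
-- of x. The order of the exponents is recovered from the real inequality at ε = ½.
natural-power : ∀ r C .{{_ : ℕ.NonZero C}} → IsPower (log₂ r) (fromℕ C) (log₂ r Defs.^ C)
natural-power r C = record
  { nonNegative = pointwise-≤ {0#} {y} λ n → subst (0ℚ ≤_) (sym (seq-^ x C n)) (^-nonNeg C (log₂-nonNeg r n))
  ; increasing  = increasing (logCase r)
  ; decreasing  = decreasing (logCase r)
  }
  where
  x y : ℝ
  x = log₂ r
  y = x Defs.^ C

  seq-x^p : ∀ p n → seq (x Defs.^ p) n ≡ seq x n ^ p
  seq-x^p = seq-^ x

  seq-y^q : ∀ q n → seq (y Defs.^ q) n ≡ seq x n ^ (q ℕ.* C)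
  seq-y^q q n = trans (seq-^ y q n) (trans (cong (_^ q) (seq-^ x C n)) (trans (^-assocʳ (seq x n) C q) (cong (seq x n ^_) (ℕ.*-comm C q))))

  lower : ∀ {p q} → fromℕ p Defs.≤ fromℕ q Defs.* fromℕ C → p ℕ.≤ q ℕ.* C
  lower {p} {q} p≤qC with N , b ← p≤qC ½ = fromℕ-cancel-≤ (subst (λ k → ι p ≤ k + ½) (sym (ι-* q C)) (b ℕ.≤-refl))

  upper : ∀ {p q} → fromℕ q Defs.* fromℕ C Defs.≤ fromℕ p → q ℕ.* C ℕ.≤ p
  upper {p} {q} qC≤p with N , b ← qC≤p ½ = fromℕ-cancel-≤ (subst (λ k → k ≤ ι p + ½) (sym (ι-* q C)) (b ℕ.≤-refl))

  x^p≤y^q : ∀ p q → (∀ n → seq x n ^ p ≤ seq x n ^ (q ℕ.* C)) → x Defs.^ p Defs.≤ y Defs.^ q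
  x^p≤y^q p q le = pointwise-≤ {x Defs.^ p} {y Defs.^ q} λ n → subst₂ _≤_ (sym (seq-x^p p n)) (sym (seq-y^q q n)) (le n)

  y^q≤x^p : ∀ p q → (∀ n → seq x n ^ (q ℕ.* C) ≤ seq x n ^ p) → y Defs.^ q Defs.≤ x Defs.^ p
  y^q≤x^p p q le = pointwise-≤ {y Defs.^ q} {x Defs.^ p} λ n → subst₂ _≤_ (sym (seq-y^q q n)) (sym (seq-x^p p n)) (le n)

  0-power : ∀ {n} k l → seq x n ≡ 0ℚ → .{{_ : ℕ.NonZero k}} → seq x n ^ k ≤ seq x n ^ l
  0-power {n} k l x≡0 = ℚ.≤-trans (ℚ.≤-reflexive (trans (cong (_^ k) x≡0) (0^k≡0 k))) (^-nonNeg l (log₂-nonNeg r n))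

  1-power : ∀ {n} k l → seq x n ≡ 1ℚ → seq x n ^ k ≤ seq x n ^ l
  1-power k l x≡1 = ℚ.≤-reflexive (trans (cong (_^ k) x≡1) (trans (trans (1^k≡1 k) (sym (1^k≡1 l))) (cong (_^ l) (sym x≡1))))

  increasing : LogCase r → 1# Defs.≤ x → ∀ p q .{{_ : ℕ.NonZero q}} →
    (fromℕ p Defs.≤ fromℕ q Defs.* fromℕ C → x Defs.^ p Defs.≤ y Defs.^ q) ×
    (fromℕ q Defs.* fromℕ C Defs.≤ fromℕ p → y Defs.^ q Defs.≤ x Defs.^ p)
  increasing (zero x≡0)    1≤x p q = contradiction 1≤x (1≰0 {x} x≡0)
  increasing (one x≡1)     1≤x p q =
    (λ _ → x^p≤y^q p q λ n → 1-power p (q ℕ.* C) (x≡1 n)) , (λ _ → y^q≤x^p p q λ n → 1-power (q ℕ.* C) p (x≡1 n))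
  increasing (large x≥1 _) 1≤x p q =
    (λ p≤qC → x^p≤y^q p q λ n → ^-monoʳ-≤ (x≥1 n) (lower {p} {q} p≤qC)) , (λ qC≤p → y^q≤x^p p q λ n → ^-monoʳ-≤ (x≥1 n) (upper {p} {q} qC≤p))

  decreasing : LogCase r → x Defs.≤ 1# → ∀ p q .{{_ : ℕ.NonZero q}} →
    (fromℕ p Defs.≤ fromℕ q Defs.* fromℕ C → y Defs.^ q Defs.≤ x Defs.^ p) ×
    (fromℕ q Defs.* fromℕ C Defs.≤ fromℕ p → x Defs.^ p Defs.≤ y Defs.^ q)
  decreasing (zero x≡0)    x≤1 p q =
    (λ _ → y^q≤x^p p q λ n → 0-power (q ℕ.* C) p (x≡0 n)) ,
    -- 0^p is 0 only for p ≥ 1, which follows from 1 ≤ qC ≤ p.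
    (λ qC≤p → x^p≤y^q p q λ n → 0-power p (q ℕ.* C) (x≡0 n) {{ℕ.>-nonZero (ℕ.≤-trans (ℕ.>-nonZero⁻¹ (q ℕ.* C)) (upper {p} {q} qC≤p))}})
    where instance _ = ℕ.m*n≢0 q C
  decreasing (one x≡1)     x≤1 p q =
    (λ _ → y^q≤x^p p q λ n → 1-power (q ℕ.* C) p (x≡1 n)) , (λ _ → x^p≤y^q p q λ n → 1-power p (q ℕ.* C) (x≡1 n))
  decreasing (large _ x≰1) x≤1 p q = contradiction x≤1 x≰1

p≤∣p∣ : ∀ p → p ≤ ∣ p ∣
p≤∣p∣ p with ℚ.≤-total 0ℚ p
... | inj₁ p≥0 = ℚ.≤-reflexive (sym (ℚ.0≤p⇒∣p∣≡p p≥0))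
... | inj₂ p≤0 = ℚ.≤-trans p≤0 (ℚ.0≤∣p∣ p)

archimedean : ∀ q → ∃ λ N → q ≤ ι N
archimedean q@record{} = ℤ.∣ ℚ.↥ q ∣ , ℚ.toℚᵘ-cancel-≤ (ℚᵘ.≤-respʳ-≃ (ℚᵘ.≃-sym (toℚᵘ-ι ℤ.∣ ℚ.↥ q ∣)) (ℚᵘ.*≤* (begin
  ℚ.↥ q ℤ.* ℤ.+ 1                    ≡⟨ ℤ.*-identityʳ (ℚ.↥ q) ⟩
  ℚ.↥ q                              ≤⟨ i≤∣i∣ (ℚ.↥ q) ⟩
  ℤ.+ ℤ.∣ ℚ.↥ q ∣                    ≤⟨ ℤ.+≤+ (ℕ.m≤m*n ℤ.∣ ℚ.↥ q ∣ (ℚ.↧ₙ q)) ⟩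
  ℤ.+ (ℤ.∣ ℚ.↥ q ∣ ℕ.* ℚ.↧ₙ q)       ≡⟨ ℤ.pos-* ℤ.∣ ℚ.↥ q ∣ (ℚ.↧ₙ q) ⟩
  ℤ.+ ℤ.∣ ℚ.↥ q ∣ ℤ.* ℚ.↧ q          ∎)))
  where
  open ℤ.≤-Reasoning
  i≤∣i∣ : ∀ i → i ℤ.≤ ℤ.+ ℤ.∣ i ∣
  i≤∣i∣ (ℤ.+ n)        = ℤ.≤-refl
  i≤∣i∣ (ℤ.-[1+ n ]) = ℤ.-≤+

natural-bound : ∀ c → ∃ λ N → c Defs.≤ fromℕ N
natural-bound c = bound (eventually-bounded {seq c} (cauchy c))
  where
  bound : (Σ ℚ λ B → Positive B × ∃ λ M → ∀ {n} → M ℕ.≤ n → ∣ seq c n ∣ ≤ B) → ∃ λ N → c Defs.≤ fromℕ N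
  bound (B , _ , M , b) = proj₁ (archimedean B) , λ ε → M , λ {n} n≥ →
    ≤+ε {seq c n} {ι (proj₁ (archimedean B))} ε (ℚ.≤-trans (p≤∣p∣ (seq c n)) (ℚ.≤-trans (b {n} n≥) (proj₂ (archimedean B))))

-- Only natural exponents above c are compared with c, except that for log₂ r ≤ 1 the
-- power is at most 1 because c ≥ 0.
power-bound : ∀ {c y} N r → 0# < c → c Defs.≤ fromℕ N → IsPower (log₂ r) c y →
  ∃ λ M → ∀ {n} → M ℕ.≤ n → seq y n ≤ ι (suc ⌊log₂ r ⌋ ℕ.^ N) + 1ℚ
power-bound {c} {y} N r (ε , ε>0 , K , c>0) c≤N y-power = bound (logCase r)
  where
  open ℚ.≤-Reasoning
  x : ℝ
  x = log₂ r
  A : ℕ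
  A = suc ⌊log₂ r ⌋ ℕ.^ N
  use : ∀ {z} → y Defs.^ 1 Defs.≤ z → (∀ n → seq z n ≤ ι A) → ∃ λ M → ∀ {n} → M ℕ.≤ n → seq y n ≤ ι A + 1ℚ
  use y≤z z≤A with M , b ← y≤z 1ℚ = M , λ {n} n≥ → ℚ.≤-trans (ℚ.≤-reflexive (sym (ℚ.*-identityʳ (seq y n))))
    (ℚ.≤-trans (b n≥) (ℚ.+-monoˡ-≤ 1ℚ (z≤A n)))
  x^N≤A : ∀ n → seq (x Defs.^ N) n ≤ ι A
  x^N≤A n = subst₂ _≤_ (sym (seq-^ x N n)) (sym (ι-^ (suc ⌊log₂ r ⌋) N)) (^-monoˡ-≤ N (log₂-nonNeg r n) (log₂-upper r n))
  c≤N′ : fromℕ 1 Defs.* c Defs.≤ fromℕ N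
  c≤N′ ε with M , b ← c≤N ε = M , λ {n} n≥ → subst (_≤ ι N + ε) (sym (ℚ.*-identityˡ (seq c n))) (b n≥)
  0≤c : fromℕ 0 Defs.≤ fromℕ 1 Defs.* c
  0≤c ε′ = K , λ {n} n≥ → ≤+ε ε′ (begin
    0ℚ               ≤⟨ ≤+ε ε {{ε>0}} ℚ.≤-refl ⟩
    0ℚ + ε           ≤⟨ c>0 n≥ ⟩
    seq c n          ≡⟨ ℚ.*-identityˡ (seq c n) ⟨
    1ℚ * seq c n     ∎)
  1≤x : (∀ n → 1ℚ ≤ seq x n) → 1# Defs.≤ x
  1≤x = pointwise-≤ {1#} {x}
  bound : LogCase r → _
  bound (zero x≡0)    = use {1#} (proj₁ (IsPower.decreasing y-power (pointwise-≤ {x} {1#} λ n → ℚ.≤-trans (ℚ.≤-reflexive (x≡0 n)) 0≤1) 0 1) 0≤c)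
    (λ _ → ι-mono-≤ {1} {A} (ℕ.m^n>0 (suc ⌊log₂ r ⌋) N))
  bound (one x≡1)     = use {x Defs.^ N} (proj₂ (IsPower.increasing y-power (1≤x λ n → ℚ.≤-reflexive (sym (x≡1 n))) N 1) c≤N′) x^N≤A
  bound (large x≥1 _) = use {x Defs.^ N} (proj₂ (IsPower.increasing y-power (1≤x x≥1) N 1) c≤N′) x^N≤A

-- Three real inequalities, for y, for c and for d, are each used with slack 1; this is the 3.
complexity-bound : ∀ {c y} N r d → 0# < c → c Defs.≤ fromℕ N → IsPower (log₂ r) c y → fromℕ d Defs.≤ y Defs.+ c →
  d ℕ.≤ suc ⌊log₂ r ⌋ ℕ.^ N ℕ.+ N ℕ.+ 3
complexity-bound {c} {y} N r d c>0 c≤N y-power d≤y+c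
  with J , y≤ ← power-bound {c} {y} N r c>0 c≤N y-power
  with K , c≤ ← c≤N 1ℚ
  with M , d≤ ← d≤y+c 1ℚ
  = ι-cancel-≤ {d} {A ℕ.+ N ℕ.+ 3} (begin
    ι d                                    ≤⟨ d≤ {n} (ℕ.≤-trans (ℕ.m≤n⊔m K M) (ℕ.m≤n⊔m J (K ℕ.⊔ M))) ⟩
    seq y n + seq c n + 1ℚ                 ≤⟨ ℚ.+-monoˡ-≤ 1ℚ (ℚ.+-mono-≤ (y≤ {n} (ℕ.m≤m⊔n J (K ℕ.⊔ M))) (c≤ {n} (ℕ.≤-trans (ℕ.m≤m⊔n K M) (ℕ.m≤n⊔m J (K ℕ.⊔ M))))) ⟩
    (ι A + 1ℚ) + (ι N + 1ℚ) + 1ℚ           ≡⟨ cong₂ (λ a b → a + b + 1ℚ) (ι-+1 A) (ι-+1 N) ⟩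
    ι (A ℕ.+ 1) + ι (N ℕ.+ 1) + 1ℚ         ≡⟨ trans (cong (_+ 1ℚ) (sym (ι-+ (A ℕ.+ 1) (N ℕ.+ 1)))) (ι-+1 ((A ℕ.+ 1) ℕ.+ (N ℕ.+ 1))) ⟩
    ι ((A ℕ.+ 1) ℕ.+ (N ℕ.+ 1) ℕ.+ 1)      ≡⟨ cong ι (regroup A N) ⟩
    ι (A ℕ.+ N ℕ.+ 3)                      ∎)
  where
  open ℚ.≤-Reasoning
  A n : ℕ
  A = suc ⌊log₂ r ⌋ ℕ.^ N
  n = J ℕ.⊔ (K ℕ.⊔ M)
  ι-+1 : ∀ k → ι k + 1ℚ ≡ ι (k ℕ.+ 1)
  ι-+1 k = sym (ι-+ k 1)
  regroup : ∀ a n → (a ℕ.+ 1) ℕ.+ (n ℕ.+ 1) ℕ.+ 1 ≡ a ℕ.+ n ℕ.+ 3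
  regroup = ℕ-Ring.solve-∀

natural-≤-power : ∀ d r C → d ℕ.≤ ⌊log₂ r ⌋ ℕ.^ C ℕ.+ C → fromℕ d Defs.≤ log₂ r Defs.^ C Defs.+ fromℕ C
natural-≤-power d r C d≤ = pointwise-≤ {fromℕ d} {log₂ r Defs.^ C Defs.+ fromℕ C} λ n → begin
  ι d                                    ≤⟨ ι-mono-≤ d≤ ⟩
  ι (⌊log₂ r ⌋ ℕ.^ C ℕ.+ C)              ≡⟨ trans (ι-+ (⌊log₂ r ⌋ ℕ.^ C) C) (cong (_+ ι C) (ι-^ ⌊log₂ r ⌋ C)) ⟩
  ι ⌊log₂ r ⌋ ^ C + ι C                  ≤⟨ ℚ.+-monoˡ-≤ (ι C) (^-monoˡ-≤ C (ι-mono-≤ {0} {⌊log₂ r ⌋} z≤n) (log₂-lower r n)) ⟩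
  seq (log₂ r) n ^ C + ι C               ≡⟨ cong (_+ ι C) (seq-^ (log₂ r) C n) ⟨
  seq (log₂ r Defs.^ C) n + ι C          ∎
  where open ℚ.≤-Reasoning

-- Numerical bounds

^-distribʳ-* : ∀ k m n → (m ℕ.* n) ℕ.^ k ≡ m ℕ.^ k ℕ.* n ℕ.^ k
^-distribʳ-* zero    m n = refl
^-distribʳ-* (suc k) m n = trans (cong (m ℕ.* n ℕ.*_) (^-distribʳ-* k m n)) (regroup m n (m ℕ.^ k) (n ℕ.^ k))
  where
  regroup : ∀ a b c d → a ℕ.* b ℕ.* (c ℕ.* d) ≡ a ℕ.* c ℕ.* (b ℕ.* d)
  regroup = ℕ-Ring.solve-∀

-- Squaring makes the base (3/2)² = 9/4 exceed 2. This is the source of the factor 2 in front of the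
-- logarithm in `size-bound`.
square-bound : ∀ s r → 3 ℕ.^ s ℕ.≤ 2 ℕ.^ s ℕ.* r → 2 ℕ.^ s ℕ.≤ r ℕ.* r
square-bound s r le = ℕ.*-cancelˡ-≤ (4 ℕ.^ s) {{ℕ.m^n≢0 4 s}} (begin
  4 ℕ.^ s ℕ.* 2 ℕ.^ s                        ≡⟨ ^-distribʳ-* s 4 2 ⟨
  8 ℕ.^ s                                    ≤⟨ ℕ.^-monoˡ-≤ s (ℕ.n≤1+n 8) ⟩
  9 ℕ.^ s                                    ≡⟨ ^-distribʳ-* s 3 3 ⟩
  3 ℕ.^ s ℕ.* 3 ℕ.^ s                        ≤⟨ ℕ.*-mono-≤ le le ⟩
  (2 ℕ.^ s ℕ.* r) ℕ.* (2 ℕ.^ s ℕ.* r)        ≡⟨ regroup (2 ℕ.^ s) r ⟩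
  (2 ℕ.^ s ℕ.* 2 ℕ.^ s) ℕ.* (r ℕ.* r)        ≡⟨ cong (ℕ._* (r ℕ.* r)) (^-distribʳ-* s 2 2) ⟨
  4 ℕ.^ s ℕ.* (r ℕ.* r)                      ∎)
  where
  open ℕ.≤-Reasoning
  regroup : ∀ p r → (p ℕ.* r) ℕ.* (p ℕ.* r) ≡ (p ℕ.* p) ℕ.* (r ℕ.* r)
  regroup = ℕ-Ring.solve-∀

size-bound : ∀ s r → 3 ℕ.^ s ℕ.≤ 2 ℕ.^ s ℕ.* r → s ℕ.≤ suc (2 ℕ.* ⌊log₂ r ⌋)
size-bound s r le = ℕ.≮⇒≥ λ lt → ℕ.<-irrefl refl (begin-strict
  2 ℕ.^ s                                    ≤⟨ square-bound s r le ⟩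
  r ℕ.* r                                    <⟨ ℕ.*-mono-< (n<2^[1+⌊log₂n⌋] r) (n<2^[1+⌊log₂n⌋] r) ⟩
  2 ℕ.^ suc l ℕ.* 2 ℕ.^ suc l                ≡⟨ ℕ.^-distribˡ-+-* 2 (suc l) (suc l) ⟨
  2 ℕ.^ (suc l ℕ.+ suc l)                    ≤⟨ ℕ.^-monoʳ-≤ 2 (subst (ℕ._≤ s) (double l) lt) ⟩
  2 ℕ.^ s                                    ∎)
  where
  open ℕ.≤-Reasoning
  l : ℕ
  l = ⌊log₂ r ⌋
  double : ∀ l → suc (suc (2 ℕ.* l)) ≡ suc l ℕ.+ suc l
  double = ℕ-Ring.solve-∀

K-mono : ∀ {m n} → m ℕ.≤ n → K m ℕ.≤ K n
K-mono m≤n = ℕ.*-mono-≤ (s≤s (ℕ.*-monoˡ-≤ 2 m≤n)) (ℕ.*-mono-≤ m≤n m≤n)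

depth-bound : ∀ d → depth d ℕ.≤ d ℕ.* (K d ℕ.* d)
depth-bound zero    = z≤n
depth-bound (suc d) = ℕ.+-monoʳ-≤ (K (suc d) ℕ.* suc d)
  (ℕ.≤-trans (depth-bound d) (ℕ.*-monoʳ-≤ d (ℕ.*-mono-≤ (K-mono (ℕ.n≤1+n d)) (ℕ.n≤1+n d))))

depth≤3d⁵ : ∀ d → depth (suc d) ℕ.≤ 3 ℕ.* suc d ℕ.^ 5
depth≤3d⁵ d = begin
  depth m                                                      ≤⟨ depth-bound m ⟩
  m ℕ.* (suc (m ℕ.* 2) ℕ.* (m ℕ.* m) ℕ.* m)                    ≤⟨ ℕ.*-monoʳ-≤ m (ℕ.*-monoˡ-≤ m (ℕ.*-monoˡ-≤ (m ℕ.* m) (ℕ.+-monoˡ-≤ (m ℕ.* 2) (s≤s (z≤n {d}))))) ⟩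
  m ℕ.* ((m ℕ.+ m ℕ.* 2) ℕ.* (m ℕ.* m) ℕ.* m)                  ≡⟨ collect m ⟩
  3 ℕ.* m ℕ.^ 5                                                ∎
  where
  open ℕ.≤-Reasoning
  m : ℕ
  m = suc d
  collect : ∀ m → m ℕ.* ((m ℕ.+ m ℕ.* 2) ℕ.* (m ℕ.* m) ℕ.* m) ≡ 3 ℕ.* (m ℕ.* (m ℕ.* (m ℕ.* (m ℕ.* (m ℕ.* 1)))))
  collect = ℕ-Ring.solve-∀

n≤2^n : ∀ n → n ℕ.≤ 2 ℕ.^ n
n≤2^n zero    = z≤n
n≤2^n (suc n) = ℕ.+-mono-≤ (ℕ.m^n>0 2 n) (ℕ.≤-trans (n≤2^n n) (ℕ.≤-reflexive (sym (ℕ.+-identityʳ (2 ℕ.^ n)))))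

-- 729 is 3 · 3^5: the 3 comes from `depth≤3d⁵`, the 3^5 from 1 + 2l ≤ 3l. Likewise 2^N comes from 1
-- + l ≤ 2l. The remaining power of l has exponent 5 + N.
scale exponent : ℕ → ℕ
scale N    = 729 ℕ.* (2 ℕ.^ N ℕ.+ (N ℕ.+ 3))
exponent N = scale N ℕ.+ (5 ℕ.+ N)

-- For l ≥ 2 the factor moves into the exponent, as A ≤ 2^A ≤ l^A; for l = 1 powers do not grow and
-- the additive term takes it.
absorb-scale : ∀ A M l .{{_ : ℕ.NonZero l}} → A ℕ.* l ℕ.^ M ℕ.≤ l ℕ.^ (A ℕ.+ M) ℕ.+ (A ℕ.+ M)
absorb-scale A M 1 = begin
  A ℕ.* 1 ℕ.^ M                            ≡⟨ trans (cong (A ℕ.*_) (ℕ.^-zeroˡ M)) (ℕ.*-identityʳ A) ⟩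
  A                                        ≤⟨ ℕ.m≤m+n A M ⟩
  A ℕ.+ M                                  ≤⟨ ℕ.m≤n+m (A ℕ.+ M) (1 ℕ.^ (A ℕ.+ M)) ⟩
  1 ℕ.^ (A ℕ.+ M) ℕ.+ (A ℕ.+ M)            ∎
  where open ℕ.≤-Reasoning
absorb-scale A M l@(suc (suc _)) = begin
  A ℕ.* l ℕ.^ M                            ≤⟨ ℕ.*-monoˡ-≤ (l ℕ.^ M) (ℕ.≤-trans (n≤2^n A) (ℕ.^-monoˡ-≤ A (s≤s (s≤s z≤n)))) ⟩
  l ℕ.^ A ℕ.* l ℕ.^ M                      ≡⟨ ℕ.^-distribˡ-+-* l A M ⟨
  l ℕ.^ (A ℕ.+ M)                          ≤⟨ ℕ.m≤m+n (l ℕ.^ (A ℕ.+ M)) (A ℕ.+ M) ⟩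
  l ℕ.^ (A ℕ.+ M) ℕ.+ (A ℕ.+ M)            ∎
  where open ℕ.≤-Reasoning

final-bound : ∀ N l → 3 ℕ.* suc (2 ℕ.* l) ℕ.^ 5 ℕ.* (suc l ℕ.^ N ℕ.+ N ℕ.+ 3) ℕ.≤ l ℕ.^ exponent N ℕ.+ exponent N
-- For l = 0 the estimates 1 + 2l ≤ 3l and 1 + l ≤ 2l fail, and the additive constant carries the
-- whole bound.
final-bound N zero = begin
  3 ℕ.* (1 ℕ.^ N ℕ.+ N ℕ.+ 3)                   ≡⟨ cong (3 ℕ.*_) (ℕ.+-assoc (1 ℕ.^ N) N 3) ⟩
  3 ℕ.* (1 ℕ.^ N ℕ.+ (N ℕ.+ 3))                 ≤⟨ ℕ.*-mono-≤ (ℕ.≤ᵇ⇒≤ 3 729 _) (ℕ.+-monoˡ-≤ (N ℕ.+ 3) (ℕ.^-monoˡ-≤ N (s≤s (z≤n {1})))) ⟩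
  scale N                                       ≤⟨ ℕ.m≤m+n (scale N) (5 ℕ.+ N) ⟩
  exponent N                                    ≤⟨ ℕ.m≤n+m (exponent N) (0 ℕ.^ exponent N) ⟩
  0 ℕ.^ exponent N ℕ.+ exponent N               ∎
  where open ℕ.≤-Reasoning
final-bound N l@(suc l′) = begin
  3 ℕ.* suc (2 ℕ.* l) ℕ.^ 5 ℕ.* (suc l ℕ.^ N ℕ.+ N ℕ.+ 3)
    ≡⟨ cong (3 ℕ.* suc (2 ℕ.* l) ℕ.^ 5 ℕ.*_) (ℕ.+-assoc (suc l ℕ.^ N) N 3) ⟩
  3 ℕ.* suc (2 ℕ.* l) ℕ.^ 5 ℕ.* (suc l ℕ.^ N ℕ.+ (N ℕ.+ 3))
    ≤⟨ ℕ.*-mono-≤ (ℕ.*-monoʳ-≤ 3 (ℕ.^-monoˡ-≤ 5 (ℕ.+-monoˡ-≤ (2 ℕ.* l) (s≤s (z≤n {l′})))))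
         (ℕ.+-mono-≤ (ℕ.^-monoˡ-≤ N (ℕ.+-mono-≤ {1} {l} {l} {l ℕ.+ 0} (s≤s z≤n) (ℕ.m≤m+n l 0))) (ℕ.m≤m*n (N ℕ.+ 3) (l ℕ.^ N) {{ℕ.m^n≢0 l N}})) ⟩
  3 ℕ.* (3 ℕ.* l) ℕ.^ 5 ℕ.* ((2 ℕ.* l) ℕ.^ N ℕ.+ (N ℕ.+ 3) ℕ.* l ℕ.^ N)
    ≡⟨ cong₂ (λ a b → 3 ℕ.* a ℕ.* (b ℕ.+ (N ℕ.+ 3) ℕ.* l ℕ.^ N)) (^-distribʳ-* 5 3 l) (^-distribʳ-* N 2 l) ⟩
  3 ℕ.* (243 ℕ.* l ℕ.^ 5) ℕ.* (2 ℕ.^ N ℕ.* l ℕ.^ N ℕ.+ (N ℕ.+ 3) ℕ.* l ℕ.^ N)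
    ≡⟨ collect (l ℕ.^ 5) (2 ℕ.^ N) (N ℕ.+ 3) (l ℕ.^ N) ⟩
  scale N ℕ.* (l ℕ.^ 5 ℕ.* l ℕ.^ N)
    ≡⟨ cong (scale N ℕ.*_) (ℕ.^-distribˡ-+-* l 5 N) ⟨
  scale N ℕ.* l ℕ.^ (5 ℕ.+ N)
    ≤⟨ absorb-scale (scale N) (5 ℕ.+ N) l ⟩
  l ℕ.^ exponent N ℕ.+ exponent N ∎
  where
  open ℕ.≤-Reasoning
  collect : ∀ p q m s → 3 ℕ.* (243 ℕ.* p) ℕ.* (q ℕ.* s ℕ.+ m ℕ.* s) ≡ 729 ℕ.* (q ℕ.+ m) ℕ.* (p ℕ.* s)
  collect = ℕ-Ring.solve-∀

depth-absorbed : ∀ N l → depth (suc (2 ℕ.* l)) ℕ.* (suc l ℕ.^ N ℕ.+ N ℕ.+ 3) ℕ.≤ l ℕ.^ exponent N ℕ.+ exponent N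
depth-absorbed N l = ℕ.≤-trans (ℕ.*-monoˡ-≤ (suc l ℕ.^ N ℕ.+ N ℕ.+ 3) (depth≤3d⁵ (2 ℕ.* l))) (final-bound N l)

-- Composed functions

product-represents : ∀ {n} (k : Fin n → ℕ) → ∃ λ K → Represents {∀ i → Fin (k i)} (λ x y → ∀ i → x i ≡ y i) K
product-represents {zero}  k = 1 , record { ~-refl = λ _ _ → refl ; pick = λ _ () ; index = λ _ → zero ; sound = λ _ () }
product-represents {suc n} k with K , R ← product-represents (k ∘ suc) = k zero ℕ.* K , record
  { ~-refl = λ _ _ → refl
  ; pick   = pick
  ; index  = λ x → Fin.combine (x zero) (R.index (x ∘ suc))
  ; sound  = λ
      { x zero    → cong proj₁ (Fin.remQuot-combine {k zero} {K} (x zero) (R.index (x ∘ suc)))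
      ; x (suc i) → trans (cong (λ p → R.pick (proj₂ p) i) (Fin.remQuot-combine {k zero} {K} (x zero) (R.index (x ∘ suc)))) (R.sound (x ∘ suc) i) }
  }
  where
  module R = Represents R
  pick : Fin (k zero ℕ.* K) → ∀ i → Fin (k i)
  pick p zero    = proj₁ (Fin.remQuot {k zero} K p)
  pick p (suc i) = R.pick (proj₂ (Fin.remQuot {k zero} K p)) i

compose-cong : ∀ {n} {X Y : Fin n → Set} {A B : Set} (f : Vec A n → B) (g : ∀ i → X i → Y i → A) {x x′ y y′} →
  (∀ i → x i ≡ x′ i) → (∀ i → y i ≡ y′ i) → compose f g x y ≡ compose f g x′ y′
compose-cong f g x≡ y≡ = cong f (Vec.tabulate-cong λ i → cong₂ (g i) (x≡ i) (y≡ i))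

lookup-gates : ∀ {n} (z X Y : Cube n) i → lookup (gates z X Y) i ≡ gate (lookup z i) (lookup X i) (lookup Y i)
lookup-gates (g ∷ z) (x ∷ X) (y ∷ Y) zero    = refl
lookup-gates (g ∷ z) (x ∷ X) (y ∷ Y) (suc i) = lookup-gates z X Y i

splice : ∀ {n} {X : Fin n → Set} j → X j → (∀ i → X i) → ∀ i → X i
splice j a x i with j Fin.≟ i
... | yes refl = a
... | no _     = x i

splice-lookup : ∀ {n} {X Y : Fin n → Set} (g : ∀ i → X i → Y i → Bool) (v : Cube n) j a b x y →
  (∀ i → g i (x i) (y i) ≡ lookup v i) →
  tabulate (λ i → g i (splice {X = X} j a x i) (splice {X = Y} j b y i)) ≡ v [ j ]≔ g j a b
splice-lookup g v j a b x y e = lookup-ext λ i → trans (Vec.lookup∘tabulate _ i) (at i)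
  where
  at : ∀ i → g i (splice j a x i) (splice j b y i) ≡ lookup (v [ j ]≔ g j a b) i
  at i with j Fin.≟ i
  ... | yes refl = sym (Vec.lookup∘update j v (g j a b))
  ... | no j≢i   = trans (e i) (sym (Vec.lookup∘update′ (j≢i ∘ sym) v (g j a b)))

-- The entries selected by φ are ε times the shorter vectors, so a relation among the longer vectors
-- restricts to one among the shorter.
scaled-restriction : ∀ {s I J} (t : Fin s → I → Sign) (u : Fin s → J → Sign) (φ : I → J) {ε} → ε ≢ 0ℚ →
  (∀ k i → sign (u k (φ i)) ≡ ε * sign (t k i)) →
  LinearlyIndependent (λ k i → signToℝ (t k i)) → LinearlyIndependent (λ k j → signToℝ (u k j))
scaled-restriction {s} {I} t u φ {ε} ε≢0 scaled li a null = li a λ i → Null⇒≈0 {Defs.sum λ k → a k Defs.* signToℝ (t k i)}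
  (Null-cong (λ n → sym (seq-combination a (λ k → t k i) n))
    (Null-cancel {ε} ε≢0 (Null-cong (λ n → trans (seq-combination a (λ k → u k (φ i)) n) (factor i n))
      (≈0⇒Null {Defs.sum λ k → a k Defs.* signToℝ (u k (φ i))} (null (φ i))))))
  where
  factor : ∀ i n → sum (λ k → seq (a k) n * sign (u k (φ i))) ≡ ε * sum (λ k → seq (a k) n * sign (t k i))
  factor i n = trans
    (sum-cong-≗ λ k → trans (cong (seq (a k) n *_) (scaled k i))
      (solve 3 (λ a e s → a :* (e :* s) := e :* (a :* s)) refl (seq (a k) n) ε (sign (t k i))))
    (sym (*-distribˡ-sum ε λ k → seq (a k) n * sign (t k i)))

sign≢0 : ∀ s → sign s ≢ 0ℚ
sign≢0 Sign.+ ()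
sign≢0 Sign.- ()

-- A nonconstant sign of one bit is plus or minus the character -1^b; this is where ±G_j appears
-- inside F.
sign-bit : ∀ (h : Bool → Sign) → h true ≢ h false → ∀ b → sign (h b) ≡ sign (h false) * sign (-1^ b)
sign-bit h h≢ b with h true in eq | h false in eq′ | b
... | Sign.+ | Sign.+ | _     = contradiction refl h≢
... | Sign.- | Sign.- | _     = contradiction refl h≢
... | Sign.+ | Sign.- | true  = cong sign eq
... | Sign.+ | Sign.- | false = cong sign eq′
... | Sign.- | Sign.+ | true  = cong sign eq
... | Sign.- | Sign.+ | false = cong sign eq′

-- Submatrices of the composed matrix and the resulting protocol

module Composition {n} (f : Cube n → Sign) (k l : Fin n → ℕ) (g : ∀ i → Fin (k i) → Fin (l i) → Bool)
  (gadgets : ∀ i → ContainsSubmatrix (matrix₂₂ true false false false) (g i) × ContainsSubmatrix (matrix₂₂ false true true true) (g i)) where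

  -- The exceptional entry of each pattern sits at index `zero`. That index stands for `true` in the
  -- AND pattern and for `false` in the OR pattern.
  row : ∀ i → Bool → Bool → Fin (k i)
  row i false b with (ρ , _) , _ ← gadgets i = ρ (if b then zero else suc zero)
  row i true  b with _ , (ρ , _) ← gadgets i = ρ (if b then suc zero else zero)

  column : ∀ i → Bool → Bool → Fin (l i)
  column i false b with (_ , κ , _) , _ ← gadgets i = κ (if b then zero else suc zero)
  column i true  b with _ , (_ , κ , _) ← gadgets i = κ (if b then suc zero else zero)

  g-gate : ∀ i z a b → g i (row i z a) (column i z b) ≡ gate z a b
  g-gate i false a b with (_ , _ , _ , _ , e) , _ ← gadgets i = trans (e _ _) (table a b)
    where
    table : ∀ a b → matrix₂₂ true false false false (if a then zero else suc zero) (if b then zero else suc zero) ≡ a ∧ b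
    table true  true  = refl
    table true  false = refl
    table false true  = refl
    table false false = refl
  g-gate i true a b with _ , (_ , _ , _ , _ , e) ← gadgets i = trans (e _ _) (table a b)
    where
    table : ∀ a b → matrix₂₂ false true true true (if a then suc zero else zero) (if b then suc zero else zero) ≡ a ∨ b
    table true  true  = refl
    table true  false = refl
    table false true  = refl
    table false false = refl

  rows : Cube n → Cube n → ∀ i → Fin (k i)
  rows z X i = row i (lookup z i) (lookup X i)

  cols : Cube n → Cube n → ∀ i → Fin (l i)
  cols z Y i = column i (lookup z i) (lookup Y i)

  F-gates : ∀ z X Y → compose f g (rows z X) (cols z Y) ≡ f (gates z X Y)
  F-gates z X Y = cong f (lookup-ext λ i → trans (Vec.lookup∘tabulate _ i)
    (trans (g-gate i (lookup z i) (lookup X i) (lookup Y i)) (sym (lookup-gates z X Y i))))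

  rank-F : ∃ λ r → IsRank (λ x y → signToℝ (compose f g x y)) r
  rank-F = rank-exists (compose f g) (proj₂ (product-represents k)) (proj₂ (product-represents l)) (compose-cong f g)

  complexity-F : ∀ π → Computes π (compose f g) → ∃ λ d → IsCommunicationComplexity (compose f g) d × d ℕ.≤ cost π
  complexity-F = complexity-exists (compose f g) (proj₂ (product-represents k)) (proj₂ (product-represents l)) (compose-cong f g)

  monomials≤rank : ∀ {r} → IsRank (λ x y → signToℝ (compose f g x y)) r → ∀ z → monomials (sign ∘ f) z ℕ.≤ r
  monomials≤rank (_ , maximal) z = maximal (cols z ∘ columns (sign ∘ f) z)
    (Independent⇒LinearlyIndependent (λ k x → compose f g x (cols z (columns (sign ∘ f) z k)))
      λ a null → columns-independent (sign ∘ f) z a λ X → Null-cong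
        (λ m → sum-cong-≗ λ k → cong (λ s → a k m * sign s) (F-gates z X (columns (sign ∘ f) z k)))
        (null (rows z X)))

  -- A witness X₀ of relevance is realised off j through AND patterns with column bit `true`,
  -- leaving coordinate j free. There F equals f(X₀ with bit j set to g_j), which is ± G_j.
  rank-mono : ∀ {r} → IsRank (λ x y → signToℝ (compose f g x y)) r → ∀ j → Relevant f j →
    ∀ {s} → IsRank (λ x y → signToℝ (-1^ g j x y)) s → s ℕ.≤ r
  rank-mono (_ , maximal) j (X₀ , f≢) ((κ , li) , _) = maximal (y ∘ κ)
    (scaled-restriction (λ m i → -1^ g j i (κ m)) (λ m z → compose f g z (y (κ m))) x (sign≢0 (f (X₀ [ j ]≔ false))) (λ m i → F-restricted i (κ m)) li)
    where
    x₀ : ∀ i → Fin (k i)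
    x₀ i = row i false (lookup X₀ i)
    y₀ : ∀ i → Fin (l i)
    y₀ i = column i false true
    x : Fin (k j) → ∀ i → Fin (k i)
    x a = splice {X = Fin ∘ k} j a x₀
    y : Fin (l j) → ∀ i → Fin (l i)
    y b = splice {X = Fin ∘ l} j b y₀
    ε : ℚ
    ε = sign (f (X₀ [ j ]≔ false))
    F-restricted : ∀ a b → sign (compose f g (x a) (y b)) ≡ ε * sign (-1^ g j a b)
    F-restricted a b = trans (cong (sign ∘ f) (splice-lookup {X = Fin ∘ k} {Y = Fin ∘ l} g X₀ j a b x₀ y₀
      λ i → trans (g-gate i false (lookup X₀ i) true) (∧-true (lookup X₀ i)))) (sign-bit (λ b → f (X₀ [ j ]≔ b)) f≢ (g j a b))
      where
      ∧-true : ∀ b → b ∧ true ≡ b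
      ∧-true true  = refl
      ∧-true false = refl
  module Bound (r d m : ℕ) (rank : IsRank (λ x y → signToℝ (compose f g x y)) r)
    (small : ∀ s → 3 ℕ.^ s ℕ.≤ 2 ℕ.^ s ℕ.* r → s ℕ.≤ d)
    (cheap : ∀ j → Relevant f j → ∃ λ π → Computes π (g j) × cost π ℕ.≤ m) where

    low-degree : DegLe d (sign ∘ f)
    low-degree S d<S = decidable-stable (coef (sign ∘ f) S ℚ.≟ 0ℚ) λ c≢0 → ℕ.<⇒≱ d<S (S≤ (many-monomials (sign ∘ f) S c≢0))
      where
      S≤ : (∃ λ z → 3 ℕ.^ size S ℕ.≤ 2 ℕ.^ size S ℕ.* monomials (sign ∘ f) z) → size S ℕ.≤ d
      S≤ (z , many) = small (size S) (ℕ.≤-trans many (ℕ.*-monoʳ-≤ (2 ℕ.^ size S) (monomials≤rank rank z)))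

    inputs : (∀ i → Fin (k i)) → (∀ i → Fin (l i)) → Cube n
    inputs x y = tabulate λ i → g i (x i) (y i)

    bit-protocol : ∀ j → Relevant f j → ∃ λ π → Computes π (λ x y → lookup (inputs x y) j) × cost π ℕ.≤ m
    bit-protocol j rel = build (cheap j rel)
      where
      build : (∃ λ π → Computes π (g j) × cost π ℕ.≤ m) → ∃ λ π → Computes π (λ x y → lookup (inputs x y) j) × cost π ℕ.≤ m
      build (π , π-computes , π≤) =
        pullback (λ x → x j) (λ y → y j) π ,
        (λ x y → trans (run-pullback (λ x → x j) (λ y → y j) π x y)
          (trans (π-computes (x j) (y j)) (sym (Vec.lookup∘tabulate (λ i → g i (x i) (y i)) j)))) ,
        subst (ℕ._≤ m) (sym (cost-pullback (λ x → x j) (λ y → y j) π)) π≤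

    protocol : ∃ λ π → Computes π (compose f g) × cost π ℕ.≤ depth d ℕ.* m
    protocol = tree-protocol inputs (decision-tree d f low-degree) bit-protocol

    log-rank-bound : ∀ C .{{_ : ℕ.NonZero C}} → depth d ℕ.* m ℕ.≤ ⌊log₂ r ⌋ ℕ.^ C ℕ.+ C → LogRankBound (compose f g) (compose f g) (fromℕ C)
    log-rank-bound C ≤C = conclude protocol
      where
      conclude : (∃ λ π → Computes π (compose f g) × cost π ℕ.≤ depth d ℕ.* m) → LogRankBound (compose f g) (compose f g) (fromℕ C)
      conclude (π , π-computes , π≤) = finish (complexity-F π π-computes)
        where
        finish : (∃ λ e → IsCommunicationComplexity (compose f g) e × e ℕ.≤ cost π) → LogRankBound (compose f g) (compose f g) (fromℕ C)
        finish (e , complexity , e≤) = e , r , log₂ r Defs.^ C , complexity , rank , natural-power r C ,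
          natural-≤-power e r C (ℕ.≤-trans e≤ (ℕ.≤-trans π≤ ≤C))

-- Gadget costs in terms of rk F, and the final bound

cheap-protocol : ∀ {X Y} {h : X → Y → Bool} {M : Matrix Sign X Y} {c} N r → 0# < c → c Defs.≤ fromℕ N → LogRankBound h M c →
  (∀ {s} → IsRank (λ x y → signToℝ (M x y)) s → s ℕ.≤ r) →
  ∃ λ π → Computes π h × cost π ℕ.≤ suc ⌊log₂ r ⌋ ℕ.^ N ℕ.+ N ℕ.+ 3
cheap-protocol {c = c} N r c>0 c≤N (d , s , y , ((π , π-computes , π≡d) , _) , rank , y-power , d≤) s≤r = π , π-computes , (begin
  cost π                                         ≡⟨ π≡d ⟩
  d                                              ≤⟨ complexity-bound {c} {y} N s d c>0 c≤N y-power d≤ ⟩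
  suc ⌊log₂ s ⌋ ℕ.^ N ℕ.+ N ℕ.+ 3                ≤⟨ ℕ.+-monoˡ-≤ 3 (ℕ.+-monoˡ-≤ N (ℕ.^-monoˡ-≤ N (s≤s (⌊log₂⌋-mono-≤ (s≤r rank))))) ⟩
  suc ⌊log₂ r ⌋ ℕ.^ N ℕ.+ N ℕ.+ 3                ∎)
  where open ℕ.≤-Reasoning

fromℕ-positive : ∀ n .{{_ : ℕ.NonZero n}} → 0# < fromℕ n
fromℕ-positive n = 1ℚ , _ , 0 , λ _ → ι-mono-≤ {1} {n} (ℕ.>-nonZero⁻¹ n)

exponent≢0 : ∀ N → ℕ.NonZero (exponent N)
exponent≢0 N = ℕ.>-nonZero (ℕ.≤-trans (s≤s z≤n) (ℕ.m≤n+m (5 ℕ.+ N) (scale N)))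

-- The variable l will be `⌊log₂ r ⌋`; quantifying over it here keeps C independent of f and of the
-- gadgets.
Absorbs : ℕ → ℕ → Set
Absorbs N C = ∀ l → depth (suc (2 ℕ.* l)) ℕ.* (suc l ℕ.^ N ℕ.+ N ℕ.+ 3) ℕ.≤ l ℕ.^ C ℕ.+ C

composed-log-rank-bound : ∀ {c N C} .{{_ : ℕ.NonZero C}} → 0# < c → c Defs.≤ fromℕ N → Absorbs N C →
  ∀ n (f : Cube n → Sign) (k l : Fin n → ℕ) (g : ∀ i → Fin (k i) → Fin (l i) → Bool) →
  (∀ i → ContainsSubmatrix (matrix₂₂ true false false false) (g i) × ContainsSubmatrix (matrix₂₂ false true true true) (g i)) →
  (∀ i → LogRankBound (g i) (λ x y → -1^ (g i x y)) c) →
  LogRankBound (compose f g) (compose f g) (fromℕ C)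
composed-log-rank-bound {c} {N} {C} c>0 c≤N absorbs n f k l g gadgets bounds = with-rank rank-F
  where
  open Composition f k l g gadgets
  with-rank : (∃ λ r → IsRank (λ x y → signToℝ (compose f g x y)) r) → LogRankBound (compose f g) (compose f g) (fromℕ C)
  with-rank (r , rank) = Bound.log-rank-bound r (suc (2 ℕ.* ⌊log₂ r ⌋)) (suc ⌊log₂ r ⌋ ℕ.^ N ℕ.+ N ℕ.+ 3) rank
    (λ s → size-bound s r)
    (λ j rel → cheap-protocol {M = λ x y → -1^ (g j x y)} {c} N r c>0 c≤N (bounds j) (rank-mono rank j rel))
    C (absorbs ⌊log₂ r ⌋)

theorem7p2 : ∀ (c : ℝ) → 0# < c →
    ∃ λ (C : ℝ) → 0# < C ×
    (∀ (n : ℕ) (f : Vec Bool n → Sign)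
    (k l : Fin n → ℕ) (g : ∀ i → Fin (k i) → Fin (l i) → Bool) →
    (∀ i → ContainsSubmatrix (matrix₂₂ true false false false) (g i) ×
    ContainsSubmatrix (matrix₂₂ false true true true) (g i)) →
    (∀ i → LogRankBound (g i) (λ x y → -1^ (g i x y)) c) →
    LogRankBound (compose f g) (compose f g) C)
theorem7p2 c c>0 = fromℕ C , fromℕ-positive C , composed-log-rank-bound {c} {N} {C} c>0 (proj₂ (natural-bound c)) (depth-absorbed N)
  where
  N C : ℕ
  N = proj₁ (natural-bound c)
  C = exponent N
  instance _ = exponent≢0 N
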